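{- Fix a positive integer $r$ and $\epsilon>0$. There is a constant $\kappa=\kappa(r,\epsilon)>0$, depending only on $r$ and $\epsilon$, and there are deterministic algorithms which, given an integer $n\ge2$, run in time polynomial in $n$ and construct, respectively: (a) $k\le\kappa\ln n$ linear forms $\ell_1,\ldots,\ell_k:\mathbb{R}^n\to\mathbb{R}$ such that in the monomial expansion $\sum_{i=1}^k\ell_i(\mathbf{x})^r=\sum_a\tilde h_{r,a}\mathbf{x}^a$ one has $(1-\epsilon)^r\le\tilde h_{r,a}\le(1+\epsilon)^r$ for all non-negative integer vectors $a=(\alpha_1,\ldots,\alpha_n)$ with $\alpha_1+\cdots+\alpha_n=r$; (b) an integer $k\le\kappa\ln n$ and linear forms $\ell_{ij}:\mathbb{R}^n\to\mathbb{R}$, $1\le i\le k$, $1\le j\le r$, such that $\sum_{i=1}^k\prod_{j=1}^r\ell_{ij}(\mathbf{x})=\sum_I\tilde e_{r,I}\prod_{i\in I}x_i$, where $I$ ranges over the $r$-element subsets of $\{1,\ldots,n\}$, and $(1-\epsilon)^r\le\tilde e_{r,I}\le(1+\epsilon)^r$ for every such $I$.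
   Context: $\mathbf{x}=(x_1,\ldots,x_n)$ and $\mathbf{x}^a=x_1^{\alpha_1}\cdots x_n^{\alpha_n}$ for $a=(\alpha_1,\ldots,\alpha_n)$. A linear form is a homogeneous linear function $\mathbb{R}^n\to\mathbb{R}$. -}

module Defs where

open import Algebra.Bundles.Raw using (RawSemiring)
import Algebra.Definitions.RawSemiring
open import Data.Bool.Base using (if_then_else_)
open import Data.Fin.Base using (Fin; toℕ; combine)
open import Data.Fin.Subset using (Subset; inside; outside; ∣_∣)
open import Data.Fin.Subset.Properties using (_∈?_)
open import Data.Integer.Base as ℤ using (+_; _⊖_)
import Data.Integer.Properties as ℤP
open import Data.List.Base using (List; []; _∷_; foldr; map; filter; upTo; allFin; cartesianProductWith)
open import Data.Nat.Base as ℕ using (ℕ; zero; suc; NonZero)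
import Data.Nat.Properties as ℕP
open import Data.Product.Base using (∃-syntax; _×_; _,_; proj₁; proj₂)
open import Data.Rational.Base as ℚ using (ℚ; 0ℚ; 1ℚ)
import Data.Rational.Properties as ℚP
import Data.Rational.Unnormalised.Base as ℚᵘ
import Data.Rational.Unnormalised.Properties as ℚᵘP
open import Data.Rational.Solver using (module +-*-Solver)
open import Data.Sum.Base using (inj₁; inj₂)
open import Data.Vec.Base using (Vec; []; _∷_; lookup; sum)
open import Level using (0ℓ)
open import Relation.Nullary.Decidable using (does)
open import Relation.Binary.PropositionalEquality
  using (_≡_; _≢_; refl; sym; trans; cong; cong₂; subst; subst₂)

------------------------------------------------------------------------
-- Real numbers: Cauchy sequences of rationals.  All operations are
-- pointwise, and equality of reals is _≃ᴿ_.

IsCauchy : (ℕ → ℚ) → Set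
IsCauchy x = ∀ δ → 0ℚ ℚ.< δ →
  ∃[ N ] (∀ m n → N ℕ.≤ m → N ℕ.≤ n → ℚ.∣ x m ℚ.- x n ∣ ℚ.≤ δ)

record ℝ : Set where
  constructor mkℝ
  field
    seq    : ℕ → ℚ
    cauchy : IsCauchy seq

open ℝ public

infix 4 _≃ᴿ_ _≤ᴿ_ _<ᴿ_

_≃ᴿ_ : ℝ → ℝ → Set
x ≃ᴿ y = ∀ δ → 0ℚ ℚ.< δ → ∃[ N ] (∀ m → N ℕ.≤ m → ℚ.∣ seq x m ℚ.- seq y m ∣ ℚ.≤ δ)

_≤ᴿ_ : ℝ → ℝ → Set
x ≤ᴿ y = ∀ δ → 0ℚ ℚ.< δ → ∃[ N ] (∀ m → N ℕ.≤ m → seq x m ℚ.≤ seq y m ℚ.+ δ)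

_<ᴿ_ : ℝ → ℝ → Set
x <ᴿ y = ∃[ δ ] (0ℚ ℚ.< δ × ∃[ N ] (∀ m → N ℕ.≤ m → seq x m ℚ.+ δ ℚ.≤ seq y m))

fromℚ : ℚ → ℝ
fromℚ q = mkℝ (λ _ → q) λ δ 0<δ → 0 , λ _ _ _ _ →
  subst (ℚ._≤ δ) (sym (cong ℚ.∣_∣ (ℚP.+-inverseʳ q))) (ℚP.<⇒≤ 0<δ)

fromℕ : ℕ → ℝ
fromℕ n = fromℚ (+ n ℚ./ 1)

0ᴿ 1ᴿ : ℝ
0ᴿ = fromℚ 0ℚ
1ᴿ = fromℚ 1ℚ

module _ {δ : ℚ} (0<δ : 0ℚ ℚ.< δ) where
  private instance
    pos-δ : ℚ.Positive δ
    pos-δ = ℚ.positive 0<δ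

  0<half : 0ℚ ℚ.< δ ℚ.* ℚ.½
  0<half = ℚP.positive⁻¹ _ {{ℚP.pos*pos⇒pos δ ℚ.½}}

halves : ∀ δ → δ ℚ.* ℚ.½ ℚ.+ δ ℚ.* ℚ.½ ≡ δ
halves δ = trans (sym (ℚP.*-distribˡ-+ δ ℚ.½ ℚ.½)) (ℚP.*-identityʳ δ)

infixl 6 _+ᴿ_ _-ᴿ_
infixl 7 _*ᴿ_
infix  8 -ᴿ_

_+ᴿ_ : ℝ → ℝ → ℝ
x +ᴿ y = mkℝ (λ m → seq x m ℚ.+ seq y m) λ δ 0<δ →
  let (M , p) = cauchy x (δ ℚ.* ℚ.½) (0<half 0<δ)
      (N , q) = cauchy y (δ ℚ.* ℚ.½) (0<half 0<δ)
  in M ℕ.⊔ N , λ m n m≥ n≥ → begin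
    ℚ.∣ (seq x m ℚ.+ seq y m) ℚ.- (seq x n ℚ.+ seq y n) ∣
      ≡⟨ cong ℚ.∣_∣ (rearrange (seq x m) (seq y m) (seq x n) (seq y n)) ⟩
    ℚ.∣ (seq x m ℚ.- seq x n) ℚ.+ (seq y m ℚ.- seq y n) ∣
      ≤⟨ ℚP.∣p+q∣≤∣p∣+∣q∣ (seq x m ℚ.- seq x n) (seq y m ℚ.- seq y n) ⟩
    ℚ.∣ seq x m ℚ.- seq x n ∣ ℚ.+ ℚ.∣ seq y m ℚ.- seq y n ∣
      ≤⟨ ℚP.+-mono-≤ (p m n (ℕP.m⊔n≤o⇒m≤o M N m≥) (ℕP.m⊔n≤o⇒m≤o M N n≥))
                     (q m n (ℕP.m⊔n≤o⇒n≤o M N m≥) (ℕP.m⊔n≤o⇒n≤o M N n≥)) ⟩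
    δ ℚ.* ℚ.½ ℚ.+ δ ℚ.* ℚ.½
      ≡⟨ halves δ ⟩
    δ ∎
  where
  open ℚP.≤-Reasoning
  rearrange : ∀ a b c d → (a ℚ.+ b) ℚ.- (c ℚ.+ d) ≡ (a ℚ.- c) ℚ.+ (b ℚ.- d)
  rearrange = solve 4 (λ a b c d → ((a :+ b) :- (c :+ d)) := ((a :- c) :+ (b :- d))) refl
    where open +-*-Solver

-ᴿ_ : ℝ → ℝ
-ᴿ x = mkℝ (λ m → ℚ.- seq x m) λ δ 0<δ →
  let (N , p) = cauchy x δ 0<δ in
  N , λ m n m≥ n≥ → subst (ℚ._≤ δ) (eq (seq x m) (seq x n)) (p m n m≥ n≥)
  where
  neg-diff : ∀ a b → ℚ.- (a ℚ.- b) ≡ (ℚ.- a) ℚ.- (ℚ.- b)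
  neg-diff = solve 2 (λ a b → (:- (a :- b)) := ((:- a) :- (:- b))) refl
    where open +-*-Solver
  eq : ∀ a b → ℚ.∣ a ℚ.- b ∣ ≡ ℚ.∣ (ℚ.- a) ℚ.- (ℚ.- b) ∣
  eq a b = trans (sym (ℚP.∣-p∣≡∣p∣ (a ℚ.- b))) (cong ℚ.∣_∣ (neg-diff a b))

_-ᴿ_ : ℝ → ℝ → ℝ
x -ᴿ y = x +ᴿ (-ᴿ y)

eventuallyBounded : (x : ℝ) →
  ∃[ B ] (0ℚ ℚ.< B × ∃[ N ] (∀ m → N ℕ.≤ m → ℚ.∣ seq x m ∣ ℚ.≤ B))
eventuallyBounded x = B , 0<B , N , λ m m≥ → begin
  ℚ.∣ seq x m ∣                               ≡⟨ cong ℚ.∣_∣ (split (seq x m) (seq x N)) ⟩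
  ℚ.∣ seq x N ℚ.+ (seq x m ℚ.- seq x N) ∣       ≤⟨ ℚP.∣p+q∣≤∣p∣+∣q∣ (seq x N) (seq x m ℚ.- seq x N) ⟩
  ℚ.∣ seq x N ∣ ℚ.+ ℚ.∣ seq x m ℚ.- seq x N ∣    ≤⟨ ℚP.+-monoʳ-≤ ℚ.∣ seq x N ∣ (proj₂ c m N m≥ ℕP.≤-refl) ⟩
  B                                          ∎
  where
  open ℚP.≤-Reasoning
  c = cauchy x 1ℚ (ℚP.positive⁻¹ 1ℚ)
  N = proj₁ c
  B = ℚ.∣ seq x N ∣ ℚ.+ 1ℚ
  0<B : 0ℚ ℚ.< B
  0<B = ℚP.+-mono-≤-< (ℚP.0≤∣p∣ (seq x N)) (ℚP.positive⁻¹ 1ℚ)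
  split : ∀ a b → a ≡ b ℚ.+ (a ℚ.- b)
  split = solve 2 (λ a b → a := (b :+ (a :- b))) refl
    where open +-*-Solver

mul-bound : ∀ a b {C D} → 0ℚ ℚ.< C → ℚ.∣ a ∣ ℚ.≤ C → ℚ.∣ b ∣ ℚ.≤ D → ℚ.∣ a ℚ.* b ∣ ℚ.≤ C ℚ.* D
mul-bound a b {C} {D} 0<C a≤ b≤ = begin
  ℚ.∣ a ℚ.* b ∣         ≡⟨ ℚP.∣p*q∣≡∣p∣*∣q∣ a b ⟩
  ℚ.∣ a ∣ ℚ.* ℚ.∣ b ∣    ≤⟨ ℚP.*-monoʳ-≤-nonNeg ℚ.∣ b ∣ {{ℚP.∣-∣-nonNeg b}} a≤ ⟩
  C ℚ.* ℚ.∣ b ∣         ≤⟨ ℚP.*-monoˡ-≤-nonNeg C {{ℚ.nonNegative (ℚP.<⇒≤ 0<C)}} b≤ ⟩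
  C ℚ.* D              ∎
  where open ℚP.≤-Reasoning

scale-down : ∀ B δ → 0ℚ ℚ.< B → 0ℚ ℚ.< δ → ∃[ δ′ ] (0ℚ ℚ.< δ′ × B ℚ.* δ′ ≡ δ)
scale-down B δ 0<B 0<δ = δ ℚ.* B⁻¹ , 0<δ′ , trans (swap B δ B⁻¹)
    (trans (cong (δ ℚ.*_) (ℚP.*-inverseʳ B {{nzB}})) (ℚP.*-identityʳ δ))
  where
  posB : ℚ.Positive B
  posB = ℚ.positive 0<B
  nzB : ℚ.NonZero B
  nzB = ℚP.pos⇒nonZero B {{posB}}
  B⁻¹ : ℚ
  B⁻¹ = ℚ.1/_ B {{nzB}}
  0<δ′ : 0ℚ ℚ.< δ ℚ.* B⁻¹
  0<δ′ = ℚP.positive⁻¹ _ {{ℚP.pos*pos⇒pos δ {{ℚ.positive 0<δ}} B⁻¹ {{ℚP.1/pos⇒pos B {{posB}}}}}}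
  swap : ∀ a b c → a ℚ.* (b ℚ.* c) ≡ b ℚ.* (a ℚ.* c)
  swap a b c = trans (sym (ℚP.*-assoc a b c)) (trans (cong (ℚ._* c) (ℚP.*-comm a b)) (ℚP.*-assoc b a c))

*-cauchy : (x y : ℝ) → IsCauchy (λ m → seq x m ℚ.* seq y m)
*-cauchy x y δ 0<δ =
  let Bx , 0<Bx , Nx , bx = eventuallyBounded x
      By , 0<By , Ny , by = eventuallyBounded y
      δ′ , 0<δ′ , eq = scale-down (Bx ℚ.+ By) δ (ℚP.+-mono-< 0<Bx 0<By) 0<δ
      Mx , p = cauchy x δ′ 0<δ′
      My , q = cauchy y δ′ 0<δ′
  in (Nx ℕ.⊔ Ny) ℕ.⊔ (Mx ℕ.⊔ My) , λ m n m≥ n≥ →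
     let m≥N = ℕP.m⊔n≤o⇒m≤o (Nx ℕ.⊔ Ny) (Mx ℕ.⊔ My) m≥
         m≥M = ℕP.m⊔n≤o⇒n≤o (Nx ℕ.⊔ Ny) (Mx ℕ.⊔ My) m≥
         n≥N = ℕP.m⊔n≤o⇒m≤o (Nx ℕ.⊔ Ny) (Mx ℕ.⊔ My) n≥
         n≥M = ℕP.m⊔n≤o⇒n≤o (Nx ℕ.⊔ Ny) (Mx ℕ.⊔ My) n≥
     in begin
  ℚ.∣ seq x m ℚ.* seq y m ℚ.- seq x n ℚ.* seq y n ∣
    ≡⟨ cong ℚ.∣_∣ (rearrange (seq x m) (seq y m) (seq x n) (seq y n)) ⟩
  ℚ.∣ seq x m ℚ.* (seq y m ℚ.- seq y n) ℚ.+ seq y n ℚ.* (seq x m ℚ.- seq x n) ∣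
    ≤⟨ ℚP.∣p+q∣≤∣p∣+∣q∣ (seq x m ℚ.* (seq y m ℚ.- seq y n)) (seq y n ℚ.* (seq x m ℚ.- seq x n)) ⟩
  ℚ.∣ seq x m ℚ.* (seq y m ℚ.- seq y n) ∣ ℚ.+ ℚ.∣ seq y n ℚ.* (seq x m ℚ.- seq x n) ∣
    ≤⟨ ℚP.+-mono-≤
         (mul-bound (seq x m) (seq y m ℚ.- seq y n) 0<Bx (bx m (ℕP.m⊔n≤o⇒m≤o Nx Ny m≥N))
           (q m n (ℕP.m⊔n≤o⇒n≤o Mx My m≥M) (ℕP.m⊔n≤o⇒n≤o Mx My n≥M)))
         (mul-bound (seq y n) (seq x m ℚ.- seq x n) 0<By (by n (ℕP.m⊔n≤o⇒n≤o Nx Ny n≥N))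
           (p m n (ℕP.m⊔n≤o⇒m≤o Mx My m≥M) (ℕP.m⊔n≤o⇒m≤o Mx My n≥M))) ⟩
  Bx ℚ.* δ′ ℚ.+ By ℚ.* δ′
    ≡⟨ sym (ℚP.*-distribʳ-+ δ′ Bx By) ⟩
  (Bx ℚ.+ By) ℚ.* δ′
    ≡⟨ eq ⟩
  δ ∎
  where
  open ℚP.≤-Reasoning
  rearrange : ∀ a b c d → a ℚ.* b ℚ.- c ℚ.* d ≡ a ℚ.* (b ℚ.- d) ℚ.+ d ℚ.* (a ℚ.- c)
  rearrange = solve 4 (λ a b c d → ((a :* b) :- (c :* d)) := ((a :* (b :- d)) :+ (d :* (a :- c)))) refl
    where open +-*-Solver

_*ᴿ_ : ℝ → ℝ → ℝ
x *ᴿ y = mkℝ (λ m → seq x m ℚ.* seq y m) (*-cauchy x y)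

ℝ-rawSemiring : RawSemiring 0ℓ 0ℓ
ℝ-rawSemiring = record
  { Carrier = ℝ
  ; _≈_     = _≃ᴿ_
  ; _+_     = _+ᴿ_
  ; _*_     = _*ᴿ_
  ; 0#      = 0ᴿ
  ; 1#      = 1ᴿ
  }

open Algebra.Definitions.RawSemiring ℝ-rawSemiring public
  using () renaming (_^_ to infixr 8 _^ᴿ_)

------------------------------------------------------------------------
-- The natural logarithm of a positive integer

-- recipSum a l = 1/(a+1) + 1/(a+2) + … + 1/(a+l)
recipSum : ℕ → ℕ → ℚ
recipSum a zero    = 0ℚ
recipSum a (suc l) = (+ 1 ℚ./ suc a) ℚ.+ recipSum (suc a) l

-- The right Riemann sum of ∫₁ⁿ dt/t with mesh 1/N, where N = m + 1:
-- the nodes are t = (N + i)/N for 1 ≤ i ≤ (n - 1) N, and (1/N)(1/t) = 1/(N + i).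
lnSeq : ℕ → ℕ → ℚ
lnSeq n m = recipSum (suc m) ((n ℕ.∸ 1) ℕ.* suc m)

module LnCauchy where
  open ℚP.≤-Reasoning

  /-mono : ∀ a b c d .{{_ : NonZero b}} .{{_ : NonZero d}} →
           a ℕ.* d ℕ.≤ c ℕ.* b → (+ a ℚ./ b) ℚ.≤ (+ c ℚ./ d)
  /-mono a (suc b) c (suc d) h = ℚP.toℚᵘ-cancel-≤ (ℚᵘP.≤-trans
    (ℚᵘP.≤-reflexive (ℚP.toℚᵘ-fromℚᵘ (ℚᵘ.mkℚᵘ (+ a) b)))
    (ℚᵘP.≤-trans
      (ℚᵘ.*≤* (subst₂ ℤ._≤_ (ℤP.pos-* a (suc d)) (ℤP.pos-* c (suc b)) (ℤ.+≤+ h)))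
      (ℚᵘP.≤-reflexive (ℚᵘP.≃-sym (ℚP.toℚᵘ-fromℚᵘ (ℚᵘ.mkℚᵘ (+ c) d))))))

  /-suc : ∀ l c .{{_ : NonZero c}} → (+ 1 ℚ./ c) ℚ.+ (+ l ℚ./ c) ≡ (+ suc l ℚ./ c)
  /-suc l (suc c) = ℚP.toℚᵘ-injective
    (ℚᵘP.≃-trans (ℚP.toℚᵘ-homo-+ (+ 1 ℚ./ suc c) (+ l ℚ./ suc c))
    (ℚᵘP.≃-trans (ℚᵘP.+-cong (ℚP.toℚᵘ-fromℚᵘ (ℚᵘ.mkℚᵘ (+ 1) c)) (ℚP.toℚᵘ-fromℚᵘ (ℚᵘ.mkℚᵘ (+ l) c)))
    (ℚᵘP.≃-trans (ℚᵘ.*≡* eq)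
    (ℚᵘP.≃-sym (ℚP.toℚᵘ-fromℚᵘ (ℚᵘ.mkℚᵘ (+ suc l) c))))))
    where
    eq : (+ 1 ℤ.* + suc c ℤ.+ + l ℤ.* + suc c) ℤ.* + suc c ≡ + suc l ℤ.* + (suc c ℕ.* suc c)
    eq = trans (cong (ℤ._* + suc c) (sym (ℤP.*-distribʳ-+ (+ suc c) (+ 1) (+ l))))
        (trans (ℤP.*-assoc (+ suc l) (+ suc c) (+ suc c))
               (cong (+ suc l ℤ.*_) (sym (ℤP.pos-* (suc c) (suc c)))))

  recip-mono : ∀ a b .{{_ : NonZero a}} .{{_ : NonZero b}} → a ℕ.≤ b → (+ 1 ℚ./ b) ℚ.≤ (+ 1 ℚ./ a)
  recip-mono a b a≤b = /-mono 1 b 1 a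
    (subst₂ ℕ._≤_ (sym (ℕP.*-identityˡ a)) (sym (ℕP.*-identityˡ b)) a≤b)

  recipSum-lower : ∀ b l c .{{_ : NonZero c}} → b ℕ.+ l ℕ.≤ c → (+ l ℚ./ c) ℚ.≤ recipSum b l
  recipSum-lower b zero    c h = ℚP.≤-reflexive (ℚP.0/n≡0 c)
  recipSum-lower b (suc l) c h = begin
    + suc l ℚ./ c                        ≡⟨ sym (/-suc l c) ⟩
    (+ 1 ℚ./ c) ℚ.+ (+ l ℚ./ c)          ≤⟨ ℚP.+-mono-≤ (recip-mono (suc b) c (ℕP.m+n≤o⇒m≤o (suc b) h′))
                                                          (recipSum-lower (suc b) l c h′) ⟩
    recipSum b (suc l)                    ∎
    where h′ = subst (ℕ._≤ c) (ℕP.+-suc b l) h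

  recipSum-upper : ∀ b l c .{{_ : NonZero c}} → c ℕ.≤ suc b → recipSum b l ℚ.≤ (+ l ℚ./ c)
  recipSum-upper b zero    c h = ℚP.≤-reflexive (sym (ℚP.0/n≡0 c))
  recipSum-upper b (suc l) c h = begin
    recipSum b (suc l)                    ≤⟨ ℚP.+-mono-≤ (recip-mono c (suc b) h)
                                                          (recipSum-upper (suc b) l c (ℕP.m≤n⇒m≤1+n h)) ⟩
    (+ 1 ℚ./ c) ℚ.+ (+ l ℚ./ c)          ≡⟨ /-suc l c ⟩
    + suc l ℚ./ c                        ∎

  recipSum-++ : ∀ a l l′ → recipSum a (l ℕ.+ l′) ≡ recipSum a l ℚ.+ recipSum (l ℕ.+ a) l′
  recipSum-++ a zero    l′ = sym (ℚP.+-identityˡ _)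
  recipSum-++ a (suc l) l′ = trans
    (cong ((+ 1 ℚ./ suc a) ℚ.+_)
      (trans (recipSum-++ (suc a) l l′)
             (cong (λ b → recipSum (suc a) l ℚ.+ recipSum b l′) (ℕP.+-suc l a))))
    (sym (ℚP.+-assoc (+ 1 ℚ./ suc a) (recipSum (suc a) l) (recipSum (suc l ℕ.+ a) l′)))

  module _ (M-1 : ℕ) where
    M : ℕ
    M = suc M-1

    M/aM : ∀ a .{{_ : NonZero a}} .{{_ : NonZero (a ℕ.* M)}} → (+ M ℚ./ (a ℕ.* M)) ≡ (+ 1 ℚ./ a)
    M/aM a = ℚP.≤-antisym
      (/-mono M (a ℕ.* M) 1 a (ℕP.≤-reflexive (trans (ℕP.*-comm M a) (sym (ℕP.*-identityˡ (a ℕ.* M))))))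
      (/-mono 1 a M (a ℕ.* M) (ℕP.≤-reflexive (trans (ℕP.*-identityˡ (a ℕ.* M)) (ℕP.*-comm a M))))

    refine-lower : ∀ a l → recipSum a l ℚ.≤ recipSum (a ℕ.* M) (l ℕ.* M)
    refine-lower a zero    = ℚP.≤-refl
    refine-lower a (suc l) = begin
      (+ 1 ℚ./ suc a) ℚ.+ recipSum (suc a) l
        ≤⟨ ℚP.+-mono-≤
             (subst (ℚ._≤ recipSum (a ℕ.* M) M) (M/aM (suc a))
               (recipSum-lower (a ℕ.* M) M (suc a ℕ.* M) (ℕP.≤-reflexive (ℕP.+-comm (a ℕ.* M) M))))
             (refine-lower (suc a) l) ⟩
      recipSum (a ℕ.* M) M ℚ.+ recipSum (M ℕ.+ a ℕ.* M) (l ℕ.* M)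
        ≡⟨ sym (recipSum-++ (a ℕ.* M) M (l ℕ.* M)) ⟩
      recipSum (a ℕ.* M) (suc l ℕ.* M) ∎

    refine-upper : ∀ a l → recipSum (suc a ℕ.* M) (l ℕ.* M) ℚ.≤ recipSum a l
    refine-upper a zero    = ℚP.≤-refl
    refine-upper a (suc l) = begin
      recipSum (suc a ℕ.* M) (suc l ℕ.* M)
        ≡⟨ recipSum-++ (suc a ℕ.* M) M (l ℕ.* M) ⟩
      recipSum (suc a ℕ.* M) M ℚ.+ recipSum (suc (suc a) ℕ.* M) (l ℕ.* M)
        ≤⟨ ℚP.+-mono-≤
             (subst (recipSum (suc a ℕ.* M) M ℚ.≤_) (M/aM (suc a))
               (recipSum-upper (suc a ℕ.* M) M (suc a ℕ.* M) (ℕP.n≤1+n (suc a ℕ.* M))))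
             (refine-upper (suc a) l) ⟩
      recipSum a (suc l) ∎

  recipSum-snoc : ∀ a l → recipSum a l ℚ.≤ recipSum a (suc l)
  recipSum-snoc a zero    = subst (0ℚ ℚ.≤_) (sym (ℚP.+-identityʳ (+ 1 ℚ./ suc a)))
    (ℚP.nonNegative⁻¹ (+ 1 ℚ./ suc a) {{ℚP.normalize-nonNeg 1 (suc a)}})
  recipSum-snoc a (suc l) = ℚP.+-monoʳ-≤ (+ 1 ℚ./ suc a) (recipSum-snoc (suc a) l)

  lnSeq-close : ∀ n i j → lnSeq n i ℚ.≤ (+ 1 ℚ./ suc j) ℚ.+ lnSeq n j
  lnSeq-close n i j = begin
    recipSum (suc i) (d ℕ.* suc i)
      ≤⟨ refine-lower j (suc i) (d ℕ.* suc i) ⟩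
    recipSum (suc i ℕ.* suc j) (d ℕ.* suc i ℕ.* suc j)
      ≡⟨ cong₂ recipSum (ℕP.*-comm (suc i) (suc j))
           (trans (ℕP.*-assoc d (suc i) (suc j))
             (trans (cong (d ℕ.*_) (ℕP.*-comm (suc i) (suc j))) (sym (ℕP.*-assoc d (suc j) (suc i))))) ⟩
    recipSum (suc j ℕ.* suc i) (d ℕ.* suc j ℕ.* suc i)
      ≤⟨ refine-upper i j (d ℕ.* suc j) ⟩
    recipSum j (d ℕ.* suc j)
      ≤⟨ recipSum-snoc j (d ℕ.* suc j) ⟩
    (+ 1 ℚ./ suc j) ℚ.+ recipSum (suc j) (d ℕ.* suc j) ∎
    where d = n ℕ.∸ 1

  archimedean : ∀ δ → 0ℚ ℚ.< δ → ∃[ N ] (+ 1 ℚ./ suc N) ℚ.≤ δ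
  archimedean δ@(ℚ.mkℚ (+ suc p) q _) 0<δ = q ,
    subst ((+ 1 ℚ./ suc q) ℚ.≤_) (ℚP.↥p/↧p≡p δ)
      (/-mono 1 (suc q) (suc p) (suc q) (ℕP.*-monoˡ-≤ (suc q) (ℕ.s≤s (ℕ.z≤n {p}))))
  archimedean (ℚ.mkℚ (+ zero) q _)  (ℚ.*<* (ℤ.+<+ ()))
  archimedean (ℚ.mkℚ ℤ.-[1+ _ ] q _) (ℚ.*<* ())

  ∣-∣-bound : ∀ a b δ → a ℚ.≤ δ ℚ.+ b → b ℚ.≤ δ ℚ.+ a → ℚ.∣ a ℚ.- b ∣ ℚ.≤ δ
  ∣-∣-bound a b δ a≤ b≤ with ℚP.∣p∣≡p∨∣p∣≡-p (a ℚ.- b)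
  ... | inj₁ eq = subst (ℚ._≤ δ) (sym eq) (subst (a ℚ.- b ℚ.≤_) (cancel δ b) (ℚP.+-monoˡ-≤ (ℚ.- b) a≤))
    where
    cancel : ∀ c d → c ℚ.+ d ℚ.- d ≡ c
    cancel = solve 2 (λ c d → ((c :+ d) :- d) := c) refl
      where open +-*-Solver
  ... | inj₂ eq = subst (ℚ._≤ δ) (sym (trans eq (flip a b)))
                    (subst (b ℚ.- a ℚ.≤_) (cancel δ a) (ℚP.+-monoˡ-≤ (ℚ.- a) b≤))
    where
    cancel : ∀ c d → c ℚ.+ d ℚ.- d ≡ c
    cancel = solve 2 (λ c d → ((c :+ d) :- d) := c) refl
      where open +-*-Solver
    flip : ∀ c d → ℚ.- (c ℚ.- d) ≡ d ℚ.- c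
    flip = solve 2 (λ c d → (:- (c :- d)) := (d :- c)) refl
      where open +-*-Solver

  lnSeq-cauchy : ∀ n → IsCauchy (lnSeq n)
  lnSeq-cauchy n δ 0<δ with archimedean δ 0<δ
  ... | N , 1/N≤δ = N , λ i j i≥ j≥ → ∣-∣-bound (lnSeq n i) (lnSeq n j) δ (bound i j j≥) (bound j i i≥)
    where
    bound : ∀ i j → N ℕ.≤ j → lnSeq n i ℚ.≤ δ ℚ.+ lnSeq n j
    bound i j j≥ = ℚP.≤-trans (lnSeq-close n i j)
      (ℚP.+-monoˡ-≤ (lnSeq n j) (ℚP.≤-trans (recip-mono (suc N) (suc j) (ℕ.s≤s j≥)) 1/N≤δ))

-- The value at n = 0 is junk (it is 0).
ln : ℕ → ℝ
ln n = mkℝ (lnSeq n) (LnCauchy.lnSeq-cauchy n)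

------------------------------------------------------------------------
-- Finite sums and products, linear forms, monomials

∑ ∏ : {A : Set} → List A → (A → ℝ) → ℝ
∑ xs f = foldr _+ᴿ_ 0ᴿ (map f xs)
∏ xs f = foldr _*ᴿ_ 1ᴿ (map f xs)

infixr 6.5 ∑ ∏
syntax ∑ xs (λ i → e) = ∑[ i ← xs ] e
syntax ∏ xs (λ i → e) = ∏[ i ← xs ] e

Point : ℕ → Set
Point n = Fin n → ℝ

-- A linear form on ℝⁿ, given by its coefficients.
LinearForm : ℕ → Set
LinearForm n = Fin n → ℝ

infixl 9 _⟨_⟩
_⟨_⟩ : ∀ {n} → LinearForm n → Point n → ℝ
ℓ ⟨ x ⟩ = ∑[ j ← allFin _ ] ℓ j *ᴿ x j

words : {A : Set} → List A → (n : ℕ) → List (Vec A n)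
words as zero    = [] ∷ []
words as (suc n) = cartesianProductWith _∷_ as (words as n)

-- The exponent vectors a ∈ ℕⁿ with α₁ + ⋯ + αₙ = r, each listed once.
exponents : (n r : ℕ) → List (Vec ℕ n)
exponents n r = filter (λ a → sum a ℕP.≟ r) (words (upTo (suc r)) n)

monomial : ∀ {n} → Point n → Vec ℕ n → ℝ
monomial {n} x a = ∏[ i ← allFin n ] x i ^ᴿ lookup a i

-- The r-element subsets of the index set, each listed once.
subsets : (n r : ℕ) → List (Subset n)
subsets n r = filter (λ I → ∣ I ∣ ℕP.≟ r) (words (inside ∷ outside ∷ []) n)

squarefree : ∀ {n} → Point n → Subset n → ℝ
squarefree {n} x I = ∏[ i ← filter (_∈? I) (allFin n) ] x i

------------------------------------------------------------------------
-- Deterministic algorithms: structured programs for a random access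
-- machine whose memory consists of arrays ℕ → ℕ.  Each primitive operation
-- (constant, indexed read, addition, truncated subtraction, indexed write,
-- test) takes one unit of time.  As there is no multiplication, numbers
-- gain O(1) bits per unit of time, so polynomial time in this model
-- is polynomial time on a Turing machine.

Store : Set
Store = ℕ → ℕ → ℕ

infixl 6 _⊕_ _⊝_
data Expr : Set where
  const   : ℕ → Expr
  _at_    : ℕ → Expr → Expr
  _⊕_ _⊝_ : Expr → Expr → Expr

eval : Store → Expr → ℕ
eval σ (const c) = c
eval σ (A at e)  = σ A (eval σ e)
eval σ (e ⊕ f)   = eval σ e ℕ.+ eval σ f
eval σ (e ⊝ f)   = eval σ e ℕ.∸ eval σ f

cost : Expr → ℕ
cost (const c) = 1
cost (A at e)  = 1 ℕ.+ cost e
cost (e ⊕ f)   = 1 ℕ.+ cost e ℕ.+ cost f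
cost (e ⊝ f)   = 1 ℕ.+ cost e ℕ.+ cost f

write : Store → ℕ → ℕ → ℕ → Store
write σ A i v B j =
  if does (A ℕP.≟ B) then (if does (i ℕP.≟ j) then v else σ B j) else σ B j

infixr 4 _⨾_
data Program : Set where
  skip  : Program
  put   : ℕ → Expr → Expr → Program
  _⨾_   : Program → Program → Program
  cond  : Expr → Program → Program → Program
  while : Expr → Program → Program

-- ⟪ P , σ ⟫⇓⟪ τ , t ⟫: started in σ, the program P halts in τ after time t.
-- A test succeeds when its value is nonzero.
data ⟪_,_⟫⇓⟪_,_⟫ : Program → Store → Store → ℕ → Set where
  run-skip : ∀ {σ} → ⟪ skip , σ ⟫⇓⟪ σ , 1 ⟫
  run-put  : ∀ {A e f σ} →
             ⟪ put A e f , σ ⟫⇓⟪ write σ A (eval σ e) (eval σ f) , 1 ℕ.+ cost e ℕ.+ cost f ⟫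
  run-⨾    : ∀ {P Q σ τ υ s t} → ⟪ P , σ ⟫⇓⟪ τ , s ⟫ → ⟪ Q , τ ⟫⇓⟪ υ , t ⟫ →
             ⟪ P ⨾ Q , σ ⟫⇓⟪ υ , s ℕ.+ t ⟫
  run-then : ∀ {e P Q σ τ t} → eval σ e ≢ 0 → ⟪ P , σ ⟫⇓⟪ τ , t ⟫ →
             ⟪ cond e P Q , σ ⟫⇓⟪ τ , 1 ℕ.+ cost e ℕ.+ t ⟫
  run-else : ∀ {e P Q σ τ t} → eval σ e ≡ 0 → ⟪ Q , σ ⟫⇓⟪ τ , t ⟫ →
             ⟪ cond e P Q , σ ⟫⇓⟪ τ , 1 ℕ.+ cost e ℕ.+ t ⟫
  run-stop : ∀ {e P σ} → eval σ e ≡ 0 →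
             ⟪ while e P , σ ⟫⇓⟪ σ , 1 ℕ.+ cost e ⟫
  run-loop : ∀ {e P σ τ υ s t} → eval σ e ≢ 0 →
             ⟪ P , σ ⟫⇓⟪ τ , s ⟫ → ⟪ while e P , τ ⟫⇓⟪ υ , t ⟫ →
             ⟪ while e P , σ ⟫⇓⟪ υ , 1 ℕ.+ cost e ℕ.+ s ℕ.+ t ⟫

-- The input n is placed in cell 0 of array 0; all other cells hold 0.
input : ℕ → Store
input n = write (λ _ _ → 0) 0 0 n

-- The algorithm P, given n ≥ 2, runs in time polynomial in n and halts
-- with an output that satisfies Spec n.
PolyTime : Program → (ℕ → Store → Set) → Set
PolyTime P Spec = ∃[ c ] ∃[ d ] (∀ n → n ℕ.≥ 2 →
  ∃[ σ ] ∃[ t ] (⟪ P , input n ⟫⇓⟪ σ , t ⟫ × t ℕ.≤ c ℕ.* n ℕ.^ d × Spec n σ))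

-- Output convention: the number k is in cell 0 of array 0, and the
-- coefficients are rational numbers, listed consecutively, each being
-- (p - q)/(s + 1) with p, q, s stored in arrays 1, 2, 3.

outputCount : Store → ℕ
outputCount σ = σ 0 0

outputCoeff : Store → ℕ → ℝ
outputCoeff σ i = fromℚ ((σ 1 i ⊖ σ 2 i) ℚ./ suc (σ 3 i))

outputForms : (σ : Store) (n : ℕ) → Fin (outputCount σ) → LinearForm n
outputForms σ n i m = outputCoeff σ (toℕ (combine i m))

outputFormFamily : (σ : Store) (r n : ℕ) → Fin (outputCount σ) → Fin r → LinearForm n
outputFormFamily σ r n i j m = outputCoeff σ (toℕ (combine (combine i j) m))

{-# OPTIONS --safe #-}
-- Colour the n variables in each of k rows with q colours, so that every pattern, which prescribes
-- the colours of at most r variables, occurs in nearly the expected number of rows.  For (b) take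
-- q = r and let ℓ_ij be the sum of the variables of colour j in row i: then e_I counts the rows in
-- which I has all r colours, and no square of a variable appears.  For (a) give a variable of
-- colour u the coefficient d_u, where (d_u) is a sample whose moments up to r are nearly
-- proportional to those a! of the exponential distribution: the multinomial coefficient r!/∏ a_j!
-- then cancels, and all h_a are nearly equal.
--
-- By Chernoff's bound k = O(log n) random rows suffice.  They are found by conditional expectations:
-- the potential is the sum over all patterns of ∏_i (1 + p_i/N), where p_i is a multiple of the
-- conditional probability that row i has the pattern.  Averaged over the colours of one cell the
-- potential does not change, so some colour does not increase it.  At the end a single summand
-- (1 + q^s/(NQ))^count is at most the initial potential, which bounds every count from above; the
-- lower bounds follow, since the counts of the q patterns that extend a given one by one variable
-- add up.  Making k a constant times an r-th power w^r keeps the scaling of the forms rational.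

module Submission where

open import Algebra.Bundles using (CommutativeMonoid)
import Algebra.Properties.CommutativeSemigroup as CommutativeSemigroupProperties
open import Data.Bool.Base using (Bool; true; false)
open import Data.Empty using (⊥; ⊥-elim)
open import Data.Fin.Base using (Fin; zero; suc; toℕ; combine)
open import Data.Fin.Properties using (toℕ<n; toℕ-combine; toℕ-injective)
open import Data.Fin.Subset using (Subset; inside; outside; ∣_∣)
open import Data.Fin.Subset.Properties using (_∈?_)
import Data.Integer.Base as ℤ
import Data.Integer.Properties as ℤP
open import Data.List.Base
  using (List; []; _∷_; _++_; map; length; filter; upTo; applyUpTo; allFin; tabulate; cartesianProductWith)
open import Data.List.Properties using (length-++; length-map; length-tabulate)
open import Data.List.Relation.Unary.All using (All; []; _∷_)
import Data.List.Relation.Unary.All.Properties as AllP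
open import Data.List.Relation.Unary.AllPairs using (AllPairs; []; _∷_)
open import Data.List.Relation.Unary.Unique.Propositional.Properties using (allFin⁺; map⁺)
open import Data.Nat.Base
open import Data.Nat.DivMod
  using (_/_; _%_; m≡m%n+[m/n]*n; m/n*n≤m; m%n<n; m<n*o⇒m/o<n; m<n⇒m%n≡m; [m+kn]%n≡m%n)
open import Data.Nat.Properties
open import Data.Nat.Tactic.RingSolver using (solve-∀)
open import Data.Product.Base using (∃-syntax; Σ-syntax; _×_; _,_; proj₁; proj₂)
open import Data.Rational.Base as ℚ using (ℚ; 0ℚ; 1ℚ)
import Data.Rational.Properties as ℚP
open import Data.Rational.Solver using (module +-*-Solver)
import Data.Rational.Unnormalised.Base as ℚᵘ
import Data.Rational.Unnormalised.Properties as ℚᵘP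
open import Data.Sum.Base using (_⊎_; inj₁; inj₂)
open import Data.Vec.Base using (Vec; []; _∷_; lookup; sum)
open import Relation.Binary.PropositionalEquality
open import Relation.Nullary.Decidable using (does; yes; no; dec-true; dec-false)
open import Relation.Unary using (Decidable)
open import Defs

open CommutativeSemigroupProperties *-commutativeSemigroup
  using (x∙yz≈y∙xz; xy∙z≈y∙xz; xy∙z≈xz∙y; x∙yz≈yx∙z) renaming (interchange to *-interchange)
open CommutativeSemigroupProperties (CommutativeMonoid.commutativeSemigroup ℚP.*-1-commutativeMonoid)
  using () renaming (interchange to *ℚ-interchange)

-- A loop language compiled to programs

-- Everything that depends only on `r` and `ε` is built into the programs as constants, but `ε` is a
-- Cauchy sequence, whose order relations cannot be decided. It is therefore replaced by integers X
-- and Y with |1 - ε| ≤ X/Y < (X + 1)/Y ≤ 1 + ε. The ratio (X + 1)/X is the whole error budget; it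
-- is spent in factors (2X + 2)/(2X + 1), one on the deviation of the counts and r on the deviation
-- of the moments. All estimates are kept in the natural numbers. The potential is scaled by A^k
-- with A = NQ, so that each of its factors is A plus zero or a power of q; the exponential
-- inequalities behind Chernoff's bound become Bernoulli's inequality and a quadratic upper bound
-- for (1 + 1/A)^x. Only upper deviations are controlled by the potential. The price is paid in the
-- lower bounds: an upper deviation 1/D at the empty pattern grows by a factor q with every variable
-- of the pattern, whence the choice D + 1 = q^r (2X + 2). The machine cannot multiply, so the
-- construction multiplies only by constants, by values 0, 1 or q through a case distinction, and by
-- loop bounds through loops.

Runs : Program → Store → ℕ → (Store → Set) → Set
Runs P σ T Post = ∃[ τ ] ∃[ t ] (⟪ P , σ ⟫⇓⟪ τ , t ⟫ × t ≤ T × Post τ)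

runs-weaken : ∀ {P σ T Post Post′} → (∀ {τ} → Post τ → Post′ τ) → Runs P σ T Post → Runs P σ T Post′
runs-weaken f (τ , t , run , t≤ , post) = τ , t , run , t≤ , f post

runs-⨾ : ∀ {P Q σ S T Mid Post} → Runs P σ S Mid → (∀ {τ} → Mid τ → Runs Q τ T Post) →
         Runs (P ⨾ Q) σ (S + T) Post
runs-⨾ (τ , s , run , s≤ , mid) next with next mid
... | υ , t , run′ , t≤ , post = υ , s + t , run-⨾ run run′ , +-mono-≤ s≤ t≤ , post

runs-put : ∀ {A e f σ Post} → Post (write σ A (eval σ e) (eval σ f)) →
           Runs (put A e f) σ (1 + cost e + cost f) Post
runs-put post = _ , _ , run-put , ≤-refl , post

write-hit : ∀ σ A i v → write σ A i v A i ≡ v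
write-hit σ A i v rewrite dec-true (A ≟ A) refl | dec-true (i ≟ i) refl = refl

write-miss : ∀ σ A {i} v B {j} → i ≢ j → write σ A i v B j ≡ σ B j
write-miss σ A {i} v B {j} i≢j with does (A ≟ B)
... | false = refl
... | true rewrite dec-false (i ≟ j) i≢j = refl

register : ℕ → Expr
register i = 0 at const i

countdown : ℕ → Program → Program
countdown c P = while (register c) (P ⨾ put 0 (const c) (register c ⊝ const 1))

-- The invariant is indexed by the number `y` of completed rounds. Besides its body a round costs 9,
-- namely 3 for the test and 6 for the decrement; the last, failing test costs 3. The invariant must
-- tolerate writes to the counter because the decrement lies outside the body.
runs-countdown : ∀ c P T (I : ℕ → Store → Set) →
  (∀ y σ v → I y σ → I y (write σ 0 c v)) →
  (∀ y σ → I y σ → Runs P σ T (λ τ → I (suc y) τ × τ 0 c ≡ σ 0 c)) →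
  ∀ m y σ → σ 0 c ≡ m → I y σ → Runs (countdown c P) σ (3 + m * (9 + T)) (I (m + y))
runs-countdown c P T I stable body zero y σ σc≡ inv = σ , 3 , run-stop σc≡ , ≤-refl , inv
runs-countdown c P T I stable body (suc m) y σ σc≡ inv
  with body y σ inv
... | τ , s , run , s≤ , inv′ , τc≡
  with runs-countdown c P T I stable body m (suc y)
         (write τ 0 c (τ 0 c ∸ 1))
         (trans (write-hit τ 0 c _) (cong (_∸ 1) (trans τc≡ σc≡)))
         (stable (suc y) τ _ inv′)
... | υ , t , runs , t≤ , inv″ =
  υ , _ , run-loop (λ eq → 1+n≢0 (trans (sym σc≡) eq)) (run-⨾ run run-put) runs , time ,
  subst (λ z → I z υ) (+-suc m y) inv″
  where
  time : 3 + (s + 6) + t ≤ 3 + suc m * (9 + T)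
  time = begin
    3 + (s + 6) + t                       ≤⟨ +-mono-≤ (+-monoʳ-≤ 3 (+-monoˡ-≤ 6 s≤)) t≤ ⟩
    3 + (T + 6) + (3 + m * (9 + T))       ≡⟨ rearrange T (m * (9 + T)) ⟩
    3 + suc m * (9 + T)                   ∎
    where
    open ≤-Reasoning
    rearrange : ∀ T z → 3 + (T + 6) + (3 + z) ≡ 3 + (9 + T + z)
    rearrange = solve-∀

-- Array 0 of the machine holds the registers; array suc A of the machine is array A of the memory.
Memory : Set
Memory = ℕ → ℕ → ℕ

-- The cells of this array hold the bounds of all loops.
bounds : ℕ
bounds = 3

infixl 6 _⊞_ _⊟_
-- A loop bound is the index of a memory cell and not a term, so that one upper bound on the array
-- `bounds` makes every running time a polynomial in it. In `iter b s t` the body `t` sees the index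
-- as `var zero` and the accumulator as the variable after it.
data Term (v : ℕ) : Set where
  var     : Fin v → Term v
  lit     : ℕ → Term v
  arr     : ℕ → Term v → Term v
  _⊞_ _⊟_ : Term v → Term v → Term v
  ifz     : Term v → Term v → Term v → Term v
  lett    : Term v → Term (suc v) → Term v
  iter    : ℕ → Term v → Term (suc (suc v)) → Term v

ifzero : ℕ → ℕ → ℕ → ℕ
ifzero zero    a b = a
ifzero (suc _) a b = b

recur : {A : Set} → (ℕ → A → A) → A → ℕ → A
recur f z zero    = z
recur f z (suc x) = f x (recur f z x)

⟦_⟧ : ∀ {v} → Term v → Memory → Vec ℕ v → ℕ
⟦ var i ⟧ D ρ      = lookup ρ i
⟦ lit c ⟧ D ρ      = c
⟦ arr A t ⟧ D ρ    = D A (⟦ t ⟧ D ρ)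
⟦ s ⊞ t ⟧ D ρ      = ⟦ s ⟧ D ρ + ⟦ t ⟧ D ρ
⟦ s ⊟ t ⟧ D ρ      = ⟦ s ⟧ D ρ ∸ ⟦ t ⟧ D ρ
⟦ ifz c s t ⟧ D ρ  = ifzero (⟦ c ⟧ D ρ) (⟦ s ⟧ D ρ) (⟦ t ⟧ D ρ)
⟦ lett s t ⟧ D ρ   = ⟦ t ⟧ D (⟦ s ⟧ D ρ ∷ ρ)
⟦ iter b s t ⟧ D ρ = recur (λ x z → ⟦ t ⟧ D (x ∷ z ∷ ρ)) (⟦ s ⟧ D ρ) (D bounds b)

-- The value is left in register d, and only registers ≥ d are written.
compile : ∀ {v} → ℕ → Vec ℕ v → Term v → Program
compile d vs (var i)      = put 0 (const d) (register (lookup vs i))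
compile d vs (lit c)      = put 0 (const d) (const c)
compile d vs (arr A t)    = compile d vs t ⨾ put 0 (const d) (suc A at register d)
compile d vs (s ⊞ t)      =
  compile d vs s ⨾ compile (suc d) vs t ⨾ put 0 (const d) (register d ⊕ register (suc d))
compile d vs (s ⊟ t)      =
  compile d vs s ⨾ compile (suc d) vs t ⨾ put 0 (const d) (register d ⊝ register (suc d))
compile d vs (ifz c s t)  = compile d vs c ⨾ cond (register d) (compile d vs t) (compile d vs s)
compile d vs (lett s t)   =
  compile d vs s ⨾ compile (suc d) (d ∷ vs) t ⨾ put 0 (const d) (register (suc d))
compile d vs (iter b s t) =
  compile d vs s ⨾ put 0 (const (1 + d)) (const 0) ⨾ put 0 (const (2 + d)) (suc bounds at const b) ⨾
  countdown (2 + d) (compile (3 + d) (1 + d ∷ d ∷ vs) t ⨾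
                     put 0 (const d) (register (3 + d)) ⨾
                     put 0 (const (1 + d)) (register (1 + d) ⊕ const 1))

-- Both branches of `ifz` are charged, and every loop is charged `B` rounds. This leaves only sums
-- and products with `B`, from which a polynomial bound can be read off.
termTime : ∀ {v} → Term v → ℕ → ℕ
termTime (var i) B      = 4
termTime (lit c) B      = 3
termTime (arr A t) B    = termTime t B + 5
termTime (s ⊞ t) B      = termTime s B + (termTime t B + 7)
termTime (s ⊟ t) B      = termTime s B + (termTime t B + 7)
termTime (ifz c s t) B  = termTime c B + (3 + (termTime s B + termTime t B))
termTime (lett s t) B   = termTime s B + (termTime t B + 4)
termTime (iter b s t) B = termTime s B + (3 + (4 + (3 + B * (9 + (termTime t B + (4 + 6))))))

record Agree (D : Memory) (σ : Store) : Set where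
  constructor agrees
  field cell : ∀ A j → σ (suc A) j ≡ D A j
open Agree

Bounded : Memory → ℕ → Set
Bounded D B = ∀ b → D bounds b ≤ B

record Unchanged (d : ℕ) (σ τ : Store) : Set where
  constructor unchanged
  field kept : ∀ j → j < d → τ 0 j ≡ σ 0 j
open Unchanged

record Environment {v : ℕ} (d : ℕ) (vs ρ : Vec ℕ v) (σ : Store) : Set where
  constructor environment
  field holds : ∀ i → lookup vs i < d × σ 0 (lookup vs i) ≡ lookup ρ i
open Environment

Result : ℕ → Memory → Store → ℕ → Store → Set
Result d D σ x τ = τ 0 d ≡ x × Unchanged d σ τ × Agree D τ

unchanged-refl : ∀ {d σ} → Unchanged d σ σ
unchanged-refl = unchanged λ _ _ → refl

unchanged-trans : ∀ {d σ τ υ} → Unchanged d σ τ → Unchanged d τ υ → Unchanged d σ υ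
unchanged-trans p q = unchanged λ j j<d → trans (kept q j j<d) (kept p j j<d)

unchanged-≤ : ∀ {d e σ τ} → d ≤ e → Unchanged e σ τ → Unchanged d σ τ
unchanged-≤ d≤e p = unchanged λ j j<d → kept p j (≤-trans j<d d≤e)

unchanged-write : ∀ {d e} σ v → d ≤ e → Unchanged d σ (write σ 0 e v)
unchanged-write σ v d≤e =
  unchanged λ j j<d → write-miss σ 0 v 0 (λ e≡j → <⇒≢ (≤-trans j<d d≤e) (sym e≡j))

environment-unchanged : ∀ {v d σ τ} {vs ρ : Vec ℕ v} → Unchanged d σ τ →
                        Environment d vs ρ σ → Environment d vs ρ τ
environment-unchanged p env = environment λ i →
  proj₁ (holds env i) , trans (kept p _ (proj₁ (holds env i))) (proj₂ (holds env i))

environment-≤ : ∀ {v d e σ} {vs ρ : Vec ℕ v} → d ≤ e → Environment d vs ρ σ → Environment e vs ρ σ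
environment-≤ d≤e env = environment λ i → ≤-trans (proj₁ (holds env i)) d≤e , proj₂ (holds env i)

environment-∷ : ∀ {v d e x σ} {vs ρ : Vec ℕ v} → d < e → σ 0 d ≡ x →
                Environment e vs ρ σ → Environment e (d ∷ vs) (x ∷ ρ) σ
environment-∷ d<e eq env = environment λ { zero → d<e , eq ; (suc i) → holds env i }

-- A write to array 0 leaves the cells of the arrays `suc A` alone by computation, so that `Agree`
-- only has to be wrapped again.
runs-return : ∀ {d D σ τ x} e → eval τ e ≡ x → Unchanged d σ τ → Agree D τ →
              Runs (put 0 (const d) e) τ (2 + cost e) (Result d D σ x)
runs-return {d} {τ = τ} e eq u a = runs-put
  (trans (write-hit τ 0 d _) eq , unchanged-trans u (unchanged-write τ _ ≤-refl) , agrees (cell a))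

d≤1+d : ∀ {d} → d ≤ 1 + d
d≤1+d = n≤1+n _

-- Induction on the term. A left operand survives in register `d` because the code of the right one
-- writes only to registers from `suc d` on.
compile-runs : ∀ {v} (t : Term v) d vs ρ D σ B → Environment d vs ρ σ → Agree D σ → Bounded D B →
  Runs (compile d vs t) σ (termTime t B) (Result d D σ (⟦ t ⟧ D ρ))
compile-runs (var i) d vs ρ D σ B env agree bound =
  runs-return (register (lookup vs i)) (proj₂ (holds env i)) unchanged-refl agree
compile-runs (lit c) d vs ρ D σ B env agree bound =
  runs-return (const c) refl unchanged-refl agree
compile-runs (arr A t) d vs ρ D σ B env agree bound =
  runs-⨾ (compile-runs t d vs ρ D σ B env agree bound) λ { {τ} (h , u , a) →
    runs-return (suc A at register d) (trans (cell a A _) (cong (D A) h)) u a }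
compile-runs (s ⊞ t) d vs ρ D σ B env agree bound =
  runs-⨾ (compile-runs s d vs ρ D σ B env agree bound) λ { {τ} (h , u , a) →
  runs-⨾ (compile-runs t (suc d) vs ρ D τ B
            (environment-≤ d≤1+d (environment-unchanged u env)) a bound) λ { {υ} (h′ , u′ , a′) →
  runs-return (register d ⊕ register (suc d)) (cong₂ _+_ (trans (kept u′ d ≤-refl) h) h′)
    (unchanged-trans u (unchanged-≤ d≤1+d u′)) a′ } }
compile-runs (s ⊟ t) d vs ρ D σ B env agree bound =
  runs-⨾ (compile-runs s d vs ρ D σ B env agree bound) λ { {τ} (h , u , a) →
  runs-⨾ (compile-runs t (suc d) vs ρ D τ B
            (environment-≤ d≤1+d (environment-unchanged u env)) a bound) λ { {υ} (h′ , u′ , a′) →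
  runs-return (register d ⊝ register (suc d)) (cong₂ _∸_ (trans (kept u′ d ≤-refl) h) h′)
    (unchanged-trans u (unchanged-≤ d≤1+d u′)) a′ } }
compile-runs (ifz c s t) d vs ρ D σ B env agree bound =
  runs-⨾ (compile-runs c d vs ρ D σ B env agree bound) λ { {τ} (h , u , a) → branch τ _ h u a }
  where
  branch : ∀ τ x → τ 0 d ≡ x → Unchanged d σ τ → Agree D τ →
    Runs (cond (register d) (compile d vs t) (compile d vs s)) τ
      (3 + (termTime s B + termTime t B)) (Result d D σ (ifzero x (⟦ s ⟧ D ρ) (⟦ t ⟧ D ρ)))
  branch τ zero h u a
    with compile-runs s d vs ρ D τ B (environment-unchanged u env) a bound
  ... | υ , m , run , m≤ , (h′ , u′ , a′) =
    υ , _ , run-else h run , +-monoʳ-≤ 3 (≤-trans m≤ (m≤m+n _ _)) , h′ , unchanged-trans u u′ , a′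
  branch τ (suc x) h u a
    with compile-runs t d vs ρ D τ B (environment-unchanged u env) a bound
  ... | υ , m , run , m≤ , (h′ , u′ , a′) =
    υ , _ , run-then (λ eq → 1+n≢0 (trans (sym h) eq)) run , +-monoʳ-≤ 3 (≤-trans m≤ (m≤n+m _ _)) ,
    h′ , unchanged-trans u u′ , a′
compile-runs (lett s t) d vs ρ D σ B env agree bound =
  runs-⨾ (compile-runs s d vs ρ D σ B env agree bound) λ { {τ} (h , u , a) →
  runs-⨾ (compile-runs t (suc d) (d ∷ vs) _ D τ B
            (environment-∷ ≤-refl h (environment-≤ d≤1+d (environment-unchanged u env))) a bound)
  λ { {υ} (h′ , u′ , a′) →
  runs-return (register (suc d)) h′ (unchanged-trans u (unchanged-≤ d≤1+d u′)) a′ } }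
compile-runs (iter b s t) d vs ρ D σ B env agree bound =
  runs-⨾ (compile-runs s d vs ρ D σ B env agree bound) λ { {τ} (h , u , a) →
  runs-⨾ (runs-put {Post = λ υ → υ 0 d ≡ z × υ 0 (1 + d) ≡ 0 × Unchanged d σ υ × Agree D υ}
           ( trans (kept (unchanged-write τ 0 ≤-refl) d ≤-refl) h
           , write-hit τ 0 (1 + d) 0
           , unchanged-trans u (unchanged-write τ 0 d≤1+d)
           , agrees (cell a))) λ { {υ} (h₁ , h₂ , u₁ , a₁) →
  runs-⨾ (runs-put {Post = λ φ → φ 0 (2 + d) ≡ D bounds b × I 0 φ}
           ( trans (write-hit υ 0 (2 + d) _) (cell a₁ bounds b)
           , stable 0 υ _ (h₁ , h₂ , u₁ , a₁))) λ { {φ} (h₃ , inv) →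
  time-≤ (runs-weaken (λ { (h₄ , _ , u₄ , a₄) → trans h₄ (cong (recur f z) (+-identityʳ (D bounds b))) , u₄ , a₄ })
    (runs-countdown (2 + d) _ _ I stable body (D bounds b) 0 φ h₃ inv)) } } }
  where
  f : ℕ → ℕ → ℕ
  f x y = ⟦ t ⟧ D (x ∷ y ∷ ρ)
  z : ℕ
  z = ⟦ s ⟧ D ρ
  -- Register `d` holds the accumulator and `1 + d` the ascending index read by the body. The
  -- descending counter in `2 + d` is handled by `runs-countdown`.
  I : ℕ → Store → Set
  I y τ = τ 0 d ≡ recur f z y × τ 0 (1 + d) ≡ y × Unchanged d σ τ × Agree D τ
  stable : ∀ y τ v → I y τ → I y (write τ 0 (2 + d) v)
  stable y τ v (h , h′ , u , a) =
    trans (kept (unchanged-write τ v ≤-refl) d (n≤1+n _)) h ,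
    trans (kept (unchanged-write τ v ≤-refl) (1 + d) ≤-refl) h′ ,
    unchanged-trans u (unchanged-write τ v (≤-trans d≤1+d d≤1+d)) , agrees (cell a)
  body : ∀ y τ → I y τ → Runs (compile (3 + d) (1 + d ∷ d ∷ vs) t ⨾
                     put 0 (const d) (register (3 + d)) ⨾
                     put 0 (const (1 + d)) (register (1 + d) ⊕ const 1))
         τ (termTime t B + (4 + 6)) (λ υ → I (suc y) υ × υ 0 (2 + d) ≡ τ 0 (2 + d))
  body y τ (h , h′ , u , a) =
    runs-⨾ (compile-runs t (3 + d) (1 + d ∷ d ∷ vs) (y ∷ _ ∷ ρ) D τ B
              (environment-∷ (n≤1+n _) h′ (environment-∷ (≤-trans (n≤1+n _) (n≤1+n _)) h
                (environment-≤ (m≤n+m d 3) (environment-unchanged u env)))) a bound)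
    λ { {υ} (h₁ , u₁ , a₁) →
    runs-⨾ (runs-put {Post = λ φ → φ 0 d ≡ f y (recur f z y) × φ 0 (1 + d) ≡ y
                                  × φ 0 (2 + d) ≡ τ 0 (2 + d) × Unchanged d σ φ × Agree D φ}
      ( trans (write-hit υ 0 d _) h₁
      , trans (write-miss υ 0 _ 0 (<⇒≢ (n<1+n d))) (trans (kept u₁ (1 + d) (n≤1+n _)) h′)
      , trans (write-miss υ 0 _ 0 (<⇒≢ (m≤n⇒m≤1+n (n<1+n d)))) (kept u₁ (2 + d) ≤-refl)
      , unchanged-trans u (unchanged-trans (unchanged-≤ (m≤n+m d 3) u₁) (unchanged-write υ _ ≤-refl))
      , agrees (cell a₁))) λ { {φ} (h₂ , h₃ , h₄ , u₂ , a₂) →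
    runs-put
      ( ( trans (write-miss φ 0 _ 0 (λ eq → <⇒≢ (n<1+n d) (sym eq))) h₂
        , trans (write-hit φ 0 (1 + d) _) (trans (+-comm _ 1) (cong suc h₃))
        , unchanged-trans u₂ (unchanged-write φ _ d≤1+d)
        , agrees (cell a₂))
      , trans (write-miss φ 0 _ 0 (<⇒≢ (n<1+n (1 + d)))) h₄) } }
  time-≤ : ∀ {P τ Post} → Runs P τ (3 + D bounds b * (9 + (termTime t B + (4 + 6)))) Post →
           Runs P τ (3 + B * (9 + (termTime t B + (4 + 6)))) Post
  time-≤ (υ , m , run , m≤ , post) =
    υ , m , run , ≤-trans m≤ (+-monoʳ-≤ 3 (*-monoˡ-≤ _ (bound b))) , post

-- Statements, their compilation and its correctness

data Stmt (v : ℕ) : Set where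
  set  : ℕ → Term v → Term v → Stmt v
  _⨟_  : Stmt v → Stmt v → Stmt v
  done : Stmt v
  ifz  : Term v → Stmt v → Stmt v → Stmt v
  for  : ℕ → Stmt (suc v) → Stmt v

infixr 4 _⨟_

upd : Memory → ℕ → ℕ → ℕ → Memory
upd = write

ifzeroᴹ : ℕ → Memory → Memory → Memory
ifzeroᴹ zero    D E = D
ifzeroᴹ (suc _) D E = E

exec : ∀ {v} → Stmt v → Memory → Vec ℕ v → Memory
exec (set A s t) D ρ = upd D A (⟦ s ⟧ D ρ) (⟦ t ⟧ D ρ)
exec (p ⨟ q) D ρ     = exec q (exec p D ρ) ρ
exec done D ρ        = D
exec (ifz c p q) D ρ = ifzeroᴹ (⟦ c ⟧ D ρ) (exec p D ρ) (exec q D ρ)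
exec (for b p) D ρ   = recur (λ x E → exec p E (x ∷ ρ)) D (D bounds b)

compileStmt : ∀ {v} → ℕ → Vec ℕ v → Stmt v → Program
compileStmt d vs (set A s t) =
  compile d vs s ⨾ compile (suc d) vs t ⨾ put (suc A) (register d) (register (suc d))
compileStmt d vs (p ⨟ q)     = compileStmt d vs p ⨾ compileStmt d vs q
compileStmt d vs done        = skip
compileStmt d vs (ifz c p q) =
  compile d vs c ⨾ cond (register d) (compileStmt d vs q) (compileStmt d vs p)
compileStmt d vs (for b p)   =
  put 0 (const d) (const 0) ⨾ put 0 (const (1 + d)) (suc bounds at const b) ⨾
  countdown (1 + d) (compileStmt (2 + d) (d ∷ vs) p ⨾ put 0 (const d) (register d ⊕ const 1))

stmtTime : ∀ {v} → Stmt v → ℕ → ℕ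
stmtTime (set A s t) B = termTime s B + (termTime t B + 5)
stmtTime (p ⨟ q) B     = stmtTime p B + stmtTime q B
stmtTime done B        = 1
stmtTime (ifz c p q) B = termTime c B + (3 + (stmtTime p B + stmtTime q B))
stmtTime (for b p) B   = 3 + (4 + (3 + B * (9 + (stmtTime p B + 6))))

KeepsBounds : ∀ {v} → Stmt v → Set
KeepsBounds {v} p = ∀ D (ρ : Vec ℕ v) b → exec p D ρ bounds b ≡ D bounds b

-- Every loop of the statement finds the loop bounds that held at the start.
data Steady {v : ℕ} : Stmt v → Set where
  set  : ∀ {A s t} → Steady (set A s t)
  both : ∀ {p q} → KeepsBounds p → Steady p → Steady q → Steady (p ⨟ q)
  done : Steady done
  ifz  : ∀ {c p q} → Steady p → Steady q → Steady (ifz c p q)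
  for  : ∀ {b p} → KeepsBounds p → Steady p → Steady (for b p)

agree-write : ∀ {D σ} A i v → Agree D σ → Agree (upd D A i v) (write σ (suc A) i v)
agree-write {D} {σ} A i v agree = agrees same
  where
  same : ∀ B j → write σ (suc A) i v (suc B) j ≡ upd D A i v B j
  same B j with does (A ≟ B)
  ... | false = cell agree B j
  ... | true with does (i ≟ j)
  ...   | true  = refl
  ...   | false = cell agree B j

bounded-keeps : ∀ D E {B} → (∀ b → E bounds b ≡ D bounds b) → Bounded D B → Bounded E B
bounded-keeps D E {B} keeps bound b = subst (_≤ B) (sym (keeps b)) (bound b)

-- A loop reads its bound once, on entry. Nested and later loops read theirs in memories that have
-- changed meanwhile; `KeepsBounds` carries the upper bound `B` over to these.
compileStmt-runs : ∀ {v} {p : Stmt v} → Steady p → ∀ d vs ρ D σ B →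
  Environment d vs ρ σ → Agree D σ → Bounded D B →
  Runs (compileStmt d vs p) σ (stmtTime p B) (λ τ → Unchanged d σ τ × Agree (exec p D ρ) τ)
compileStmt-runs {p = set A s t} set d vs ρ D σ B env agree bound =
  runs-⨾ (compile-runs s d vs ρ D σ B env agree bound) λ { {τ} (h , u , a) →
  runs-⨾ (compile-runs t (suc d) vs ρ D τ B
            (environment-≤ d≤1+d (environment-unchanged u env)) a bound) λ { {υ} (h′ , u′ , a′) →
  runs-put
    ( unchanged (kept (unchanged-trans u (unchanged-≤ d≤1+d u′)))
    , subst₂ (λ i x → Agree (upd D A i x) (write υ (suc A) (υ 0 d) (υ 0 (suc d))))
        (trans (kept u′ d ≤-refl) h) h′ (agree-write A (υ 0 d) (υ 0 (suc d)) a′)) } }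
compileStmt-runs {p = p ⨟ q} (both keeps sp sq) d vs ρ D σ B env agree bound =
  runs-⨾ (compileStmt-runs sp d vs ρ D σ B env agree bound) λ { {τ} (u , a) →
  runs-weaken (λ { (u′ , a′) → unchanged-trans u u′ , a′ })
    (compileStmt-runs sq d vs ρ _ τ B (environment-unchanged u env) a (bounded-keeps D (exec p D ρ) (keeps D ρ) bound)) }
compileStmt-runs done d vs ρ D σ B env agree bound = σ , 1 , run-skip , ≤-refl , unchanged-refl , agree
compileStmt-runs {p = ifz c p q} (ifz sp sq) d vs ρ D σ B env agree bound =
  runs-⨾ (compile-runs c d vs ρ D σ B env agree bound) λ { {τ} (h , u , a) → branch τ _ h u a }
  where
  branch : ∀ τ x → τ 0 d ≡ x → Unchanged d σ τ → Agree D τ →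
    Runs (cond (register d) (compileStmt d vs q) (compileStmt d vs p)) τ
      (3 + (stmtTime p B + stmtTime q B))
      (λ υ → Unchanged d σ υ × Agree (ifzeroᴹ x (exec p D ρ) (exec q D ρ)) υ)
  branch τ zero h u a
    with compileStmt-runs sp d vs ρ D τ B (environment-unchanged u env) a bound
  ... | υ , m , run , m≤ , (u′ , a′) =
    υ , _ , run-else h run , +-monoʳ-≤ 3 (≤-trans m≤ (m≤m+n _ _)) , unchanged-trans u u′ , a′
  branch τ (suc x) h u a
    with compileStmt-runs sq d vs ρ D τ B (environment-unchanged u env) a bound
  ... | υ , m , run , m≤ , (u′ , a′) =
    υ , _ , run-then (λ eq → 1+n≢0 (trans (sym h) eq)) run , +-monoʳ-≤ 3 (≤-trans m≤ (m≤n+m _ _)) ,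
    unchanged-trans u u′ , a′
compileStmt-runs {p = for b p} (for keeps sp) d vs ρ D σ B env agree bound =
  runs-⨾ (runs-put {Post = λ τ → τ 0 d ≡ 0 × Unchanged d σ τ × Agree D τ}
    (write-hit σ 0 d 0 , unchanged-write σ 0 ≤-refl , agrees (cell agree))) λ { {τ} (h , u , a) →
  runs-⨾ (runs-put {Post = λ υ → υ 0 (1 + d) ≡ D bounds b × I 0 υ}
    (trans (write-hit τ 0 (1 + d) _) (cell a bounds b) , stable 0 τ _ (h , u , a))) λ { {υ} (h′ , inv) →
  time-≤ (runs-weaken (λ { {φ} (_ , u′ , a′) → u′ ,
      subst (λ m → Agree (E m) φ) (+-identityʳ (D bounds b)) a′ })
    (runs-countdown (1 + d) _ _ I stable body (D bounds b) 0 υ h′ inv)) } }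
  where
  E : ℕ → Memory
  E = recur (λ x F → exec p F (x ∷ ρ)) D
  E-keeps : ∀ y b → E y bounds b ≡ D bounds b
  E-keeps zero    b = refl
  E-keeps (suc y) b = trans (keeps (E y) _ b) (E-keeps y b)
  I : ℕ → Store → Set
  I y τ = τ 0 d ≡ y × Unchanged d σ τ × Agree (E y) τ
  stable : ∀ y τ v → I y τ → I y (write τ 0 (1 + d) v)
  stable y τ v (h , u , a) =
    trans (kept (unchanged-write τ v ≤-refl) d ≤-refl) h , unchanged-trans u (unchanged-write τ v d≤1+d) , agrees (cell a)
  body : ∀ y τ → I y τ → Runs (compileStmt (2 + d) (d ∷ vs) p ⨾ put 0 (const d) (register d ⊕ const 1))
         τ (stmtTime p B + 6) (λ υ → I (suc y) υ × υ 0 (1 + d) ≡ τ 0 (1 + d))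
  body y τ (h , u , a) =
    runs-⨾ (compileStmt-runs sp (2 + d) (d ∷ vs) (y ∷ ρ) (E y) τ B
      (environment-∷ (n≤1+n _) h (environment-≤ (m≤n+m d 2) (environment-unchanged u env))) a
      (bounded-keeps D (E y) (E-keeps y) bound)) λ { {υ} (u₁ , a₁) →
    runs-put
      ( ( trans (write-hit υ 0 d _) (trans (+-comm _ 1) (cong suc (trans (kept u₁ d (n≤1+n _)) h)))
        , unchanged-trans u (unchanged-trans (unchanged-≤ (m≤n+m d 2) u₁) (unchanged-write υ _ ≤-refl))
        , agrees (cell a₁))
      , trans (write-miss υ 0 _ 0 (<⇒≢ (n<1+n d))) (kept u₁ (1 + d) ≤-refl)) }
  time-≤ : ∀ {P τ Post} → Runs P τ (3 + D bounds b * (9 + (stmtTime p B + 6))) Post →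
           Runs P τ (3 + B * (9 + (stmtTime p B + 6))) Post
  time-≤ (υ , m , run , m≤ , post) =
    υ , m , run , ≤-trans m≤ (+-monoʳ-≤ 3 (*-monoˡ-≤ _ (bound b))) , post

-- Polynomial bounds on running times

PolyBounded : (ℕ → ℕ) → Set
PolyBounded T = ∃[ c ] ∃[ d ] (∀ B → 1 ≤ B → T B ≤ c * B ^ d)

poly-const : ∀ a → PolyBounded (λ _ → a)
poly-const a = a , 0 , λ _ _ → ≤-reflexive (sym (*-identityʳ a))

poly-+ : ∀ {S T} → PolyBounded S → PolyBounded T → PolyBounded (λ B → S B + T B)
poly-+ {S} {T} (c , d , p) (c′ , d′ , p′) = c + c′ , d + d′ , λ B 1≤B → begin
  S B + T B                            ≤⟨ +-mono-≤ (p B 1≤B) (p′ B 1≤B) ⟩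
  c * B ^ d + c′ * B ^ d′              ≤⟨ +-mono-≤ (*-monoʳ-≤ c (power B 1≤B (m≤m+n d d′)))
                                                   (*-monoʳ-≤ c′ (power B 1≤B (m≤n+m d′ d))) ⟩
  c * B ^ (d + d′) + c′ * B ^ (d + d′) ≡⟨ *-distribʳ-+ (B ^ (d + d′)) c c′ ⟨
  (c + c′) * B ^ (d + d′)              ∎
  where
  open ≤-Reasoning
  power : ∀ B → 1 ≤ B → ∀ {m n} → m ≤ n → B ^ m ≤ B ^ n
  power B 1≤B m≤n = ^-monoʳ-≤ B {{>-nonZero 1≤B}} m≤n

poly-B* : ∀ {T} → PolyBounded T → PolyBounded (λ B → B * T B)
poly-B* {T} (c , d , p) = c , suc d , λ B 1≤B → begin
  B * T B          ≤⟨ *-monoʳ-≤ B (p B 1≤B) ⟩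
  B * (c * B ^ d)  ≡⟨ x∙yz≈y∙xz B c (B ^ d) ⟩
  c * (B * B ^ d)  ∎
  where
  open ≤-Reasoning

termTime-poly : ∀ {v} (t : Term v) → PolyBounded (termTime t)
termTime-poly (var i)      = poly-const 4
termTime-poly (lit c)      = poly-const 3
termTime-poly (arr A t)    = poly-+ (termTime-poly t) (poly-const 5)
termTime-poly (s ⊞ t)      = poly-+ (termTime-poly s) (poly-+ (termTime-poly t) (poly-const 7))
termTime-poly (s ⊟ t)      = poly-+ (termTime-poly s) (poly-+ (termTime-poly t) (poly-const 7))
termTime-poly (ifz c s t)  =
  poly-+ (termTime-poly c) (poly-+ (poly-const 3) (poly-+ (termTime-poly s) (termTime-poly t)))
termTime-poly (lett s t)   = poly-+ (termTime-poly s) (poly-+ (termTime-poly t) (poly-const 4))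
termTime-poly (iter b s t) = poly-+ (termTime-poly s) (poly-+ (poly-const 10)
  (poly-B* (poly-+ (poly-const 9) (poly-+ (termTime-poly t) (poly-const 10)))))

stmtTime-poly : ∀ {v} (p : Stmt v) → PolyBounded (stmtTime p)
stmtTime-poly (set A s t) = poly-+ (termTime-poly s) (poly-+ (termTime-poly t) (poly-const 5))
stmtTime-poly (p ⨟ q)     = poly-+ (stmtTime-poly p) (stmtTime-poly q)
stmtTime-poly done        = poly-const 1
stmtTime-poly (ifz c p q) =
  poly-+ (termTime-poly c) (poly-+ (poly-const 3) (poly-+ (stmtTime-poly p) (stmtTime-poly q)))
stmtTime-poly (for b p)   = poly-+ (poly-const 10)
  (poly-B* (poly-+ (poly-const 9) (poly-+ (stmtTime-poly p) (poly-const 6))))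

-- Finite sums of natural numbers

sumTo : ℕ → (ℕ → ℕ) → ℕ
sumTo n f = recur (λ x z → z + f x) 0 n

sumTo-cong : ∀ n {f g} → (∀ x → x < n → f x ≡ g x) → sumTo n f ≡ sumTo n g
sumTo-cong zero    eq = refl
sumTo-cong (suc n) eq = cong₂ _+_ (sumTo-cong n (λ x x<n → eq x (m≤n⇒m≤1+n x<n))) (eq n ≤-refl)

sumTo-mono : ∀ n {f g} → (∀ x → x < n → f x ≤ g x) → sumTo n f ≤ sumTo n g
sumTo-mono zero    le = z≤n
sumTo-mono (suc n) le = +-mono-≤ (sumTo-mono n (λ x x<n → le x (m≤n⇒m≤1+n x<n))) (le n ≤-refl)

sumTo-const : ∀ n c → sumTo n (λ _ → c) ≡ n * c
sumTo-const zero    c = refl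
sumTo-const (suc n) c = trans (cong (_+ c) (sumTo-const n c)) (+-comm (n * c) c)

sumTo-+ : ∀ n f g → sumTo n (λ x → f x + g x) ≡ sumTo n f + sumTo n g
sumTo-+ zero    f g = refl
sumTo-+ (suc n) f g = trans (cong (_+ (f n + g n)) (sumTo-+ n f g)) (interchange (sumTo n f) (sumTo n g) (f n) (g n))
  where
  interchange : ∀ a b c d → a + b + (c + d) ≡ a + c + (b + d)
  interchange = solve-∀

sumTo-*ˡ : ∀ n c f → sumTo n (λ x → c * f x) ≡ c * sumTo n f
sumTo-*ˡ zero    c f = sym (*-zeroʳ c)
sumTo-*ˡ (suc n) c f = trans (cong (_+ c * f n) (sumTo-*ˡ n c f)) (sym (*-distribˡ-+ c _ (f n)))

sumTo-*ʳ : ∀ n c f → sumTo n (λ x → f x * c) ≡ sumTo n f * c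
sumTo-*ʳ n c f = trans (sumTo-cong n (λ x _ → *-comm (f x) c))
  (trans (sumTo-*ˡ n c f) (*-comm c _))

sumTo-swap : ∀ m n (f : ℕ → ℕ → ℕ) →
             sumTo m (λ x → sumTo n (f x)) ≡ sumTo n (λ y → sumTo m (λ x → f x y))
sumTo-swap zero    n f = sym (trans (sumTo-const n 0) (*-zeroʳ n))
sumTo-swap (suc m) n f = trans (cong (_+ sumTo n (f m)) (sumTo-swap m n f))
  (sym (sumTo-+ n (λ y → sumTo m (λ x → f x y)) (f m)))

sumTo-term : ∀ {n} f {x} → x < n → f x ≤ sumTo n f
sumTo-term {suc n} f {x} x<1+n with m≤n⇒m<n∨m≡n (s≤s⁻¹ x<1+n)
... | inj₁ x<n  = ≤-trans (sumTo-term f x<n) (m≤m+n _ _)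
... | inj₂ refl = m≤n+m _ _

sumTo-zero : ∀ n {f} → (∀ x → x < n → f x ≡ 0) → sumTo n f ≡ 0
sumTo-zero n eq = trans (sumTo-cong n eq) (trans (sumTo-const n 0) (*-zeroʳ n))

sumTo-spike : ∀ {n} f {u} → u < n → (∀ x → x < n → x ≢ u → f x ≡ 0) → sumTo n f ≡ f u
sumTo-spike {suc n} f {u} u<1+n zeros with m≤n⇒m<n∨m≡n (s≤s⁻¹ u<1+n)
... | inj₂ refl = cong (_+ f u) (sumTo-zero n (λ x x<n → zeros x (m≤n⇒m≤1+n x<n) (<⇒≢ x<n)))
... | inj₁ u<n  = trans (cong₂ _+_ (sumTo-spike f u<n (λ x x<n → zeros x (m≤n⇒m≤1+n x<n)))
                           (zeros n ≤-refl (λ eq → <⇒≢ u<n (sym eq))))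
                        (+-identityʳ _)

sumTo-complement : ∀ {n} f {u} U → u < n → (∀ x → x < n → f x ≤ U) → sumTo n f + U ≤ f u + n * U
sumTo-complement {suc n} f {u} U u<1+n le with m≤n⇒m<n∨m≡n (s≤s⁻¹ u<1+n)
... | inj₂ refl = begin
  sumTo n f + f u + U   ≤⟨ +-monoˡ-≤ U (+-monoˡ-≤ (f u) (≤-trans
                             (sumTo-mono n (λ x x<n → le x (m≤n⇒m≤1+n x<n)))
                             (≤-reflexive (sumTo-const n U)))) ⟩
  n * U + f u + U       ≡⟨ rearrange (n * U) (f u) U ⟩
  f u + (U + n * U)     ∎
  where
  open ≤-Reasoning
  rearrange : ∀ a b c → a + b + c ≡ b + (c + a)
  rearrange = solve-∀
... | inj₁ u<n = begin
  sumTo n f + f n + U   ≡⟨ rearrange (sumTo n f) (f n) U ⟩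
  sumTo n f + U + f n   ≤⟨ +-mono-≤ (sumTo-complement f U u<n (λ x x<n → le x (m≤n⇒m≤1+n x<n))) (le n ≤-refl) ⟩
  f u + n * U + U       ≡⟨ rearrange′ (f u) (n * U) U ⟩
  f u + (U + n * U)     ∎
  where
  open ≤-Reasoning
  rearrange : ∀ a b c → a + b + c ≡ a + c + b
  rearrange = solve-∀
  rearrange′ : ∀ a b c → a + b + c ≡ a + (c + b)
  rearrange′ = solve-∀

-- The potential of a partial colouring

distance : ℕ → ℕ → ℕ
distance a b = (a ∸ b) + (b ∸ a)

distance-refl : ∀ a → distance a a ≡ 0
distance-refl a = cong₂ _+_ (n∸n≡0 a) (n∸n≡0 a)

distance≡0⇒≡ : ∀ {a b} → distance a b ≡ 0 → a ≡ b
distance≡0⇒≡ {a} {b} eq =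
  ≤-antisym (m∸n≡0⇒m≤n (m+n≡0⇒m≡0 (a ∸ b) eq)) (m∸n≡0⇒m≤n (m+n≡0⇒n≡0 (a ∸ b) eq))

-- The colour u < q is stored as u + 1; an uncoloured cell stores 0.
isColour : ℕ → ℕ → ℕ
isColour u c = ifzero (distance c (suc u)) 1 0

isColour-hit : ∀ u → isColour u (suc u) ≡ 1
isColour-hit u = cong (λ d → ifzero d 1 0) (distance-refl (suc u))

isColour-miss : ∀ {u c} → c ≢ suc u → isColour u c ≡ 0
isColour-miss {u} {c} c≢ with distance c (suc u) in eq
... | zero  = ⊥-elim (c≢ (distance≡0⇒≡ eq))
... | suc _ = refl

isColour-bit : ∀ u c → isColour u c ≡ 0 ⊎ isColour u c ≡ 1
isColour-bit u c with distance c (suc u)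
... | zero  = inj₂ refl
... | suc _ = inj₁ refl

Pattern : Set
Pattern = List (ℕ × ℕ)

-- The least column by which the pattern may be extended. Columns decrease strictly along the list,
-- so each set of columns occurs in one order only, and no column is prescribed twice.
lowest : Pattern → ℕ
lowest []             = 0
lowest ((j , _) ∷ _) = suc j

data Falling (n q : ℕ) : Pattern → Set where
  []  : Falling n q []
  _∷_ : ∀ {j u pat} → lowest pat ≤ j × j < n × u < q → Falling n q pat → Falling n q ((j , u) ∷ pat)

Colouring : Set
Colouring = ℕ → ℕ → ℕ

matches : Colouring → ℕ → Pattern → ℕ
matches f i []              = 1
matches f i ((j , u) ∷ pat) = isColour u (f i j) * matches f i pat

count : ℕ → Colouring → Pattern → ℕ
count k f pat = sumTo k (λ i → matches f i pat)

-- q times the probability that the cell gets colour u, when an uncoloured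
-- cell is to be coloured uniformly at random
chance : ℕ → ℕ → ℕ → ℕ
chance q u c = ifzero c 1 (isColour u c * q)

chances : ℕ → Colouring → ℕ → Pattern → ℕ
chances q f i []              = 1
chances q f i ((j , u) ∷ pat) = chance q u (f i j) * chances q f i pat

-- The product of `A + chances q f i pat` over the rows. For A = NQ this is A^k times ∏ (1 + p_i/N),
-- where p_i is `chances` divided by Q.
weight : ℕ → ℕ → ℕ → Colouring → Pattern → ℕ
weight q k A f pat = recur (λ i z → A * z + chances q f i pat * z) 1 k

-- The sum of the weights of all falling patterns that extend `pat` by at most `t` pairs; the
-- truncated difference selects the columns j ≥ `lowest pat`. The recursion has the shape of the
-- nested loops that will compute it.
potential : ℕ → ℕ → ℕ → ℕ → Colouring → ℕ → Pattern → ℕ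
potential q n k A f zero    pat = weight q k A f pat
potential q n k A f (suc t) pat = weight q k A f pat +
  sumTo n (λ j → ifzero (lowest pat ∸ j) (sumTo q (λ u → potential q n k A f t ((j , u) ∷ pat))) 0)

ifzero-cong : ∀ c {a a′} b → (c ≡ 0 → a ≡ a′) → ifzero c a b ≡ ifzero c a′ b
ifzero-cong zero    b eq = eq refl
ifzero-cong (suc c) b eq = refl

sumTo-ifzero : ∀ n c f → sumTo n (λ x → ifzero c (f x) 0) ≡ ifzero c (sumTo n f) 0
sumTo-ifzero n zero    f = refl
sumTo-ifzero n (suc c) f = trans (sumTo-const n 0) (*-zeroʳ n)

*-ifzero : ∀ a c b → a * ifzero c b 0 ≡ ifzero c (a * b) 0
*-ifzero a zero    b = refl
*-ifzero a (suc c) b = *-zeroʳ a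

-- `F v` is `f` with the cell in row `i₀` and column `j₀` painted in colour `v`. Agreement elsewhere
-- is demanded only for columns j < n: cells are stored row by row, so a column index beyond `n` may
-- address the painted cell.
record Extends (n : ℕ) (f : Colouring) (i₀ j₀ : ℕ) (F : ℕ → Colouring) : Set where
  field
    old   : f i₀ j₀ ≡ 0
    new   : ∀ v → F v i₀ j₀ ≡ suc v
    other : ∀ v i j → j < n → i ≢ i₀ ⊎ j ≢ j₀ → F v i j ≡ f i j

module Average {n q : ℕ} {f : Colouring} {i₀ j₀ : ℕ} {F : ℕ → Colouring} (ext : Extends n f i₀ j₀ F) where
  open Extends ext

  -- Of the q colours only `u` contributes, with chance q; the blank cell has chance 1 for each of
  -- the q terms on the right.
  chance-average : ∀ {u} → u < q → sumTo q (λ v → chance q u (F v i₀ j₀)) ≡ q * chance q u (f i₀ j₀)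
  chance-average {u} u<q = begin
    sumTo q (λ v → chance q u (F v i₀ j₀))  ≡⟨ sumTo-cong q (λ v _ → cong (chance q u) (new v)) ⟩
    sumTo q (λ v → isColour u (suc v) * q)  ≡⟨ sumTo-*ʳ q q _ ⟩
    sumTo q (λ v → isColour u (suc v)) * q
      ≡⟨ cong (_* q) (sumTo-spike _ u<q (λ v _ v≢u → isColour-miss (λ eq → v≢u (suc-injective eq)))) ⟩
    isColour u (suc u) * q                  ≡⟨ cong (_* q) (isColour-hit u) ⟩
    1 * q                                   ≡⟨ *-comm 1 q ⟩
    q * chance q u 0                        ≡⟨ cong (λ c → q * chance q u c) old ⟨
    q * chance q u (f i₀ j₀)                ∎
    where open ≡-Reasoning

  chances-row : ∀ v {i pat} → i ≢ i₀ → Falling n q pat → chances q (F v) i pat ≡ chances q f i pat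
  chances-row v i≢ []                     = refl
  chances-row v i≢ ((_ , j<n , _) ∷ fall) =
    cong₂ _*_ (cong (chance q _) (other v _ _ j<n (inj₁ i≢))) (chances-row v i≢ fall)

  chances-above : ∀ v i {pat} → lowest pat ≤ j₀ → Falling n q pat → chances q (F v) i pat ≡ chances q f i pat
  chances-above v i low []                          = refl
  chances-above v i low ((low′ , j<n , _) ∷ fall) = cong₂ _*_
    (cong (chance q _) (other v _ _ j<n (inj₂ (<⇒≢ low))))
    (chances-above v i (≤-trans low′ (<⇒≤ low)) fall)

  -- The columns of a falling pattern are distinct, so at most one factor of the product depends on
  -- the painted cell; the pairs after it lie in smaller columns.
  chances-average : ∀ {pat} → Falling n q pat →
                    sumTo q (λ v → chances q (F v) i₀ pat) ≡ q * chances q f i₀ pat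
  chances-average [] = sumTo-const q 1
  chances-average {(j , u) ∷ pat} ((low , j<n , u<q) ∷ fall) with j ≟ j₀
  ... | yes refl = begin
    sumTo q (λ v → chance q u (F v i₀ j₀) * chances q (F v) i₀ pat)
      ≡⟨ sumTo-cong q (λ v _ → cong (chance q u (F v i₀ j₀) *_) (chances-above v i₀ low fall)) ⟩
    sumTo q (λ v → chance q u (F v i₀ j₀) * chances q f i₀ pat)
      ≡⟨ sumTo-*ʳ q (chances q f i₀ pat) _ ⟩
    sumTo q (λ v → chance q u (F v i₀ j₀)) * chances q f i₀ pat
      ≡⟨ cong (_* chances q f i₀ pat) (chance-average u<q) ⟩
    q * chance q u (f i₀ j₀) * chances q f i₀ pat
      ≡⟨ *-assoc q (chance q u (f i₀ j₀)) (chances q f i₀ pat) ⟩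
    q * (chance q u (f i₀ j₀) * chances q f i₀ pat) ∎
    where open ≡-Reasoning
  ... | no j≢j₀ = begin
    sumTo q (λ v → chance q u (F v i₀ j) * chances q (F v) i₀ pat)
      ≡⟨ sumTo-cong q (λ v _ → cong (λ c → chance q u c * chances q (F v) i₀ pat)
                                    (other v i₀ j j<n (inj₂ j≢j₀))) ⟩
    sumTo q (λ v → chance q u (f i₀ j) * chances q (F v) i₀ pat)
      ≡⟨ sumTo-*ˡ q (chance q u (f i₀ j)) (λ v → chances q (F v) i₀ pat) ⟩
    chance q u (f i₀ j) * sumTo q (λ v → chances q (F v) i₀ pat)
      ≡⟨ cong (chance q u (f i₀ j) *_) (chances-average fall) ⟩
    chance q u (f i₀ j) * (q * chances q f i₀ pat)
      ≡⟨ rearrange (chance q u (f i₀ j)) q _ ⟩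
    q * (chance q u (f i₀ j) * chances q f i₀ pat) ∎
    where
    open ≡-Reasoning
    rearrange : ∀ a b c → a * (b * c) ≡ b * (a * c)
    rearrange = solve-∀

  weight-rows : ∀ v {k A pat} → k ≤ i₀ → Falling n q pat → weight q k A (F v) pat ≡ weight q k A f pat
  weight-rows v {zero}  k≤ fall = refl
  weight-rows v {suc k} {A} k≤ fall = cong₂ (λ z c → A * z + c * z)
    (weight-rows v {A = A} (<⇒≤ k≤) fall) (chances-row v (<⇒≢ k≤) fall)

  -- Only the factor of row `i₀` changes, and the weight is an affine function of it. This passes to
  -- the potential, which is a sum of weights.
  weight-average : ∀ {k A pat} → i₀ < k → Falling n q pat →
                   sumTo q (λ v → weight q k A (F v) pat) ≡ q * weight q k A f pat
  weight-average {suc k} {A} {pat} i₀<1+k fall with m≤n⇒m<n∨m≡n (s≤s⁻¹ i₀<1+k)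
  ... | inj₁ i₀<k = begin
    sumTo q (λ v → A * w v + chances q (F v) k pat * w v)
      ≡⟨ sumTo-cong q (λ v _ → trans
           (cong (λ c → A * w v + c * w v) (chances-row v (λ eq → <⇒≢ i₀<k (sym eq)) fall))
           (sym (*-distribʳ-+ (w v) A _))) ⟩
    sumTo q (λ v → (A + chances q f k pat) * w v)
      ≡⟨ sumTo-*ˡ q (A + chances q f k pat) w ⟩
    (A + chances q f k pat) * sumTo q w
      ≡⟨ cong ((A + chances q f k pat) *_) (weight-average {A = A} i₀<k fall) ⟩
    (A + chances q f k pat) * (q * weight q k A f pat)
      ≡⟨ rearrange A (chances q f k pat) q _ ⟩
    q * (A * weight q k A f pat + chances q f k pat * weight q k A f pat) ∎
    where
    open ≡-Reasoning
    w : ℕ → ℕ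
    w v = weight q k A (F v) pat
    rearrange : ∀ a b c d → (a + b) * (c * d) ≡ c * (a * d + b * d)
    rearrange = solve-∀
  ... | inj₂ refl = begin
    sumTo q (λ v → A * weight q k A (F v) pat + c v * weight q k A (F v) pat)
      ≡⟨ sumTo-cong q (λ v _ → cong (λ z → A * z + c v * z) (weight-rows v {A = A} ≤-refl fall)) ⟩
    sumTo q (λ v → A * w + c v * w)
      ≡⟨ sumTo-+ q _ _ ⟩
    sumTo q (λ v → A * w) + sumTo q (λ v → c v * w)
      ≡⟨ cong₂ _+_ (sumTo-const q (A * w)) (trans (sumTo-*ʳ q w c) (cong (_* w) (chances-average fall))) ⟩
    q * (A * w) + q * chances q f i₀ pat * w
      ≡⟨ rearrange q (A * w) (chances q f i₀ pat) w ⟩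
    q * (A * w + chances q f i₀ pat * w) ∎
    where
    open ≡-Reasoning
    w : ℕ
    w = weight q k A f pat
    c : ℕ → ℕ
    c v = chances q (F v) i₀ pat
    rearrange : ∀ a b c d → a * b + a * c * d ≡ a * (b + c * d)
    rearrange = solve-∀

  potential-average : ∀ {k A} t {pat} → i₀ < k → Falling n q pat →
                      sumTo q (λ v → potential q n k A (F v) t pat) ≡ q * potential q n k A f t pat
  potential-average {A = A} zero i₀<k fall = weight-average {A = A} i₀<k fall
  potential-average {k} {A} (suc t) {pat} i₀<k fall = begin
    sumTo q (λ v → weight q k A (F v) pat + rest (F v))
      ≡⟨ sumTo-+ q _ _ ⟩
    sumTo q (λ v → weight q k A (F v) pat) + sumTo q (λ v → rest (F v))
      ≡⟨ cong₂ _+_ (weight-average {A = A} i₀<k fall) rests ⟩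
    q * weight q k A f pat + q * rest f
      ≡⟨ *-distribˡ-+ q _ _ ⟨
    q * (weight q k A f pat + rest f) ∎
    where
    open ≡-Reasoning
    inner : Colouring → ℕ → ℕ
    inner g j = sumTo q (λ u → potential q n k A g t ((j , u) ∷ pat))
    rest : Colouring → ℕ
    rest g = sumTo n (λ j → ifzero (lowest pat ∸ j) (inner g j) 0)
    inners : ∀ {j} → lowest pat ≤ j → j < n → sumTo q (λ v → inner (F v) j) ≡ q * inner f j
    inners {j} low j<n = begin
      sumTo q (λ v → inner (F v) j)
        ≡⟨ sumTo-swap q q (λ v u → potential q n k A (F v) t ((j , u) ∷ pat)) ⟩
      sumTo q (λ u → sumTo q (λ v → potential q n k A (F v) t ((j , u) ∷ pat)))
        ≡⟨ sumTo-cong q (λ u u<q → potential-average {A = A} t i₀<k ((low , j<n , u<q) ∷ fall)) ⟩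
      sumTo q (λ u → q * potential q n k A f t ((j , u) ∷ pat))
        ≡⟨ sumTo-*ˡ q q _ ⟩
      q * inner f j ∎
    rests : sumTo q (λ v → rest (F v)) ≡ q * rest f
    rests = begin
      sumTo q (λ v → rest (F v))
        ≡⟨ sumTo-swap q n (λ v j → ifzero (lowest pat ∸ j) (inner (F v) j) 0) ⟩
      sumTo n (λ j → sumTo q (λ v → ifzero (lowest pat ∸ j) (inner (F v) j) 0))
        ≡⟨ sumTo-cong n (λ j j<n → trans (sumTo-ifzero q (lowest pat ∸ j) _)
             (trans (ifzero-cong (lowest pat ∸ j) 0 (λ eq → inners (m∸n≡0⇒m≤n eq) j<n))
                    (sym (*-ifzero q (lowest pat ∸ j) _)))) ⟩
      sumTo n (λ j → q * ifzero (lowest pat ∸ j) (inner f j) 0)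
        ≡⟨ sumTo-*ˡ n q _ ⟩
      q * rest f ∎

weight≤potential : ∀ q n k A f t pat → weight q k A f pat ≤ potential q n k A f t pat
weight≤potential q n k A f zero    pat = ≤-refl
weight≤potential q n k A f (suc t) pat = m≤m+n _ _

potential-∷ : ∀ {q n} k A f t {j u pat} → lowest pat ≤ j × j < n × u < q →
  potential q n k A f t ((j , u) ∷ pat) ≤ potential q n k A f (suc t) pat
potential-∷ {q} {n} k A f t {j} {u} {pat} (low , j<n , u<q) = begin
  potential q n k A f t ((j , u) ∷ pat)                ≤⟨ sumTo-term _ u<q ⟩
  inner j                                              ≡⟨ cong (λ c → ifzero c (inner j) 0) (m≤n⇒m∸n≡0 low) ⟨
  ifzero (lowest pat ∸ j) (inner j) 0                  ≤⟨ sumTo-term (λ j → ifzero (lowest pat ∸ j) (inner j) 0) j<n ⟩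
  sumTo n (λ j → ifzero (lowest pat ∸ j) (inner j) 0)  ≤⟨ m≤n+m _ _ ⟩
  potential q n k A f (suc t) pat                      ∎
  where
  open ≤-Reasoning
  inner : ℕ → ℕ
  inner j = sumTo q (λ u → potential q n k A f t ((j , u) ∷ pat))

-- Removing the first pair of a pattern raises the budget `t` by one, and the pattern is among the
-- extensions of what remains. At the empty pattern the whole sum is reached.
potential-dominates : ∀ {q n} k A f t {pat} → Falling n q pat →
  potential q n k A f t pat ≤ potential q n k A f (length pat + t) []
potential-dominates k A f t [] = ≤-refl
potential-dominates {q} {n} k A f t {_ ∷ pat} (ok ∷ fall) =
  ≤-trans (potential-∷ k A f t ok)
    (subst (λ s → potential q n k A f (suc t) pat ≤ potential q n k A f s []) (+-suc (length pat) t)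
      (potential-dominates k A f (suc t) fall))

weight≤total : ∀ {q n} k A f {r pat} → Falling n q pat → length pat ≤ r →
  weight q k A f pat ≤ potential q n k A f r []
weight≤total {q} {n} k A f {r} {pat} fall len =
  ≤-trans (weight≤potential q n k A f (r ∸ length pat) pat)
    (subst (λ s → potential q n k A f (r ∸ length pat) pat ≤ potential q n k A f s [])
      (m+[n∸m]≡n len) (potential-dominates k A f (r ∸ length pat) fall))

module Uncoloured {q n : ℕ} {f : Colouring} (blank : ∀ i j → f i j ≡ 0) where

  chances-blank : ∀ i pat → chances q f i pat ≡ 1
  chances-blank i []              = refl
  chances-blank i ((j , u) ∷ pat) =
    cong₂ _*_ (cong (chance q u) (blank i j)) (chances-blank i pat)

  weight-blank : ∀ k A pat → weight q k A f pat ≡ suc A ^ k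
  weight-blank zero    A pat = refl
  weight-blank (suc k) A pat = trans
    (cong₂ (λ z c → A * z + c * z) (weight-blank k A pat) (chances-blank k pat))
    (rearrange A (suc A ^ k))
    where
    rearrange : ∀ a b → a * b + 1 * b ≡ b + a * b
    rearrange = solve-∀

  -- On a blank colouring every chance is 1 and every weight is `suc A ^ k`. Each level of the
  -- recursion offers the choice to stop or one of at most n q pairs.
  potential-blank : ∀ k A t pat → potential q n k A f t pat ≤ (1 + n * q) ^ t * suc A ^ k
  potential-blank k A zero    pat = ≤-reflexive (trans (weight-blank k A pat) (sym (+-identityʳ _)))
  potential-blank k A (suc t) pat = begin
    weight q k A f pat + rest             ≤⟨ +-mono-≤ (≤-trans (≤-reflexive (weight-blank k A pat)) T≥) rest≤ ⟩
    T + n * (q * T)                       ≡⟨ rearrange n q ((1 + n * q) ^ t) (suc A ^ k) ⟩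
    (1 + n * q) ^ suc t * suc A ^ k       ∎
    where
    open ≤-Reasoning
    T : ℕ
    T = (1 + n * q) ^ t * suc A ^ k
    T≥ : suc A ^ k ≤ T
    T≥ = m≤n*m (suc A ^ k) ((1 + n * q) ^ t) {{m^n≢0 (1 + n * q) t}}
    rest : ℕ
    rest = sumTo n (λ j → ifzero (lowest pat ∸ j) (sumTo q (λ u → potential q n k A f t ((j , u) ∷ pat))) 0)
    drop : ∀ c a → ifzero c a 0 ≤ a
    drop zero    a = ≤-refl
    drop (suc c) a = z≤n
    rest≤ : rest ≤ n * (q * T)
    rest≤ = begin
      rest                          ≤⟨ sumTo-mono n (λ j _ → ≤-trans (drop (lowest pat ∸ j) _)
                                        (sumTo-mono q (λ u _ → potential-blank k A t ((j , u) ∷ pat)))) ⟩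
      sumTo n (λ j → sumTo q (λ u → T))  ≡⟨ sumTo-cong n (λ _ _ → sumTo-const q T) ⟩
      sumTo n (λ j → q * T)         ≡⟨ sumTo-const n (q * T) ⟩
      n * (q * T)                   ∎
    rearrange : ∀ n q a b → a * b + n * (q * (a * b)) ≡ (a + (n * q) * a) * b
    rearrange = solve-∀

-- Weights and counts in a complete colouring

record Coloured (q n k : ℕ) (f : Colouring) : Set where
  constructor coloured
  field colour : ∀ i j → i < k → j < n → ∃[ v ] (v < q × f i j ≡ suc v)
open Coloured

module Final {q n k : ℕ} {f : Colouring} (col : Coloured q n k f) where

  matches-bit : ∀ i pat → matches f i pat ≡ 0 ⊎ matches f i pat ≡ 1
  matches-bit i []              = inj₂ refl
  matches-bit i ((j , u) ∷ pat) with isColour-bit u (f i j) | matches-bit i pat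
  ... | inj₁ eq | _       = inj₁ (cong (_* matches f i pat) eq)
  ... | inj₂ eq | inj₁ e  = inj₁ (trans (cong (isColour u (f i j) *_) e) (*-zeroʳ (isColour u (f i j))))
  ... | inj₂ eq | inj₂ e  = inj₂ (cong₂ _*_ eq e)

  chances-final : ∀ {i pat} → i < k → Falling n q pat →
                  chances q f i pat ≡ matches f i pat * q ^ length pat
  chances-final i<k [] = refl
  chances-final {i} {(j , u) ∷ pat} i<k ((_ , j<n , _) ∷ fall) = begin
    chance q u (f i j) * chances q f i pat
      ≡⟨ cong₂ _*_ chance≡ (chances-final i<k fall) ⟩
    isColour u (f i j) * q * (matches f i pat * q ^ length pat)
      ≡⟨ rearrange (isColour u (f i j)) q _ _ ⟩
    isColour u (f i j) * matches f i pat * (q * q ^ length pat) ∎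
    where
    open ≡-Reasoning
    chance≡ : chance q u (f i j) ≡ isColour u (f i j) * q
    chance≡ with f i j | proj₂ (proj₂ (colour col i j i<k j<n))
    ... | .(suc _) | refl = refl
    rearrange : ∀ a b c d → a * b * (c * d) ≡ a * c * (b * d)
    rearrange = solve-∀

  -- A row with the pattern contributes `A + q ^ length pat`, any other row `A`. The factor
  -- `A ^ count` on the left avoids the difference of `k′` and the count in an exponent.
  weight-final : ∀ {k′ A pat} → k′ ≤ k → Falling n q pat →
    weight q k′ A f pat * A ^ count k′ f pat ≡ (A + q ^ length pat) ^ count k′ f pat * A ^ k′
  weight-final {zero}  k′≤ fall = refl
  weight-final {suc k′} {A} {pat} k′≤ fall with matches f k′ pat | matches-bit k′ pat | chances-final k′≤ fall
  ... | .0 | inj₁ refl | eq rewrite eq | +-identityʳ (count k′ f pat) = begin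
    (A * w + 0 * w) * A ^ c        ≡⟨ rearrange A w (A ^ c) ⟩
    A * (w * A ^ c)                ≡⟨ cong (A *_) (weight-final (<⇒≤ k′≤) fall) ⟩
    A * (B ^ c * A ^ k′)           ≡⟨ rearrange′ A (B ^ c) (A ^ k′) ⟩
    B ^ c * (A * A ^ k′)           ∎
    where
    open ≡-Reasoning
    c w B : ℕ
    c = count k′ f pat
    w = weight q k′ A f pat
    B = A + q ^ length pat
    rearrange : ∀ a w x → (a * w + 0 * w) * x ≡ a * (w * x)
    rearrange = solve-∀
    rearrange′ : ∀ a b c → a * (b * c) ≡ b * (a * c)
    rearrange′ = solve-∀
  ... | .1 | inj₂ refl | eq rewrite eq | +-comm (count k′ f pat) 1 = begin
    (A * w + 1 * y * w) * (A * A ^ c)  ≡⟨ rearrange A w y (A ^ c) ⟩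
    (A + y) * A * (w * A ^ c)          ≡⟨ cong ((A + y) * A *_) (weight-final (<⇒≤ k′≤) fall) ⟩
    (A + y) * A * (B ^ c * A ^ k′)     ≡⟨ rearrange′ (A + y) A (B ^ c) (A ^ k′) ⟩
    (A + y) * B ^ c * (A * A ^ k′)     ∎
    where
    open ≡-Reasoning
    c w y B : ℕ
    c = count k′ f pat
    w = weight q k′ A f pat
    y = q ^ length pat
    B = A + y
    rearrange : ∀ a w y x → (a * w + 1 * y * w) * (a * x) ≡ (a + y) * a * (w * x)
    rearrange = solve-∀
    rearrange′ : ∀ b a c d → b * a * (c * d) ≡ b * c * (a * d)
    rearrange′ = solve-∀

  isColour-total : ∀ i {j} → i < k → j < n → sumTo q (λ u → isColour u (f i j)) ≡ 1
  isColour-total i {j} i<k j<n with colour col i j i<k j<n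
  ... | v , v<q , eq rewrite eq =
    trans (sumTo-spike _ v<q (λ u _ u≢v → isColour-miss (λ e → u≢v (sym (suc-injective e))))) (isColour-hit v)

  count-split : ∀ {j} pat → j < n → sumTo q (λ u → count k f ((j , u) ∷ pat)) ≡ count k f pat
  count-split {j} pat j<n = trans (sumTo-swap q k (λ u i → isColour u (f i j) * matches f i pat))
    (sumTo-cong k (λ i i<k → trans (sumTo-*ʳ q (matches f i pat) _)
      (trans (cong (_* matches f i pat) (isColour-total i i<k j<n)) (*-identityˡ _))))

-- Inequalities between powers

^-distrib-* : ∀ n a b → (a * b) ^ n ≡ a ^ n * b ^ n
^-distrib-* zero    a b = refl
^-distrib-* (suc n) a b = trans (cong (a * b *_) (^-distrib-* n a b)) (*-interchange a b (a ^ n) (b ^ n))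

-- Bernoulli's inequality (1 + y/x)^m ≥ 1 + m y/x, multiplied by x^(m+1).
bernoulli : ∀ x y m → x ^ m * (x + m * y) ≤ (x + y) ^ m * x
bernoulli x y zero    = ≤-reflexive (cong (1 *_) (+-identityʳ x))
bernoulli x y (suc m) = begin
  x * x ^ m * (x + (y + m * y))                     ≤⟨ m≤m+n _ (x ^ m * (m * (y * y))) ⟩
  x * x ^ m * (x + (y + m * y)) + x ^ m * (m * (y * y)) ≡⟨ rearrange x y m (x ^ m) ⟩
  (x + y) * (x ^ m * (x + m * y))                   ≤⟨ *-monoʳ-≤ (x + y) (bernoulli x y m) ⟩
  (x + y) * ((x + y) ^ m * x)                       ≡⟨ *-assoc (x + y) _ x ⟨
  (x + y) * (x + y) ^ m * x                         ∎
  where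
  open ≤-Reasoning
  rearrange : ∀ x y m p → x * p * (x + (y + m * y)) + p * (m * (y * y)) ≡ (x + y) * (p * (x + m * y))
  rearrange = solve-∀

-- (1 + 1/A)^x ≤ 1 + x/A + x²/A²
power-upper : ∀ A x → x ≤ A → suc A ^ x * (A * A) ≤ A ^ x * (A * A + x * A + x * x)
power-upper A zero    x≤ = ≤-reflexive (rearrange A)
  where
  rearrange : ∀ A → 1 * (A * A) ≡ 1 * (A * A + 0 * A + 0 * 0)
  rearrange = solve-∀
power-upper A (suc x) x≤ = begin
  suc A * suc A ^ x * (A * A)                       ≡⟨ *-assoc (suc A) (suc A ^ x) (A * A) ⟩
  suc A * (suc A ^ x * (A * A))                     ≤⟨ *-monoʳ-≤ (suc A) (power-upper A x (<⇒≤ x≤)) ⟩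
  suc A * (A ^ x * (A * A + x * A + x * x))         ≡⟨ rearrange₁ A x (A ^ x) ⟩
  A ^ x * (A * A * A + x * A * A + x * x * A + A * A + x * A + x * x)
    ≤⟨ *-monoʳ-≤ (A ^ x) (+-monoʳ-≤ (A * A * A + x * A * A + x * x * A + A * A + x * A) (*-monoʳ-≤ x (<⇒≤ x≤))) ⟩
  A ^ x * (A * A * A + x * A * A + x * x * A + A * A + x * A + x * A)
    ≤⟨ *-monoʳ-≤ (A ^ x) (m≤m+n _ A) ⟩
  A ^ x * (A * A * A + x * A * A + x * x * A + A * A + x * A + x * A + A)
    ≡⟨ rearrange₂ A x (A ^ x) ⟩
  A * A ^ x * (A * A + suc x * A + suc x * suc x)   ∎
  where
  open ≤-Reasoning
  rearrange₁ : ∀ A x p → (1 + A) * (p * (A * A + x * A + x * x)) ≡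
               p * (A * A * A + x * A * A + x * x * A + A * A + x * A + x * x)
  rearrange₁ = solve-∀
  rearrange₂ : ∀ A x p → p * (A * A * A + x * A * A + x * x * A + A * A + x * A + x * A + A) ≡
               A * p * (A * A + (1 + x) * A + (1 + x) * (1 + x))
  rearrange₂ = solve-∀

-- With N = D² + 1 this is a gap of (g + 1)/g between (1 + 1/N)^(D + 1) and (1 + 1/(NQ))^(QD).
tilt gap : ℕ → ℕ
tilt D = D * D + 1
gap D = tilt D * tilt D + D * tilt D + D * D

-- Bernoulli gives (1 + 1/N)^(D+1) ≥ 1 + (D + 1)/N, and `power-upper` gives (1 + 1/(NQ))^(QD) ≤ 1 +
-- D/N + D²/N². Multiplied by N² the upper bound is g and the lower bound is g + N - D² = g + 1;
-- this is why N exceeds D² by one.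
gap-step : ∀ D Q .{{_ : NonZero Q}} → let N = tilt D ; A = N * Q ; g = gap D in
  suc g * (N ^ suc D * suc A ^ (Q * D)) ≤ g * (A ^ (Q * D) * suc N ^ suc D)
gap-step D Q = *-cancelʳ-≤ _ _ (N * (A * A)) {{m*n≢0 N (A * A) {{N≢0}} {{m*n≢0 A A {{A≢0}} {{A≢0}}}}}} (begin
  suc g * (N ^ suc D * suc A ^ (Q * D)) * (N * (A * A))
    ≡⟨ rearrange₁ (suc g) (N ^ suc D) (suc A ^ (Q * D)) N (A * A) ⟩
  suc g * N * N ^ suc D * (suc A ^ (Q * D) * (A * A))
    ≤⟨ *-monoʳ-≤ (suc g * N * N ^ suc D) (power-upper A (Q * D) QD≤A) ⟩
  suc g * N * N ^ suc D * (A ^ (Q * D) * (A * A + Q * D * A + Q * D * (Q * D)))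
    ≡⟨ rearrange₂ (N ^ suc D) (A ^ (Q * D)) D Q ⟩
  g * (A * A) * A ^ (Q * D) * (N ^ suc D * (N + suc D * 1))
    ≤⟨ *-monoʳ-≤ (g * (A * A) * A ^ (Q * D)) (bernoulli N 1 (suc D)) ⟩
  g * (A * A) * A ^ (Q * D) * ((N + 1) ^ suc D * N)
    ≡⟨ cong (λ z → g * (A * A) * A ^ (Q * D) * (z ^ suc D * N)) (+-comm N 1) ⟩
  g * (A * A) * A ^ (Q * D) * (suc N ^ suc D * N)
    ≡⟨ rearrange₃ g (A * A) (A ^ (Q * D)) (suc N ^ suc D) N ⟩
  g * (A ^ (Q * D) * suc N ^ suc D) * (N * (A * A)) ∎)
  where
  open ≤-Reasoning
  N A g : ℕ
  N = tilt D
  A = N * Q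
  g = gap D
  N≢0 : NonZero N
  N≢0 = subst NonZero (+-comm 1 (D * D)) _
  A≢0 : NonZero A
  A≢0 = m*n≢0 N Q {{N≢0}}
  QD≤A : Q * D ≤ A
  QD≤A = begin
    Q * D            ≡⟨ *-comm Q D ⟩
    D * Q            ≤⟨ *-monoˡ-≤ Q (≤-trans (square D) (m≤m+n (D * D) 1)) ⟩
    A                ∎
    where
    square : ∀ d → d ≤ d * d
    square zero    = z≤n
    square (suc d) = m≤m+n (suc d) _
  rearrange₁ : ∀ a b c d e → a * (b * c) * (d * e) ≡ a * d * b * (c * e)
  rearrange₁ = solve-∀
  rearrange₂ : ∀ p x D Q → let N = D * D + 1 ; A = N * Q ; g = N * N + D * N + D * D in
    (1 + g) * N * p * (x * (A * A + Q * D * A + Q * D * (Q * D))) ≡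
    g * (A * A) * x * (p * (N + (1 + D) * 1))
  rearrange₂ = solve-∀
  rearrange₃ : ∀ a b c d e → a * b * c * (d * e) ≡ a * (c * d) * (e * b)
  rearrange₃ = solve-∀

gap-power : ∀ D Q K .{{_ : NonZero Q}} → let N = tilt D ; A = N * Q ; g = gap D in
  suc g ^ K * (N ^ (suc D * K) * suc A ^ (Q * D * K)) ≤ g ^ K * (A ^ (Q * D * K) * suc N ^ (suc D * K))
gap-power D Q K = subst₂ _≤_ (distribute (suc g) (N ^ suc D) (suc A ^ (Q * D)) (^-*-assoc N (suc D) K) (^-*-assoc (suc A) (Q * D) K))
    (distribute g (A ^ (Q * D)) (suc N ^ suc D) (^-*-assoc A (Q * D) K) (^-*-assoc (suc N) (suc D) K))
    (^-monoˡ-≤ K (gap-step D Q))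
  where
  N A g : ℕ
  N = tilt D
  A = N * Q
  g = gap D
  distribute : ∀ a b c {b′ c′} → b ^ K ≡ b′ → c ^ K ≡ c′ → (a * (b * c)) ^ K ≡ a ^ K * (b′ * c′)
  distribute a b c refl refl = trans (^-distrib-* K a (b * c)) (cong (a ^ K *_) (^-distrib-* K b c))

gap≢0 : ∀ D → NonZero (gap D)
gap≢0 D = subst NonZero (sym (expand D)) _
  where
  expand : ∀ D → let N = D * D + 1 in
           N * N + D * N + D * D ≡ 1 + (D * D * (D * D) + 2 * (D * D) + (D * N + D * D))
  expand = solve-∀

-- By Bernoulli (1 + 1/g)^g ≥ 2, so g repetitions of the gap double it.
gap-doubles : ∀ D K → 2 ^ K * gap D ^ (gap D * K) ≤ suc (gap D) ^ (gap D * K)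
gap-doubles D K = begin
  2 ^ K * g ^ (g * K)    ≡⟨ cong (2 ^ K *_) (^-*-assoc g g K) ⟨
  2 ^ K * (g ^ g) ^ K    ≡⟨ ^-distrib-* K 2 (g ^ g) ⟨
  (2 * g ^ g) ^ K        ≤⟨ ^-monoˡ-≤ K (*-cancelʳ-≤ _ _ g double) ⟩
  (suc g ^ g) ^ K        ≡⟨ ^-*-assoc (suc g) g K ⟩
  suc g ^ (g * K)        ∎
  where
  open ≤-Reasoning
  g : ℕ
  g = gap D
  instance
    g≢0 : NonZero g
    g≢0 = gap≢0 D
  double : 2 * g ^ g * g ≤ suc g ^ g * g
  double = begin
    2 * g ^ g * g          ≡⟨ rearrange (g ^ g) g ⟩
    g ^ g * (g + g * 1)    ≤⟨ bernoulli g 1 g ⟩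
    (g + 1) ^ g * g        ≡⟨ cong (λ z → z ^ g * g) (+-comm g 1) ⟩
    suc g ^ g * g          ∎
    where
    rearrange : ∀ p g → 2 * p * g ≡ p * (g + g * 1)
    rearrange = solve-∀

-- Chernoff's bound for the counts of patterns

module Balance {q n : ℕ} {f : Colouring} (D K′ r : ℕ) .{{q≢0 : NonZero q}} where

  -- One unit of `K` gains the factor (g + 1)/g of `gap-step`, hence `g * K′` units gain `2 ^ K′`,
  -- more than the bound (1 + nq)^r on the number of patterns. The factor `Q` in `k` makes the
  -- expected count k/q^s of a pattern of length s ≤ r an integer.
  Q g K k A : ℕ
  Q = q ^ r
  g = gap D
  K = g * K′
  k = Q * D * K
  A = tilt D * Q

  -- This is `k` times 1 + 1/D. A count times q^s is expected to be `k`, whatever the length s, so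
  -- one upper bound serves all patterns.
  target : ℕ
  target = suc D * K * Q

  private instance
    Q≢0 : NonZero Q
    Q≢0 = m^n≢0 q r {{q≢0}}
    N≢0 : NonZero (tilt D)
    N≢0 = subst NonZero (+-comm 1 (D * D)) _
    A≢0 : NonZero A
    A≢0 = m*n≢0 (tilt D) Q {{N≢0}} {{Q≢0}}

  module _ (few : (1 + n * q) ^ r < 2 ^ K′) (col : Coloured q n k f)
           (small : potential q n k A f r [] ≤ (1 + n * q) ^ r * suc A ^ k) where

    private
      N T e : ℕ
      N = tilt D
      T = (1 + n * q) ^ r
      e = suc D * K

    -- The hypothesis says (1 + 1/N)^e ≤ T (1 + 1/A)^k. By `gap-power` the quotient of the two
    -- powers is at least (1 + 1/g)^K, and by `gap-doubles` this is at least 2^K′.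
    growth-bounded : suc N ^ e * A ^ k ≤ T * suc A ^ k * N ^ e → 2 ^ K′ ≤ T
    growth-bounded bound = *-cancelʳ-≤ _ _ (g ^ K) {{m^n≢0 g K {{g≢0}}}} (≤-trans (gap-doubles D K′)
      (*-cancelʳ-≤ _ _ (N ^ e * suc A ^ k) {{m*n≢0 _ _ {{m^n≢0 N e}} {{m^n≢0 (suc A) k}}}} (begin
        suc g ^ K * (N ^ e * suc A ^ k)      ≤⟨ gap-power D Q K ⟩
        g ^ K * (A ^ k * suc N ^ e)          ≡⟨ cong (g ^ K *_) (*-comm (A ^ k) _) ⟩
        g ^ K * (suc N ^ e * A ^ k)          ≤⟨ *-monoʳ-≤ (g ^ K) bound ⟩
        g ^ K * (T * suc A ^ k * N ^ e)      ≡⟨ rearrange (g ^ K) T (suc A ^ k) (N ^ e) ⟩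
        T * g ^ K * (N ^ e * suc A ^ k)      ∎)))
      where
      open ≤-Reasoning
      rearrange : ∀ a b c d → a * (b * c * d) ≡ b * a * (d * c)
      rearrange = solve-∀
      g≢0 : NonZero g
      g≢0 = gap≢0 D

    private
      module _ {pat} (fall : Falling n q pat) (len : length pat ≤ r) where

        s m y B c : ℕ
        s = length pat
        m = q ^ (r ∸ s)
        y = q ^ s
        B = A + y
        c = count k f pat

        instance
          B≢0 : NonZero B
          B≢0 = >-nonZero (≤-trans (>-nonZero⁻¹ A) (m≤m+n A y))

        Q≡ : Q ≡ m * y
        Q≡ = trans (cong (q ^_) (sym (m∸n+n≡m len))) (^-distribˡ-+-* q (r ∸ s) s)

        weighed : B ^ c * A ^ k ≤ T * suc A ^ k * A ^ c
        weighed = begin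
          B ^ c * A ^ k                  ≡⟨ Final.weight-final col ≤-refl fall ⟨
          weight q k A f pat * A ^ c     ≤⟨ *-monoˡ-≤ (A ^ c) (≤-trans (weight≤total k A f fall len) small) ⟩
          T * suc A ^ k * A ^ c          ∎
          where open ≤-Reasoning

        -- Since A ≤ B, the surplus of the count over `m * e` only makes `weighed` stronger and can
        -- be cancelled.
        truncated : m * e ≤ c → B ^ (m * e) * A ^ k ≤ T * suc A ^ k * A ^ (m * e)
        truncated me≤c = *-cancelʳ-≤ _ _ (B ^ d) {{m^n≢0 B d}} (begin
          B ^ (m * e) * A ^ k * B ^ d           ≡⟨ rearrange (B ^ (m * e)) (A ^ k) (B ^ d) ⟩
          B ^ (m * e) * B ^ d * A ^ k           ≡⟨ cong (_* A ^ k) (join B) ⟩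
          B ^ c * A ^ k                         ≤⟨ weighed ⟩
          T * suc A ^ k * A ^ c                 ≡⟨ cong (T * suc A ^ k *_) (join A) ⟨
          T * suc A ^ k * (A ^ (m * e) * A ^ d) ≤⟨ *-monoʳ-≤ (T * suc A ^ k) (*-monoʳ-≤ (A ^ (m * e))
                                                    (^-monoˡ-≤ d (m≤m+n A y))) ⟩
          T * suc A ^ k * (A ^ (m * e) * B ^ d) ≡⟨ *-assoc (T * suc A ^ k) _ _ ⟨
          T * suc A ^ k * A ^ (m * e) * B ^ d   ∎)
          where
          open ≤-Reasoning
          d : ℕ
          d = c ∸ m * e
          join : ∀ x → x ^ (m * e) * x ^ d ≡ x ^ c
          join x = trans (sym (^-distribˡ-+-* x (m * e) d)) (cong (x ^_) (m+[n∸m]≡n me≤c))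
          rearrange : ∀ a b c → a * b * c ≡ a * c * b
          rearrange = solve-∀

        -- By Bernoulli (1 + y/A)^m ≥ 1 + my/A, which is 1 + 1/N because my = Q. From here on the
        -- length of the pattern has left the estimate.
        tilted : A ^ m * suc N ≤ B ^ m * N
        tilted = *-cancelʳ-≤ _ _ Q (begin
          A ^ m * suc N * Q        ≡⟨ rearrange (A ^ m) N Q ⟩
          A ^ m * (A + Q)          ≡⟨ cong (λ z → A ^ m * (A + z)) Q≡ ⟩
          A ^ m * (A + m * y)      ≤⟨ bernoulli A y m ⟩
          B ^ m * A                ≡⟨ *-assoc (B ^ m) N Q ⟨
          B ^ m * N * Q            ∎)
          where
          open ≤-Reasoning
          rearrange : ∀ p N Q → p * (1 + N) * Q ≡ p * (N * Q + Q)
          rearrange = solve-∀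

        tilted-power : A ^ (m * e) * suc N ^ e ≤ B ^ (m * e) * N ^ e
        tilted-power = subst₂ _≤_ (power A (suc N)) (power B N) (^-monoˡ-≤ e tilted)
          where
          power : ∀ a b → (a ^ m * b) ^ e ≡ a ^ (m * e) * b ^ e
          power a b = trans (^-distrib-* e (a ^ m) b) (cong (_* b ^ e) (^-*-assoc a m e))

        growth : m * e ≤ c → suc N ^ e * A ^ k ≤ T * suc A ^ k * N ^ e
        growth me≤c = *-cancelʳ-≤ _ _ (A ^ (m * e)) {{m^n≢0 A (m * e)}} (begin
          suc N ^ e * A ^ k * A ^ (m * e)         ≡⟨ rearrange₁ (suc N ^ e) (A ^ k) (A ^ (m * e)) ⟩
          A ^ (m * e) * suc N ^ e * A ^ k         ≤⟨ *-monoˡ-≤ (A ^ k) tilted-power ⟩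
          B ^ (m * e) * N ^ e * A ^ k             ≡⟨ rearrange₂ (B ^ (m * e)) (N ^ e) (A ^ k) ⟩
          B ^ (m * e) * A ^ k * N ^ e             ≤⟨ *-monoˡ-≤ (N ^ e) (truncated me≤c) ⟩
          T * suc A ^ k * A ^ (m * e) * N ^ e     ≡⟨ rearrange₂ (T * suc A ^ k) (A ^ (m * e)) (N ^ e) ⟩
          T * suc A ^ k * N ^ e * A ^ (m * e)     ∎)
          where
          open ≤-Reasoning
          rearrange₁ : ∀ a b c → a * b * c ≡ c * a * b
          rearrange₁ = solve-∀
          rearrange₂ : ∀ a b c → a * b * c ≡ a * c * b
          rearrange₂ = solve-∀

    -- The threshold `m * e` is the expected count `m * D * K` times 1 + 1/D. A count that reached
    -- it would contradict `few`.
    count-upper : ∀ {pat} → Falling n q pat → length pat ≤ r →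
                  count k f pat * q ^ length pat ≤ target
    count-upper {pat} fall len with m fall len * e ≤? c fall len
    ... | yes me≤c = ⊥-elim (<⇒≱ few (growth-bounded (growth fall len me≤c)))
    ... | no  me≰c = begin
      c fall len * q ^ length pat              ≤⟨ *-monoˡ-≤ (q ^ length pat) (<⇒≤ (≰⇒> me≰c)) ⟩
      m fall len * e * q ^ length pat          ≡⟨ rearrange (m fall len) e (q ^ length pat) ⟩
      e * (m fall len * q ^ length pat)        ≡⟨ cong (e *_) (Q≡ fall len) ⟨
      target                                   ∎
      where
      open ≤-Reasoning
      rearrange : ∀ a b c → a * b * c ≡ b * (a * c)
      rearrange = solve-∀

    -- At the empty pattern the deficit of `k` against `target` is `Q * K`. Appending a variable
    -- splits a count into q parts; q - 1 of them are at most their upper bound, so the last one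
    -- inherits the deficit, multiplied by q.
    count-lower : ∀ {pat} → Falling n q pat → length pat ≤ r →
                  target ≤ count k f pat * q ^ length pat + Q * K * q ^ length pat
    count-lower [] len = begin
      suc D * K * Q                ≡⟨ rearrange D K Q ⟩
      k * 1 * 1 + Q * K * 1        ≡⟨ cong (λ z → z * 1 + Q * K * 1) (sumTo-const k 1) ⟨
      count k f [] * 1 + Q * K * 1 ∎
      where
      open ≤-Reasoning
      rearrange : ∀ D K Q → (1 + D) * K * Q ≡ Q * D * K * 1 * 1 + Q * K * 1
      rearrange = solve-∀
    count-lower {(j , u) ∷ pat} (ok@(low , j<n , u<q) ∷ fall) len =
      +-cancelʳ-≤ (q * target) _ _ (begin
        target + q * target
          ≤⟨ +-monoʳ-≤ target (*-monoʳ-≤ q (count-lower fall (<⇒≤ len))) ⟩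
        target + q * (c₀ * y₀ + Q * K * y₀)
          ≡⟨ rearrange₁ target q c₀ y₀ (Q * K) ⟩
        c₀ * (q * y₀) + target + Q * K * (q * y₀)
          ≡⟨ cong (λ z → z * (q * y₀) + target + Q * K * (q * y₀)) (Final.count-split col pat j<n) ⟨
        sumTo q cu * (q * y₀) + target + Q * K * (q * y₀)
          ≡⟨ cong (λ z → z + target + Q * K * (q * y₀)) (sumTo-*ʳ q (q * y₀) cu) ⟨
        sumTo q (λ v → cu v * (q * y₀)) + target + Q * K * (q * y₀)
          ≤⟨ +-monoˡ-≤ (Q * K * (q * y₀)) (sumTo-complement (λ v → cu v * (q * y₀)) target u<q
               (λ v v<q → count-upper ((low , j<n , v<q) ∷ fall) len)) ⟩
        cu u * (q * y₀) + q * target + Q * K * (q * y₀)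
          ≡⟨ rearrange₂ (cu u * (q * y₀)) (q * target) (Q * K * (q * y₀)) ⟩
        cu u * (q * y₀) + Q * K * (q * y₀) + q * target ∎)
      where
      open ≤-Reasoning
      c₀ y₀ : ℕ
      c₀ = count k f pat
      y₀ = q ^ length pat
      cu : ℕ → ℕ
      cu v = count k f ((j , v) ∷ pat)
      rearrange₁ : ∀ t q c y z → t + q * (c * y + z * y) ≡ c * (q * y) + t + z * (q * y)
      rearrange₁ = solve-∀
      rearrange₂ : ∀ a b c → a + b + c ≡ a + c + b
      rearrange₂ = solve-∀

-- Binomial and multinomial coefficients

binom : ℕ → ℕ → ℕ
binom n       zero    = 1
binom zero    (suc k) = 0
binom (suc n) (suc k) = binom n k + binom n (suc k)

binom-zero : ∀ {n k} → n < k → binom n k ≡ 0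
binom-zero {zero}  {suc k} _         = refl
binom-zero {suc n} {suc k} (s≤s n<k) = cong₂ _+_ (binom-zero n<k) (binom-zero (m≤n⇒m≤1+n n<k))

binom-absorb : ∀ n k → suc k * binom (suc n) (suc k) ≡ suc n * binom n k
binom-absorb zero    zero    = refl
binom-absorb zero    (suc k) = *-zeroʳ (2 + k)
binom-absorb (suc n) zero    = begin
  1 * (1 + binom (suc n) 1)        ≡⟨ rearrange (binom (suc n) 1) ⟩
  1 + 1 * binom (suc n) 1          ≡⟨ cong suc (binom-absorb n 0) ⟩
  suc (suc n * 1)                  ∎
  where
  open ≡-Reasoning
  rearrange : ∀ b → 1 * (1 + b) ≡ 1 + 1 * b
  rearrange = solve-∀
binom-absorb (suc n) (suc k) = begin
  (2 + k) * (b₁ + b₂)                       ≡⟨ rearrange k b₁ b₂ ⟩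
  suc k * b₁ + b₁ + (2 + k) * b₂            ≡⟨ cong₂ (λ x y → x + b₁ + y) (binom-absorb n k) (binom-absorb n (suc k)) ⟩
  suc n * binom n k + b₁ + suc n * binom n (suc k) ≡⟨ rearrange′ n (binom n k) (binom n (suc k)) ⟩
  (2 + n) * b₁                              ∎
  where
  open ≡-Reasoning
  b₁ b₂ : ℕ
  b₁ = binom (suc n) (suc k)
  b₂ = binom (suc n) (suc (suc k))
  rearrange : ∀ k a b → (2 + k) * (a + b) ≡ (1 + k) * a + a + (2 + k) * b
  rearrange = solve-∀
  rearrange′ : ∀ n a b → (1 + n) * a + (a + b) + (1 + n) * b ≡ (2 + n) * (a + b)
  rearrange′ = solve-∀

-- The ratio (n - k)/(k + 1) of neighbouring binomial coefficients, with the negative part moved to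
-- the left.
binom-step : ∀ n k → suc k * binom n (suc k) + k * binom n k ≡ n * binom n k
binom-step n k = +-cancelʳ-≡ (binom n k) _ _ (begin
  suc k * binom n (suc k) + k * binom n k + binom n k  ≡⟨ rearrange k (binom n (suc k)) (binom n k) ⟩
  suc k * (binom n k + binom n (suc k))                ≡⟨ binom-absorb n k ⟩
  suc n * binom n k                                    ≡⟨ +-comm (binom n k) _ ⟩
  n * binom n k + binom n k                            ∎)
  where
  open ≡-Reasoning
  rearrange : ∀ k a b → (1 + k) * a + k * b + b ≡ (1 + k) * (b + a)
  rearrange = solve-∀

binom-factorial : ∀ k l → binom (k + l) k * (k ! * l !) ≡ (k + l) !
binom-factorial zero    l = rearrange (l !)
  where
  rearrange : ∀ a → 1 * (1 * a) ≡ a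
  rearrange = solve-∀
binom-factorial (suc k) l = begin
  binom (suc (k + l)) (suc k) * (suc k * k ! * l !)  ≡⟨ rearrange (binom (suc (k + l)) (suc k)) (suc k) (k !) (l !) ⟩
  suc k * binom (suc (k + l)) (suc k) * (k ! * l !)  ≡⟨ cong (_* (k ! * l !)) (binom-absorb (k + l) k) ⟩
  suc (k + l) * binom (k + l) k * (k ! * l !)        ≡⟨ *-assoc (suc (k + l)) (binom (k + l) k) (k ! * l !) ⟩
  suc (k + l) * (binom (k + l) k * (k ! * l !))      ≡⟨ cong (suc (k + l) *_) (binom-factorial k l) ⟩
  suc (k + l) * (k + l) !                            ∎
  where
  open ≡-Reasoning
  rearrange : ∀ a b c d → a * (b * c * d) ≡ b * a * (c * d)
  rearrange = solve-∀

-- The value is zero unless the entries have the sum `t`. Expansions can therefore run over all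
-- words with entries up to r, where the first entry splits off, and be restricted to the true
-- exponents at the end.
multinomial : ∀ {m} → ℕ → Vec ℕ m → ℕ
multinomial t []       = ifzero t 1 0
multinomial t (a ∷ as) = binom t a * multinomial (t ∸ a) as

factorials : ∀ {m} → Vec ℕ m → ℕ
factorials []       = 1
factorials (a ∷ as) = a ! * factorials as

multinomial-factorials : ∀ {m} (as : Vec ℕ m) → multinomial (sum as) as * factorials as ≡ sum as !
multinomial-factorials []       = refl
multinomial-factorials (a ∷ as) = begin
  binom (a + s) a * multinomial (a + s ∸ a) as * (a ! * factorials as)
    ≡⟨ cong (λ t → binom (a + s) a * multinomial t as * (a ! * factorials as)) (m+n∸m≡n a s) ⟩
  binom (a + s) a * multinomial s as * (a ! * factorials as)
    ≡⟨ rearrange (binom (a + s) a) (multinomial s as) (a !) (factorials as) ⟩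
  binom (a + s) a * (a ! * (multinomial s as * factorials as))
    ≡⟨ cong (λ z → binom (a + s) a * (a ! * z)) (multinomial-factorials as) ⟩
  binom (a + s) a * (a ! * s !)
    ≡⟨ binom-factorial a s ⟩
  (a + s) ! ∎
  where
  open ≡-Reasoning
  s : ℕ
  s = sum as
  rearrange : ∀ a b c d → a * b * (c * d) ≡ a * (c * (b * d))
  rearrange = solve-∀

-- A finite sample whose moments are close to those of the exponential distribution

sumList : {A : Set} → List A → (A → ℕ) → ℕ
sumList []       g = 0
sumList (x ∷ xs) g = g x + sumList xs g

sumList-++ : ∀ {A : Set} (xs ys : List A) g → sumList (xs ++ ys) g ≡ sumList xs g + sumList ys g
sumList-++ []       ys g = refl
sumList-++ (x ∷ xs) ys g = trans (cong (g x +_) (sumList-++ xs ys g)) (sym (+-assoc (g x) _ _))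

sumList-mono : ∀ {A : Set} (xs : List A) {f g} → (∀ x → f x ≤ g x) → sumList xs f ≤ sumList xs g
sumList-mono []       le = z≤n
sumList-mono (x ∷ xs) le = +-mono-≤ (le x) (sumList-mono xs le)

sumList-*ˡ : ∀ {A : Set} (xs : List A) c g → sumList xs (λ x → c * g x) ≡ c * sumList xs g
sumList-*ˡ []       c g = sym (*-zeroʳ c)
sumList-*ˡ (x ∷ xs) c g = trans (cong (c * g x +_) (sumList-*ˡ xs c g)) (sym (*-distribˡ-+ c (g x) _))

sumTo-front : ∀ n f → sumTo (suc n) f ≡ f 0 + sumTo n (λ x → f (suc x))
sumTo-front zero    f = sym (+-identityʳ (f 0))
sumTo-front (suc n) f = trans (cong (_+ f (suc n)) (sumTo-front n f)) (+-assoc (f 0) _ (f (suc n)))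

nth : List ℕ → ℕ → ℕ
nth []       i       = 0
nth (x ∷ xs) zero    = x
nth (x ∷ xs) (suc i) = nth xs i

sumTo-nth : ∀ xs (g : ℕ → ℕ) → sumTo (length xs) (λ i → g (nth xs i)) ≡ sumList xs g
sumTo-nth []       g = refl
sumTo-nth (x ∷ xs) g = trans (sumTo-front (length xs) _) (cong (g x +_) (sumTo-nth xs g))

-- The value of one coordinate over the lattice points of a simplex: c occurs
-- as often as b non-negative integers have the sum M - c.
simplex : ℕ → ℕ → List ℕ
simplex zero    M       = M ∷ []
simplex (suc b) zero    = simplex b zero
simplex (suc b) (suc M) = simplex (suc b) M ++ simplex b (suc M)

-- A convolution of binomial coefficients, proved by Pascal's rule along the recursion of `simplex`.
-- For M = 0 the recursion lacks the term C(b + e, a + b + 1), which vanishes because e ≤ a.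
simplex-binom : ∀ b M {e a} → e ≤ a →
  sumList (simplex b M) (λ c → binom (c + e) a) ≡ binom (M + b + e) (a + b)
simplex-binom zero M {e} {a} e≤a = trans (+-identityʳ _)
  (cong₂ (λ x y → binom (x + e) y) (sym (+-identityʳ M)) (sym (+-identityʳ a)))
simplex-binom (suc b) zero {e} {a} e≤a = begin
  sumList (simplex b zero) (λ c → binom (c + e) a)   ≡⟨ simplex-binom b zero e≤a ⟩
  binom (b + e) (a + b)                              ≡⟨ +-identityʳ _ ⟨
  binom (b + e) (a + b) + 0
    ≡⟨ cong (binom (b + e) (a + b) +_) (binom-zero (s≤s (≤-trans (+-monoʳ-≤ b e≤a) (≤-reflexive (+-comm b a))))) ⟨
  binom (suc b + e) (suc (a + b))                    ≡⟨ cong (binom (suc b + e)) (+-suc a b) ⟨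
  binom (suc b + e) (a + suc b)                      ∎
  where open ≡-Reasoning
simplex-binom (suc b) (suc M) {e} {a} e≤a = begin
  sumList (simplex (suc b) M ++ simplex b (suc M)) g
    ≡⟨ sumList-++ (simplex (suc b) M) _ g ⟩
  sumList (simplex (suc b) M) g + sumList (simplex b (suc M)) g
    ≡⟨ cong₂ _+_ (simplex-binom (suc b) M e≤a) (simplex-binom b (suc M) e≤a) ⟩
  binom (M + suc b + e) (a + suc b) + binom (suc M + b + e) (a + b)
    ≡⟨ cong₂ (λ x y → binom (x + e) y + binom (suc (M + b + e)) (a + b)) (+-suc M b) (+-suc a b) ⟩
  binom (suc (M + b + e)) (suc (a + b)) + binom (suc (M + b + e)) (a + b)
    ≡⟨ +-comm (binom (suc (M + b + e)) (suc (a + b))) _ ⟩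
  binom (suc (suc (M + b + e))) (suc (a + b))
    ≡⟨ cong₂ (λ x y → binom (suc x + e) y) (+-suc M b) (+-suc a b) ⟨
  binom (suc M + suc b + e) (a + suc b) ∎
  where
  open ≡-Reasoning
  g : ℕ → ℕ
  g c = binom (c + e) a

simplex-length : ∀ b M → length (simplex b M) ≡ binom (M + b) b
simplex-length b M = trans (sym (ones (simplex b M)))
  (trans (simplex-binom b M {0} {0} z≤n) (cong (λ x → binom x b) (+-identityʳ (M + b))))
  where
  ones : ∀ (xs : List ℕ) → sumList xs (λ _ → 1) ≡ length xs
  ones []       = refl
  ones (x ∷ xs) = cong suc (ones xs)

-- The left-hand side is the falling factorial c(c - 1)...(c - a + 1). With the rising factorial
-- below it encloses the power, whose sum over the sample has no simple form, between two quantities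
-- that `simplex-binom` sums exactly.
falling-power : ∀ c a → a ! * binom c a ≤ c ^ a
falling-power c zero    = ≤-refl
falling-power c (suc a) = begin
  suc a * a ! * binom c (suc a)      ≡⟨ xy∙z≈y∙xz (suc a) (a !) (binom c (suc a)) ⟩
  a ! * (suc a * binom c (suc a))    ≤⟨ *-monoʳ-≤ (a !) (≤-trans (m≤m+n _ _) (≤-reflexive (binom-step c a))) ⟩
  a ! * (c * binom c a)              ≡⟨ *-assoc (a !) c (binom c a) ⟨
  a ! * c * binom c a                ≡⟨ cong (_* binom c a) (*-comm (a !) c) ⟩
  c * a ! * binom c a                ≡⟨ *-assoc c (a !) _ ⟩
  c * (a ! * binom c a)              ≤⟨ *-monoʳ-≤ c (falling-power c a) ⟩
  c * c ^ a                          ∎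
  where
  open ≤-Reasoning

-- The right-hand side is the rising factorial c(c + 1)...(c + a). The exponent starts at 1 in order
-- that c + a - 1 does not appear.
rising-power : ∀ c a → c ^ suc a ≤ suc a ! * binom (c + a) (suc a)
rising-power c zero = ≤-reflexive (begin-equality
  c * 1                           ≡⟨ binom-one c ⟨
  1 * binom c 1                   ≡⟨ cong (λ x → 1 * binom x 1) (+-identityʳ c) ⟨
  1 * binom (c + 0) 1             ∎)
  where
  open ≤-Reasoning
  binom-one : ∀ c → 1 * binom c 1 ≡ c * 1
  binom-one zero    = refl
  binom-one (suc c) = binom-absorb c 0
rising-power c (suc a) = begin
  c * c ^ suc a                                          ≤⟨ *-monoʳ-≤ c (rising-power c a) ⟩
  c * (suc a ! * binom (c + a) (suc a))                  ≤⟨ *-monoˡ-≤ _ (m≤m+n c (suc a)) ⟩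
  (c + suc a) * (suc a ! * binom (c + a) (suc a))        ≡⟨ cong (_* (suc a ! * binom (c + a) (suc a))) (+-suc c a) ⟩
  suc (c + a) * (suc a ! * binom (c + a) (suc a))        ≡⟨ x∙yz≈y∙xz (suc (c + a)) (suc a !) _ ⟩
  suc a ! * (suc (c + a) * binom (c + a) (suc a))        ≡⟨ cong (suc a ! *_) (binom-absorb (c + a) (suc a)) ⟨
  suc a ! * ((2 + a) * binom (suc (c + a)) (2 + a))      ≡⟨ x∙yz≈yx∙z (suc a !) (2 + a) _ ⟩
  (2 + a) * suc a ! * binom (suc (c + a)) (2 + a)        ≡⟨ cong (λ x → (2 + a) * suc a ! * binom x (2 + a)) (+-suc c a) ⟨
  (2 + a) * suc a ! * binom (c + suc a) (2 + a)          ∎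
  where
  open ≤-Reasoning

-- A coordinate of a random lattice point of a large simplex of high dimension, rescaled, is nearly
-- exponentially distributed, hence the factor a! in its a-th moment. The lattice sum `r + M` leaves
-- at least `M` after up to r units have been taken off in a falling factorial.
module Moments (r b M : ℕ) where

  sample : List ℕ
  sample = simplex b (r + M)

  size : ℕ
  size = length sample

  moment : ℕ → ℕ
  moment a = sumList sample (_^ a)

  private
    n : ℕ
    n = r + M + b

  -- The quotient C(n, a + b)/C(n, b) is the product of (n - b - i)/(b + 1 + i) over i < a, and
  -- every factor is at least M/(b + r).
  lower-ratio : ∀ a → a ≤ r → binom n b * M ^ a ≤ binom n (a + b) * (b + r) ^ a
  lower-ratio zero    a≤r = ≤-refl
  lower-ratio (suc a) a<r = begin
    binom n b * (M * M ^ a)                        ≡⟨ rearrange₁ (binom n b) M (M ^ a) ⟩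
    M * (binom n b * M ^ a)                        ≤⟨ *-monoʳ-≤ M (lower-ratio a (<⇒≤ a<r)) ⟩
    M * (binom n (a + b) * (b + r) ^ a)            ≡⟨ rearrange₂ M (binom n (a + b)) ((b + r) ^ a) ⟩
    M * binom n (a + b) * (b + r) ^ a              ≤⟨ *-monoˡ-≤ ((b + r) ^ a) step ⟩
    suc (a + b) * binom n (suc a + b) * (b + r) ^ a
      ≤⟨ *-monoˡ-≤ ((b + r) ^ a) (*-monoˡ-≤ (binom n (suc a + b))
           (≤-trans (≤-reflexive (cong suc (+-comm a b))) (subst (_≤ b + r) (+-suc b a) (+-monoʳ-≤ b a<r)))) ⟩
    (b + r) * binom n (suc a + b) * (b + r) ^ a    ≡⟨ xy∙z≈y∙xz (b + r) (binom n (suc a + b)) ((b + r) ^ a) ⟩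
    binom n (suc a + b) * ((b + r) * (b + r) ^ a)  ∎
    where
    open ≤-Reasoning
    step : M * binom n (a + b) ≤ suc (a + b) * binom n (suc a + b)
    step = +-cancelʳ-≤ ((a + b) * binom n (a + b)) _ _ (begin
      M * binom n (a + b) + (a + b) * binom n (a + b)   ≡⟨ *-distribʳ-+ (binom n (a + b)) M (a + b) ⟨
      (M + (a + b)) * binom n (a + b)                   ≤⟨ *-monoˡ-≤ (binom n (a + b)) M+a+b≤n ⟩
      n * binom n (a + b)                               ≡⟨ binom-step n (a + b) ⟨
      suc (a + b) * binom n (suc (a + b)) + (a + b) * binom n (a + b) ∎)
      where
      M+a+b≤n : M + (a + b) ≤ n
      M+a+b≤n = begin
        M + (a + b)   ≡⟨ trans (sym (+-assoc M a b)) (cong (_+ b) (+-comm M a)) ⟩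
        a + M + b     ≤⟨ +-monoˡ-≤ b (+-monoˡ-≤ M (<⇒≤ a<r)) ⟩
        n             ∎
    rearrange₁ : ∀ a b c → a * (b * c) ≡ b * (a * c)
    rearrange₁ = solve-∀
    rearrange₂ : ∀ a b c → a * (b * c) ≡ a * b * c
    rearrange₂ = solve-∀

  -- The quotient of the binomial coefficients has the numerator factors n - b and n + 1, ..., n +
  -- a, all at most n + r, and the denominator factors b + 1, ..., b + a + 1, all at least b + 1.
  upper-ratio : ∀ a → suc a ≤ r →
    binom (n + a) (suc a + b) * suc b ^ suc a ≤ binom n b * (n + r) ^ suc a
  upper-ratio zero a<r = begin
    binom (n + 0) (suc b) * (suc b * 1)   ≡⟨ cong₂ (λ x y → binom x (suc b) * y) (+-identityʳ n) (*-identityʳ (suc b)) ⟩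
    binom n (suc b) * suc b               ≡⟨ *-comm _ (suc b) ⟩
    suc b * binom n (suc b)               ≤⟨ ≤-trans (m≤m+n _ _) (≤-reflexive (binom-step n b)) ⟩
    n * binom n b                         ≤⟨ *-monoˡ-≤ (binom n b) (m≤m+n n r) ⟩
    (n + r) * binom n b                   ≡⟨ rearrange (n + r) (binom n b) ⟩
    binom n b * ((n + r) * 1)             ∎
    where
    open ≤-Reasoning
    rearrange : ∀ a b → a * b ≡ b * (a * 1)
    rearrange = solve-∀
  upper-ratio (suc a) a<r = begin
    binom (n + suc a) (2 + a + b) * (suc b * P)
      ≡⟨ cong (λ x → binom x (2 + a + b) * (suc b * P)) (+-suc n a) ⟩
    binom (suc (n + a)) (2 + a + b) * (suc b * P)
      ≤⟨ *-monoʳ-≤ (binom (suc (n + a)) (2 + a + b)) (*-monoˡ-≤ P (s≤s (m≤n+m b (suc a)))) ⟩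
    binom (suc (n + a)) (2 + a + b) * ((2 + a + b) * P)
      ≡⟨ rearrange₁ (binom (suc (n + a)) (2 + a + b)) (2 + a + b) P ⟩
    (2 + a + b) * binom (suc (n + a)) (2 + a + b) * P
      ≡⟨ cong (_* P) (binom-absorb (n + a) (suc a + b)) ⟩
    suc (n + a) * binom (n + a) (suc a + b) * P
      ≡⟨ *-assoc (suc (n + a)) (binom (n + a) (suc a + b)) P ⟩
    suc (n + a) * (binom (n + a) (suc a + b) * P)
      ≤⟨ *-mono-≤ (subst (_≤ n + r) (+-suc n a) (+-monoʳ-≤ n (<⇒≤ a<r))) (upper-ratio a (<⇒≤ a<r)) ⟩
    (n + r) * (binom n b * (n + r) ^ suc a)
      ≡⟨ rearrange₂ (n + r) (binom n b) ((n + r) ^ suc a) ⟩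
    binom n b * ((n + r) * (n + r) ^ suc a) ∎
    where
    open ≤-Reasoning
    P : ℕ
    P = suc b ^ suc a
    rearrange₁ : ∀ a b c → a * (b * c) ≡ b * a * c
    rearrange₁ = solve-∀
    rearrange₂ : ∀ a b c → a * (b * c) ≡ b * (a * c)
    rearrange₂ = solve-∀

  moment-zero : moment 0 ≡ size
  moment-zero = ones sample
    where
    ones : ∀ (xs : List ℕ) → sumList xs (_^ 0) ≡ length xs
    ones []       = refl
    ones (x ∷ xs) = cong suc (ones xs)

  moment-lower : ∀ a → a ≤ r → a ! * size * M ^ a ≤ moment a * (b + r) ^ a
  moment-lower a a≤r = begin
    a ! * size * M ^ a                           ≡⟨ cong (λ z → a ! * z * M ^ a) (simplex-length b (r + M)) ⟩
    a ! * binom n b * M ^ a                      ≡⟨ *-assoc (a !) _ _ ⟩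
    a ! * (binom n b * M ^ a)                    ≤⟨ *-monoʳ-≤ (a !) (lower-ratio a a≤r) ⟩
    a ! * (binom n (a + b) * (b + r) ^ a)        ≡⟨ *-assoc (a !) _ _ ⟨
    a ! * binom n (a + b) * (b + r) ^ a          ≡⟨ cong (λ z → a ! * binom z (a + b) * (b + r) ^ a) (+-identityʳ n) ⟨
    a ! * binom (n + 0) (a + b) * (b + r) ^ a    ≡⟨ cong (λ z → a ! * z * (b + r) ^ a) (simplex-binom b (r + M) {0} {a} z≤n) ⟨
    a ! * sumList sample (λ c → binom (c + 0) a) * (b + r) ^ a
      ≡⟨ cong (_* (b + r) ^ a) (sumList-*ˡ sample (a !) (λ c → binom (c + 0) a)) ⟨
    sumList sample (λ c → a ! * binom (c + 0) a) * (b + r) ^ a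
      ≤⟨ *-monoˡ-≤ ((b + r) ^ a) (sumList-mono sample (λ c →
           ≤-trans (≤-reflexive (cong (λ z → a ! * binom z a) (+-identityʳ c))) (falling-power c a))) ⟩
    moment a * (b + r) ^ a                       ∎
    where open ≤-Reasoning

  moment-upper : ∀ a → a ≤ r → moment a * suc b ^ a ≤ a ! * size * (n + r) ^ a
  moment-upper zero    a≤r = ≤-reflexive (cong (_* 1) (trans moment-zero (sym (+-identityʳ size))))
  moment-upper (suc a) a<r = begin
    moment (suc a) * suc b ^ suc a
      ≤⟨ *-monoˡ-≤ (suc b ^ suc a) (sumList-mono sample (λ c → rising-power c a)) ⟩
    sumList sample (λ c → suc a ! * binom (c + a) (suc a)) * suc b ^ suc a
      ≡⟨ cong (_* suc b ^ suc a) (sumList-*ˡ sample (suc a !) (λ c → binom (c + a) (suc a))) ⟩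
    suc a ! * sumList sample (λ c → binom (c + a) (suc a)) * suc b ^ suc a
      ≡⟨ cong (λ z → suc a ! * z * suc b ^ suc a) (simplex-binom b (r + M) (n≤1+n a)) ⟩
    suc a ! * binom (n + a) (suc a + b) * suc b ^ suc a
      ≡⟨ *-assoc (suc a !) (binom (n + a) (suc a + b)) (suc b ^ suc a) ⟩
    suc a ! * (binom (n + a) (suc a + b) * suc b ^ suc a)
      ≤⟨ *-monoʳ-≤ (suc a !) (upper-ratio a a<r) ⟩
    suc a ! * (binom n b * (n + r) ^ suc a)
      ≡⟨ *-assoc (suc a !) (binom n b) ((n + r) ^ suc a) ⟨
    suc a ! * binom n b * (n + r) ^ suc a
      ≡⟨ cong (λ z → suc a ! * z * (n + r) ^ suc a) (simplex-length b (r + M)) ⟨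
    suc a ! * size * (n + r) ^ suc a ∎
    where open ≤-Reasoning

-- Sums over the rows of a balanced colouring

valueAt : (ℕ → ℕ) → ℕ → ℕ
valueAt d zero    = 0
valueAt d (suc v) = d v

rowProduct : ∀ {m} → (ℕ → ℕ) → Colouring → ℕ → ℕ → Vec ℕ m → ℕ
rowProduct d f i j []       = 1
rowProduct d f i j (a ∷ as) = valueAt d (f i j) ^ a * rowProduct d f i (suc j) as

momentProduct : ∀ {m} → ℕ → (ℕ → ℕ) → Vec ℕ m → ℕ
momentProduct q d []       = 1
momentProduct q d (a ∷ as) = sumTo q (λ u → d u ^ a) * momentProduct q d as

picks : {A : Set} → List A → List (A × List A)
picks []       = []
picks (x ∷ xs) = (x , xs) ∷ map (λ (y , ys) → y , x ∷ ys) (picks xs)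

-- The number of bijections from the chosen columns to the colours U
-- that agree with row i
bijections : ∀ {m} → Colouring → ℕ → ℕ → List ℕ → Vec Bool m → ℕ
bijections f i j U []          = ifzero (length U) 1 0
bijections f i j U (false ∷ I) = bijections f i (suc j) U I
bijections f i j U (true ∷ I)  =
  sumList (picks U) (λ (v , V) → isColour v (f i j) * bijections f i (suc j) V I)

size : ∀ {m} → Vec Bool m → ℕ
size []          = 0
size (true ∷ I)  = suc (size I)
size (false ∷ I) = size I

sumList-map : ∀ {A B : Set} (h : A → B) xs g → sumList (map h xs) g ≡ sumList xs (λ x → g (h x))
sumList-map h []       g = refl
sumList-map h (x ∷ xs) g = cong (g (h x) +_) (sumList-map h xs g)

sumTo-sumList : ∀ {A : Set} k (xs : List A) (g : ℕ → A → ℕ) →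
                sumTo k (λ i → sumList xs (g i)) ≡ sumList xs (λ x → sumTo k (λ i → g i x))
sumTo-sumList k []       g = sumTo-zero k (λ _ _ → refl)
sumTo-sumList k (x ∷ xs) g = trans (sumTo-+ k (λ i → g i x) (λ i → sumList xs (g i)))
  (cong (sumTo k (λ i → g i x) +_) (sumTo-sumList k xs g))

-- Instantiated with ≤ for the upper bounds and with ≥ for the lower bounds.
module Squeeze (_≼_ : ℕ → ℕ → Set) (≼-refl : ∀ {a} → a ≼ a)
               (≼-+ : ∀ {a b c d} → a ≼ b → c ≼ d → (a + c) ≼ (b + d))
               (≼-* : ∀ c {a b} → a ≼ b → (c * a) ≼ (c * b))
               {q n k : ℕ} {f : Colouring} (col : Coloured q n k f) (r c₀ : ℕ)
               (bound : ∀ {pat} → Falling n q pat → length pat ≤ r →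
                        (count k f pat * q ^ length pat) ≼ c₀) where

  sumTo-≼ : ∀ m {g h} → (∀ x → x < m → g x ≼ h x) → sumTo m g ≼ sumTo m h
  sumTo-≼ zero    le = ≼-refl
  sumTo-≼ (suc m) le = ≼-+ (sumTo-≼ m (λ x x<m → le x (m≤n⇒m≤1+n x<m))) (le m ≤-refl)

  module _ (d : ℕ → ℕ) where

    rowSum : ∀ {m} → Pattern → ℕ → Vec ℕ m → ℕ
    rowSum pat j as = sumTo k (λ i → matches f i pat * rowProduct d f i j as)

    value-split : ∀ a i {j} → i < k → j < n →
      valueAt d (f i j) ^ a ≡ sumTo q (λ u → d u ^ a * isColour u (f i j))
    value-split a i {j} i<k j<n with f i j | Coloured.colour col i j i<k j<n
    ... | .(suc v) | v , v<q , refl = sym (trans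
      (sumTo-spike (λ u → d u ^ a * isColour u (suc v)) v<q (λ u _ u≢v →
        trans (cong (d u ^ a *_) (isColour-miss (λ e → u≢v (sym (suc-injective e))))) (*-zeroʳ (d u ^ a))))
      (trans (cong (d v ^ a *_) (isColour-hit v)) (*-identityʳ _)))

    rowSum-split : ∀ {m} pat {j} a (as : Vec ℕ m) → j < n →
      rowSum pat j (a ∷ as) ≡ sumTo q (λ u → d u ^ a * rowSum ((j , u) ∷ pat) (suc j) as)
    rowSum-split pat {j} a as j<n = begin
      sumTo k (λ i → matches f i pat * (valueAt d (f i j) ^ a * R i))
        ≡⟨ sumTo-cong k (λ i i<k → cong (λ z → matches f i pat * (z * R i)) (value-split a i i<k j<n)) ⟩
      sumTo k (λ i → matches f i pat * (sumTo q (λ u → d u ^ a * isColour u (f i j)) * R i))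
        ≡⟨ sumTo-cong k (λ i _ → trans (rearrange (matches f i pat) (sumTo q (c i)) (R i))
             (trans (sym (sumTo-*ʳ q (matches f i pat * R i) (c i)))
               (sumTo-cong q (λ u _ → rearrange′ (d u ^ a) (isColour u (f i j)) (matches f i pat) (R i))))) ⟩
      sumTo k (λ i → sumTo q (λ u → d u ^ a * (isColour u (f i j) * matches f i pat * R i)))
        ≡⟨ sumTo-swap k q _ ⟩
      sumTo q (λ u → sumTo k (λ i → d u ^ a * (isColour u (f i j) * matches f i pat * R i)))
        ≡⟨ sumTo-cong q (λ u _ → sumTo-*ˡ k (d u ^ a) _) ⟩
      sumTo q (λ u → d u ^ a * rowSum ((j , u) ∷ pat) (suc j) as) ∎
      where
      open ≡-Reasoning
      R : ℕ → ℕ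
      R i = rowProduct d f i (suc j) as
      c : ℕ → ℕ → ℕ
      c i u = d u ^ a * isColour u (f i j)
      rearrange : ∀ a b c → a * (b * c) ≡ b * (a * c)
      rearrange = solve-∀
      rearrange′ : ∀ a b c d → a * b * (c * d) ≡ a * (b * c * d)
      rearrange′ = solve-∀

    -- The columns are resolved from left to right. One with a positive exponent is split by its
    -- colour and joins the pattern; one with exponent 0 stays out and contributes d^0 summed over
    -- the colours, that is q. So at most r columns join, and the bound on counts applies at the
    -- end.
    rowSum-≼ : ∀ {m} pat {j} (as : Vec ℕ m) → Falling n q pat → lowest pat ≤ j → j + m ≤ n →
      length pat + sum as ≤ r →
      (rowSum pat j as * (q ^ length pat * q ^ m)) ≼ (c₀ * momentProduct q d as)
    rowSum-≼ pat {j} [] fall low fits len = subst₂ _≼_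
      (cong₂ _*_ (sumTo-cong k (λ i _ → sym (*-identityʳ (matches f i pat)))) (sym (*-identityʳ (q ^ length pat))))
      (sym (*-identityʳ c₀))
      (bound fall (≤-trans (m≤m+n _ _) len))
    rowSum-≼ {suc m} pat {j} (zero ∷ as) fall low fits len = subst₂ _≼_
      (begin
        q * (rowSum pat (suc j) as * (q ^ length pat * q ^ m))
          ≡⟨ rearrange q (rowSum pat (suc j) as) (q ^ length pat) (q ^ m) ⟩
        rowSum pat (suc j) as * (q ^ length pat * q ^ suc m)
          ≡⟨ cong (_* (q ^ length pat * q ^ suc m)) (sumTo-cong k (λ i _ →
               cong (matches f i pat *_) (sym (*-identityˡ (rowProduct d f i (suc j) as))))) ⟩
        rowSum pat j (zero ∷ as) * (q ^ length pat * q ^ suc m) ∎)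
      (begin
        q * (c₀ * momentProduct q d as)
          ≡⟨ rearrange′ q c₀ (momentProduct q d as) ⟩
        c₀ * (q * 1 * momentProduct q d as)
          ≡⟨ cong (λ z → c₀ * (z * momentProduct q d as)) (sumTo-const q 1) ⟨
        c₀ * momentProduct q d (zero ∷ as) ∎)
      (≼-* q (rowSum-≼ pat as fall (m≤n⇒m≤1+n low) (subst (_≤ n) (+-suc j m) fits) len))
      where
      open ≡-Reasoning
      rearrange : ∀ q s x y → q * (s * (x * y)) ≡ s * (x * (q * y))
      rearrange = solve-∀
      rearrange′ : ∀ q c p → q * (c * p) ≡ c * (q * 1 * p)
      rearrange′ = solve-∀
    rowSum-≼ {suc m} pat {j} (a@(suc a′) ∷ as) fall low fits len = subst₂ _≼_
      (begin
        sumTo q (λ u → d u ^ a * (S u * (q ^ suc (length pat) * q ^ m)))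
          ≡⟨ sumTo-cong q (λ u _ → rearrange (d u ^ a) (S u) q (q ^ length pat) (q ^ m)) ⟩
        sumTo q (λ u → d u ^ a * S u * (q ^ length pat * q ^ suc m))
          ≡⟨ sumTo-*ʳ q _ _ ⟩
        sumTo q (λ u → d u ^ a * S u) * (q ^ length pat * q ^ suc m)
          ≡⟨ cong (_* (q ^ length pat * q ^ suc m)) (rowSum-split pat a as j<n) ⟨
        rowSum pat j (a ∷ as) * (q ^ length pat * q ^ suc m) ∎)
      (begin
        sumTo q (λ u → d u ^ a * (c₀ * momentProduct q d as))
          ≡⟨ sumTo-*ʳ q (c₀ * momentProduct q d as) (λ u → d u ^ a) ⟩
        sumTo q (λ u → d u ^ a) * (c₀ * momentProduct q d as)
          ≡⟨ rearrange′ (sumTo q (λ u → d u ^ a)) c₀ _ ⟩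
        c₀ * momentProduct q d (a ∷ as) ∎)
      (sumTo-≼ q (λ u u<q → ≼-* (d u ^ a)
        (rowSum-≼ ((j , u) ∷ pat) as ((low , j<n , u<q) ∷ fall) ≤-refl (subst (_≤ n) (+-suc j m) fits)
          (≤-trans (s≤s (+-monoʳ-≤ (length pat) (m≤n+m (sum as) a′)))
            (subst (_≤ r) (+-suc (length pat) (a′ + sum as)) len)))))
      where
      open ≡-Reasoning
      j<n : j < n
      j<n = ≤-trans (s≤s (m≤m+n j m)) (subst (_≤ n) (+-suc j m) fits)
      S : ℕ → ℕ
      S u = rowSum ((j , u) ∷ pat) (suc j) as
      rearrange : ∀ d s q x y → d * (s * (q * x * y)) ≡ d * s * (x * (q * y))
      rearrange = solve-∀
      rearrange′ : ∀ a b c → a * (b * c) ≡ b * (a * c)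
      rearrange′ = solve-∀

  bijectionSum : ∀ {m} → Pattern → ℕ → List ℕ → Vec Bool m → ℕ
  bijectionSum pat j U I = sumTo k (λ i → matches f i pat * bijections f i j U I)

  bijectionSum-split : ∀ {m} pat j U (I : Vec Bool m) → bijectionSum pat j U (true ∷ I) ≡
    sumList (picks U) (λ (v , V) → bijectionSum ((j , v) ∷ pat) (suc j) V I)
  bijectionSum-split pat j U I = trans
    (sumTo-cong k (λ i _ → sym (trans (sumList-cong (picks U) (λ (v , V) →
        rearrange (isColour v (f i j)) (matches f i pat) (bijections f i (suc j) V I)))
      (sumList-*ˡ (picks U) (matches f i pat) _))))
    (sumTo-sumList k (picks U) (λ i (v , V) → isColour v (f i j) * matches f i pat * bijections f i (suc j) V I))
    where
    sumList-cong : ∀ {A : Set} (xs : List A) {g h : A → ℕ} → (∀ x → g x ≡ h x) → sumList xs g ≡ sumList xs h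
    sumList-cong []       eq = refl
    sumList-cong (x ∷ xs) eq = cong₂ _+_ (eq x) (sumList-cong xs eq)
    rearrange : ∀ a b c → a * b * c ≡ b * (a * c)
    rearrange = solve-∀

  Pick : List ℕ → ℕ × List ℕ → Set
  Pick U (v , V) = v < q × All (_< q) V × suc (length V) ≡ length U

  picks-all : ∀ {U} → All (_< q) U → All (Pick U) (picks U)
  picks-all []               = []
  picks-all {u ∷ U} (u<q ∷ U<q) = (u<q , U<q , refl) ∷ extend (picks-all U<q)
    where
    extend : ∀ {ps} → All (Pick U) ps → All (Pick (u ∷ U)) (map (λ (y , ys) → y , u ∷ ys) ps)
    extend []                        = []
    extend ((v<q , V<q , len) ∷ oks) = (v<q , u<q ∷ V<q , cong suc len) ∷ extend oks

  picks-length : ∀ (U : List ℕ) → sumList (picks U) (λ _ → 1) ≡ length U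
  picks-length []      = refl
  picks-length (u ∷ U) = cong suc (trans (sumList-map _ (picks U) _) (picks-length U))

  sumList-≼ : ∀ {A : Set} {P : A → Set} {xs g h} → (∀ {x} → P x → g x ≼ h x) → All P xs →
              sumList xs g ≼ sumList xs h
  sumList-≼ le []       = ≼-refl
  sumList-≼ le (p ∷ ps) = ≼-+ (le p) (sumList-≼ le ps)

  -- Each of the |U|! bijections prescribes the colours of |U| columns and so extends the pattern to
  -- length at most r; the chosen columns are resolved one at a time.
  bijectionSum-≼ : ∀ {m} pat {j} U (I : Vec Bool m) → Falling n q pat → lowest pat ≤ j → j + m ≤ n →
    All (_< q) U → length U ≡ size I → length pat + length U ≤ r →
    (bijectionSum pat j U I * q ^ (length pat + length U)) ≼ (c₀ * (length U) !)
  bijectionSum-≼ pat [] [] fall low fits U<q eq len = subst₂ _≼_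
    (cong₂ _*_ (sumTo-cong k (λ i _ → sym (*-identityʳ (matches f i pat))))
               (cong (q ^_) (sym (+-identityʳ (length pat)))))
    (sym (*-identityʳ c₀))
    (bound fall (≤-trans (m≤m+n _ _) len))
  bijectionSum-≼ {suc m} pat {j} U (false ∷ I) fall low fits U<q eq len =
    bijectionSum-≼ pat U I fall (m≤n⇒m≤1+n low) (subst (_≤ n) (+-suc j m) fits) U<q eq len
  bijectionSum-≼ {suc m} pat {j} U@(u ∷ U′) (true ∷ I) fall low fits U<q eq len = subst₂ _≼_
    (begin
      sumList (picks U) (λ (v , V) → Y * S v V)   ≡⟨ sumList-*ˡ (picks U) Y _ ⟩
      Y * sumList (picks U) (λ (v , V) → S v V)   ≡⟨ *-comm Y _ ⟩
      sumList (picks U) (λ (v , V) → S v V) * Y   ≡⟨ cong (_* Y) (bijectionSum-split pat j U I) ⟨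
      bijectionSum pat j U (true ∷ I) * Y         ∎)
    (begin
      sumList (picks U) (λ _ → c₀ * length U′ ! * 1)     ≡⟨ sumList-*ˡ (picks U) (c₀ * length U′ !) _ ⟩
      c₀ * length U′ ! * sumList (picks U) (λ _ → 1)     ≡⟨ cong (c₀ * length U′ ! *_) (picks-length U) ⟩
      c₀ * length U′ ! * length U                        ≡⟨ *-assoc c₀ _ _ ⟩
      c₀ * (length U′ ! * length U)                      ≡⟨ cong (c₀ *_) (*-comm (length U′ !) _) ⟩
      c₀ * length U !                                    ∎)
    (sumList-≼ one (picks-all U<q))
    where
    open ≡-Reasoning
    Y : ℕ
    Y = q ^ (length pat + length U)
    S : ℕ → List ℕ → ℕ
    S v V = bijectionSum ((j , v) ∷ pat) (suc j) V I
    j<n : j < n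
    j<n = ≤-trans (s≤s (m≤m+n j m)) (subst (_≤ n) (+-suc j m) fits)
    one : ∀ {p} → Pick U p → (Y * S (proj₁ p) (proj₂ p)) ≼ (c₀ * length U′ ! * 1)
    one {v , V} (v<q , V<q , lenV) = subst₂ _≼_
      (trans (*-comm (S v V) _) (cong (λ z → q ^ z * S v V) lens))
      (trans (cong (λ z → c₀ * z !) (suc-injective lenV)) (sym (*-identityʳ _)))
      (bijectionSum-≼ ((j , v) ∷ pat) V I ((low , j<n , v<q) ∷ fall) ≤-refl
        (subst (_≤ n) (+-suc j m) fits) V<q
        (suc-injective (trans lenV eq)) (subst (_≤ r) (sym lens) len))
      where
      lens : suc (length pat + length V) ≡ length pat + length U
      lens = trans (sym (+-suc (length pat) (length V))) (cong (length pat +_) lenV)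
  bijectionSum-≼ pat [] (true ∷ I) fall low fits U<q () len

-- The colouring algorithm

nCell sCell wCell kCell cellsCell : ℕ
nCell     = 0
sCell     = 1
wCell     = 2
kCell     = 3
cellsCell = 4

-- Array 1 of the memory stays blank: it is array 2 of the machine and supplies the zeros that are
-- subtracted in the output convention. Array 3 is `bounds`.
numerators denominators colours scratch : ℕ
numerators   = 0
denominators = 2
colours      = 4
scratch      = 5

recur-cong : ∀ {A : Set} {f g : ℕ → A → A} {y z} → (∀ x a → f x a ≡ g x a) → y ≡ z →
             ∀ n → recur f y n ≡ recur g z n
recur-cong eq y≡z zero    = y≡z
recur-cong {f = f} eq y≡z (suc n) = trans (cong (f n) (recur-cong eq y≡z n)) (eq n _)

-- Multiplication by a constant is unrolled into additions when the program is built.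
scale : ∀ {v} → ℕ → Term v → Term v
scale zero    t = lit 0
scale (suc c) t = t ⊞ scale c t

⟦scale⟧ : ∀ {v} c (t : Term v) D ρ → ⟦ scale c t ⟧ D ρ ≡ c * ⟦ t ⟧ D ρ
⟦scale⟧ zero    t D ρ = refl
⟦scale⟧ (suc c) t D ρ = cong (⟦ t ⟧ D ρ +_) (⟦scale⟧ c t D ρ)

sumTerms : ∀ {v} → ℕ → (ℕ → Term v) → Term v
sumTerms zero    t = lit 0
sumTerms (suc q) t = sumTerms q t ⊞ t q

⟦sumTerms⟧ : ∀ {v} q (t : ℕ → Term v) D ρ {f} → (∀ u → ⟦ t u ⟧ D ρ ≡ f u) → ⟦ sumTerms q t ⟧ D ρ ≡ sumTo q f
⟦sumTerms⟧ zero    t D ρ eq = refl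
⟦sumTerms⟧ (suc q) t D ρ eq = cong₂ _+_ (⟦sumTerms⟧ q t D ρ eq) (eq q)

timesN : ∀ {v} → Fin v → Term v
timesN i = iter nCell (lit 0) (var (suc zero) ⊞ var (suc (suc i)))

⟦timesN⟧ : ∀ {v} (i : Fin v) D ρ → ⟦ timesN i ⟧ D ρ ≡ D bounds nCell * lookup ρ i
⟦timesN⟧ i D ρ = sumTo-const (D bounds nCell) (lookup ρ i)

cellAt : ∀ {v} → Fin v → Fin v → Term v
cellAt i j = arr colours (timesN i ⊞ var j)

colouring : Memory → Colouring
colouring D i j = D colours (D bounds nCell * i + j)

⟦cellAt⟧ : ∀ {v} (i j : Fin v) D ρ → ⟦ cellAt i j ⟧ D ρ ≡ colouring D (lookup ρ i) (lookup ρ j)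
⟦cellAt⟧ i j D ρ = cong (λ z → D colours (z + lookup ρ j)) (⟦timesN⟧ i D ρ)

distanceTerm : ∀ {v} → Term v → Term v → Term v
distanceTerm s t = (s ⊟ t) ⊞ (t ⊟ s)

-- Columns are loop variables, since their number depends on the input; colours are constants, since
-- the sum over the q colours is unrolled.
VarPattern : ℕ → Set
VarPattern v = List (Fin v × ℕ)

shift : ∀ {v} → VarPattern v → VarPattern (suc (suc v))
shift = map (λ (j , u) → suc (suc j) , u)

pattern-of : ∀ {v} → Vec ℕ v → VarPattern v → Pattern
pattern-of ρ = map (λ (j , u) → lookup ρ j , u)

pattern-shift : ∀ {v} x y (ρ : Vec ℕ v) pat → pattern-of (x ∷ y ∷ ρ) (shift pat) ≡ pattern-of ρ pat
pattern-shift x y ρ []        = refl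
pattern-shift x y ρ (_ ∷ pat) = cong (_ ∷_) (pattern-shift x y ρ pat)

-- The other factor `t` is an argument because two computed values cannot be multiplied directly. In
-- the cases that occur `t` is only kept, scaled by q or replaced by 0.
chanceTerm : ∀ {v} → ℕ → ℕ → Term v → Term v → Term v
chanceTerm q u c t = ifz c t (ifz (distanceTerm c (lit (suc u))) (scale q t) (lit 0))

⟦chanceTerm⟧ : ∀ {v} q u (c t : Term v) D ρ →
  ⟦ chanceTerm q u c t ⟧ D ρ ≡ chance q u (⟦ c ⟧ D ρ) * ⟦ t ⟧ D ρ
⟦chanceTerm⟧ q u c t D ρ with ⟦ c ⟧ D ρ
... | zero  = sym (+-identityʳ _)
... | suc x with distance (suc x) (suc u)
...   | zero  = trans (⟦scale⟧ q t D ρ) (cong (_* ⟦ t ⟧ D ρ) (sym (+-identityʳ q)))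
...   | suc _ = refl

chancesTerm : ∀ {v} → ℕ → Fin v → VarPattern v → Term v → Term v
chancesTerm q i []              t = t
chancesTerm q i ((j , u) ∷ pat) t = chanceTerm q u (cellAt i j) (chancesTerm q i pat t)

⟦chancesTerm⟧ : ∀ {v} q i pat (t : Term v) D ρ →
  ⟦ chancesTerm q i pat t ⟧ D ρ ≡ chances q (colouring D) (lookup ρ i) (pattern-of ρ pat) * ⟦ t ⟧ D ρ
⟦chancesTerm⟧ q i []              t D ρ = sym (+-identityʳ _)
⟦chancesTerm⟧ q i ((j , u) ∷ pat) t D ρ = begin
  ⟦ chanceTerm q u (cellAt i j) (chancesTerm q i pat t) ⟧ D ρ
    ≡⟨ ⟦chanceTerm⟧ q u (cellAt i j) _ D ρ ⟩
  chance q u (⟦ cellAt i j ⟧ D ρ) * ⟦ chancesTerm q i pat t ⟧ D ρ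
    ≡⟨ cong₂ (λ c z → chance q u c * z) (⟦cellAt⟧ i j D ρ) (⟦chancesTerm⟧ q i pat t D ρ) ⟩
  chance q u (colouring D (lookup ρ i) (lookup ρ j)) * (chances q (colouring D) (lookup ρ i) (pattern-of ρ pat) * ⟦ t ⟧ D ρ)
    ≡⟨ *-assoc (chance q u (colouring D (lookup ρ i) (lookup ρ j))) _ _ ⟨
  chances q (colouring D) (lookup ρ i) (pattern-of ρ ((j , u) ∷ pat)) * ⟦ t ⟧ D ρ ∎
  where open ≡-Reasoning

weightTerm : ∀ {v} → ℕ → ℕ → VarPattern v → Term v
weightTerm q A pat = iter kCell (lit 1)
  (scale A (var (suc zero)) ⊞ chancesTerm q zero (shift pat) (var (suc zero)))

⟦weightTerm⟧ : ∀ {v} q A (pat : VarPattern v) D ρ →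
  ⟦ weightTerm q A pat ⟧ D ρ ≡ weight q (D bounds kCell) A (colouring D) (pattern-of ρ pat)
⟦weightTerm⟧ q A pat D ρ = recur-cong (λ i z → cong₂ _+_
  (⟦scale⟧ A (var (suc zero)) D (i ∷ z ∷ ρ))
  (trans (⟦chancesTerm⟧ q zero (shift pat) (var (suc zero)) D (i ∷ z ∷ ρ))
    (cong (λ p → chances q (colouring D) i p * z) (pattern-shift i z ρ pat)))) refl (D bounds kCell)

lowestTerm : ∀ {v} → VarPattern v → Term v
lowestTerm []            = lit 0
lowestTerm ((j , _) ∷ _) = lit 1 ⊞ var j

⟦lowestTerm⟧ : ∀ {v} (pat : VarPattern v) D ρ → ⟦ lowestTerm pat ⟧ D ρ ≡ lowest (pattern-of ρ pat)
⟦lowestTerm⟧ []        D ρ = refl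
⟦lowestTerm⟧ (_ ∷ pat) D ρ = refl

potentialTerm : ∀ {v} → ℕ → ℕ → ℕ → VarPattern v → Term v
potentialTerm q A zero    pat = weightTerm q A pat
potentialTerm q A (suc t) pat = weightTerm q A pat ⊞ iter nCell (lit 0)
  (var (suc zero) ⊞ ifz (lowestTerm (shift pat) ⊟ var zero)
    (sumTerms q (λ u → potentialTerm q A t ((zero , u) ∷ shift pat))) (lit 0))

⟦potentialTerm⟧ : ∀ {v} q A t (pat : VarPattern v) D ρ → ⟦ potentialTerm q A t pat ⟧ D ρ ≡
  potential q (D bounds nCell) (D bounds kCell) A (colouring D) t (pattern-of ρ pat)
⟦potentialTerm⟧ q A zero    pat D ρ = ⟦weightTerm⟧ q A pat D ρ
⟦potentialTerm⟧ q A (suc t) pat D ρ = cong₂ _+_ (⟦weightTerm⟧ q A pat D ρ)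
  (recur-cong (λ j z → cong (z +_) (cong₂ (λ c a → ifzero (c ∸ j) a 0)
    (trans (⟦lowestTerm⟧ (shift pat) D (j ∷ z ∷ ρ)) (cong lowest (pattern-shift j z ρ pat)))
    (⟦sumTerms⟧ q _ D (j ∷ z ∷ ρ) (λ u → trans (⟦potentialTerm⟧ q A t _ D (j ∷ z ∷ ρ))
      (cong (λ p → potential q (D bounds nCell) (D bounds kCell) A (colouring D) t ((j , u) ∷ p))
            (pattern-shift j z ρ pat)))))) refl (D bounds nCell))

chances-cong : ∀ q {f g} → (∀ i j → f i j ≡ g i j) → ∀ i pat → chances q f i pat ≡ chances q g i pat
chances-cong q eq i []              = refl
chances-cong q eq i ((j , u) ∷ pat) = cong₂ _*_ (cong (chance q u) (eq i j)) (chances-cong q eq i pat)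

potential-cong : ∀ q n k A {f g} → (∀ i j → f i j ≡ g i j) → ∀ t pat →
                 potential q n k A f t pat ≡ potential q n k A g t pat
potential-cong q n k A eq zero    pat =
  recur-cong (λ i z → cong (λ c → A * z + c * z) (chances-cong q eq i pat)) refl k
potential-cong q n k A eq (suc t) pat = cong₂ _+_
  (potential-cong q n k A eq zero pat)
  (recur-cong (λ j z → cong (λ a → z + ifzero (lowest pat ∸ j) a 0)
    (sumTo-cong q (λ u _ → potential-cong q n k A eq t ((j , u) ∷ pat)))) refl n)

divMod-unique : ∀ {n i i′ j j′} → j < n → j′ < n → n * i + j ≡ n * i′ + j′ → i ≡ i′ × j ≡ j′
divMod-unique {n@(suc _)} {i} {i′} {j} {j′} j<n j′<n eq = i≡i′ , j≡j′
  where
  remainder : ∀ i {j} → j < n → (n * i + j) % n ≡ j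
  remainder i {j} j<n = trans
    (cong (_% n) (trans (+-comm (n * i) j) (cong (j +_) (*-comm n i))))
    (trans ([m+kn]%n≡m%n j i n) (m<n⇒m%n≡m j<n))
  j≡j′ : j ≡ j′
  j≡j′ = trans (sym (remainder i j<n)) (trans (cong (_% n) eq) (remainder i′ j′<n))
  i≡i′ : i ≡ i′
  i≡i′ = *-cancelˡ-≡ i i′ n (+-cancelʳ-≡ j _ _ (trans eq (cong (n * i′ +_) (sym j≡j′))))

sumTo-pigeonhole : ∀ {q c} g → .{{NonZero q}} → sumTo q g ≤ q * c → ∃[ v ] (v < q × g v ≤ c)
sumTo-pigeonhole {q@(suc p)} {c} g le = search q (≤-refl) le
  where
  search : ∀ m → .{{NonZero m}} → m ≤ q → sumTo m g ≤ m * c → ∃[ v ] (v < q × g v ≤ c)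
  search (suc m) m<q le with g m ≤? c
  ... | yes gm≤c = m , m<q , gm≤c
  search 1 m<q le | no gm≰c = ⊥-elim (gm≰c (≤-trans le (≤-reflexive (+-identityʳ c))))
  search (suc m@(suc _)) m<q le | no gm≰c = search m (<⇒≤ m<q)
    (+-cancelʳ-≤ c _ _ (≤-trans (+-monoʳ-≤ (sumTo m g) (<⇒≤ (≰⇒> gm≰c)))
      (≤-trans le (≤-reflexive (+-comm c (m * c))))))

ifzeroᴹ-elim : ∀ {c D E} (P : Memory → Set) → (c ≡ 0 → P D) → (c ≢ 0 → P E) → P (ifzeroᴹ c D E)
ifzeroᴹ-elim {zero}  P p₀ p₁ = p₀ refl
ifzeroᴹ-elim {suc c} P p₀ p₁ = p₁ λ ()

write-elsewhere : ∀ D {A B} i v j → B ≢ A → upd D A i v B j ≡ D B j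
write-elsewhere D {A} {B} i v j B≢A rewrite dec-false (A ≟ B) (λ eq → B≢A (sym eq)) = refl

module Painting (q A r : ℕ) .{{q≢0 : NonZero q}} where

  -- Tries the colours from `v` to `v + l` against the old potential, kept in `scratch`. The last
  -- colour is left without a test: if all others fail, averaging forces it to succeed.
  try : ℕ → ℕ → Stmt 1
  try v zero    = set colours (var zero) (lit (suc v))
  try v (suc l) = set colours (var zero) (lit (suc v)) ⨟
    ifz (potentialTerm q A r [] ⊟ arr scratch (lit 0)) done (try (suc v) l)

  choose : Stmt 1
  choose = set scratch (lit 0) (potentialTerm q A r []) ⨟ try 0 (pred q)

  paint : Stmt 0
  paint = for cellsCell choose

  Φ : Memory → ℕ
  Φ D = potential q (D bounds nCell) (D bounds kCell) A (colouring D) r []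

  record Painted (D : Memory) (p v : ℕ) (E : Memory) : Set where
    field
      there     : E colours p ≡ suc v
      elsewhere : ∀ x → p ≢ x → E colours x ≡ D colours x
      frame     : ∀ B x → B ≢ colours → E B x ≡ D B x
  open Painted

  Almost : Memory → ℕ → Memory → Set
  Almost D p E = (∀ x → p ≢ x → E colours x ≡ D colours x) × (∀ B x → B ≢ colours → E B x ≡ D B x)

  upd-painted : ∀ {D p E} v → Almost D p E → Painted D p v (upd E colours p (suc v))
  upd-painted {D} {p} {E} v (other , frame) = record
    { there     = write-hit E colours p (suc v)
    ; elsewhere = λ x p≢x → trans (write-miss E colours (suc v) colours p≢x) (other x p≢x)
    ; frame     = λ B x B≢ → trans (write-elsewhere E p (suc v) x B≢) (frame B x B≢)
    }

  -- Earlier failed attempts only wrote to the same cell, so the memory after several attempts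
  -- agrees pointwise with the one painted directly, and Φ depends on nothing more.
  painted-Φ : ∀ {D p v E E′} → Painted D p v E → Painted D p v E′ → Φ E ≡ Φ E′
  painted-Φ {D} {p} {v} {E} {E′} e e′ = trans
    (cong₂ (λ n k → potential q n k A (colouring E) r []) (frames nCell) (frames kCell))
    (potential-cong q _ _ A same r [])
    where
    frames : ∀ x → E bounds x ≡ E′ bounds x
    frames x = trans (frame e bounds x (λ ())) (sym (frame e′ bounds x (λ ())))
    cells : ∀ x → E colours x ≡ E′ colours x
    cells x with p ≟ x
    ... | yes refl = trans (there e) (sym (there e′))
    ... | no  p≢x  = trans (elsewhere e x p≢x) (sym (elsewhere e′ x p≢x))
    same : ∀ i j → colouring E i j ≡ colouring E′ i j
    same i j = trans (cells _) (cong (λ n → E′ colours (n * i + j)) (frames nCell))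

  Success : Memory → ℕ → Memory → Set
  Success D p E = ∃[ v ] (v < q × Painted D p v E × Φ E ≤ D scratch 0)

  -- A failed test shows that the good colour `u` is not `v`, hence lies in the remaining range.
  -- When the range has shrunk to one colour, it is `u`.
  try-succeeds : ∀ {D p} v l E → Almost D p E → v + l < q →
    (∃[ u ] (v ≤ u × u ≤ v + l × Φ (upd D colours p (suc u)) ≤ D scratch 0)) →
    Success D p (exec (try v l) E (p ∷ []))
  try-succeeds {D} {p} v zero E almost v<q (u , v≤u , u≤v , good) =
    v , subst (_< q) (+-identityʳ v) v<q , painted ,
    ≤-trans (≤-reflexive (painted-Φ painted (upd-painted v ((λ _ _ → refl) , λ _ _ _ → refl))))
      (subst (λ z → Φ (upd D colours p (suc z)) ≤ D scratch 0)
        (≤-antisym (subst (u ≤_) (+-identityʳ v) u≤v) v≤u) good)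
    where
    painted : Painted D p v (upd E colours p (suc v))
    painted = upd-painted v almost
  try-succeeds {D} {p} v (suc l) E almost v<q (u , v≤u , u≤v , good) =
    ifzeroᴹ-elim (Success D p) stop continue
    where
    E′ : Memory
    E′ = upd E colours p (suc v)
    painted : Painted D p v E′
    painted = upd-painted v almost
    value : ⟦ potentialTerm q A r [] ⟧ E′ (p ∷ []) ≡ Φ E′
    value = ⟦potentialTerm⟧ q A r [] E′ (p ∷ [])
    old : E′ scratch 0 ≡ D scratch 0
    old = frame painted scratch 0 (λ ())
    stop : ⟦ potentialTerm q A r [] ⟧ E′ (p ∷ []) ∸ E′ scratch 0 ≡ 0 → Success D p E′
    stop eq = v , ≤-trans (s≤s (m≤m+n v (suc l))) v<q , painted ,
      subst₂ _≤_ value old (m∸n≡0⇒m≤n eq)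
    continue : ⟦ potentialTerm q A r [] ⟧ E′ (p ∷ []) ∸ E′ scratch 0 ≢ 0 →
               Success D p (exec (try (suc v) l) E′ (p ∷ []))
    continue neq = try-succeeds (suc v) l E′ (elsewhere painted , frame painted)
      (subst (_< q) (+-suc v l) v<q)
      (u , ≤∧≢⇒< v≤u v≢u , subst (u ≤_) (+-suc v l) u≤v , good)
      where
      v≢u : v ≢ u
      v≢u refl = neq (m≤n⇒m∸n≡0 (subst₂ _≤_ (sym value) (sym old)
        (≤-trans (≤-reflexive (painted-Φ painted (upd-painted v ((λ _ _ → refl) , λ _ _ _ → refl)))) good)))

  record Progress (D₀ : Memory) (y : ℕ) (D : Memory) : Set where
    field
      given : ∀ x → x < y → ∃[ v ] (v < q × D colours x ≡ suc v)
      blank : ∀ x → y ≤ x → D colours x ≡ 0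
      kept  : ∀ B x → B ≢ colours → B ≢ scratch → D B x ≡ D₀ B x
      small : Φ D ≤ Φ D₀
  open Progress

  module _ {D₀ : Memory} (n≢0 : NonZero (D₀ bounds nCell))
           (cells≡ : D₀ bounds cellsCell ≡ D₀ bounds nCell * D₀ bounds kCell) where

    -- Address `p` is the cell in row p / n and column p % n. The q values of the potential add up
    -- to q times the present one, so one of them is no larger.
    average : ∀ {D p} → Progress D₀ p D → p < D₀ bounds cellsCell →
      ∃[ u ] (u < q × Φ (upd D colours p (suc u)) ≤ Φ D)
    average {D} {p} prog p<cells = sumTo-pigeonhole (λ v → Φ (upd D colours p (suc v)))
      (≤-reflexive (Average.potential-average {q = q} ext {A = A} r i₀<k []))
      where
      n k : ℕ
      n = D bounds nCell
      k = D bounds kCell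
      instance
        n≢0′ : NonZero n
        n≢0′ = subst NonZero (sym (kept prog bounds nCell (λ ()) (λ ()))) n≢0
      i₀ j₀ : ℕ
      i₀ = p / n
      j₀ = p % n
      p≡ : n * i₀ + j₀ ≡ p
      p≡ = trans (+-comm (n * i₀) j₀) (trans (cong (j₀ +_) (*-comm n i₀)) (sym (m≡m%n+[m/n]*n p n)))
      i₀<k : i₀ < k
      i₀<k = m<n*o⇒m/o<n {o = n} (subst (p <_) (trans cells≡ (trans (cong₂ _*_
        (sym (kept prog bounds nCell (λ ()) (λ ()))) (sym (kept prog bounds kCell (λ ()) (λ ())))) (*-comm n k))) p<cells)
      ext : Extends n (colouring D) i₀ j₀ (λ v → colouring (upd D colours p (suc v)))
      ext = record
        { old   = trans (cong (D colours) p≡) (blank prog p ≤-refl)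
        ; new   = λ v → trans (cong (upd D colours p (suc v) colours) p≡) (write-hit D colours p (suc v))
        ; other = λ v i j j<n i≢⊎j≢ → write-miss D colours (suc v) colours (λ eq →
            different i≢⊎j≢ (divMod-unique {n} {i₀} {i} (m%n<n p n) j<n (trans p≡ eq)))
        }
        where
        different : ∀ {i j} → i ≢ i₀ ⊎ j ≢ j₀ → i₀ ≡ i × j₀ ≡ j → ⊥
        different (inj₁ i≢) (eq , _) = i≢ (sym eq)
        different (inj₂ j≢) (_ , eq) = j≢ (sym eq)

    choose-progress : ∀ {D p} → Progress D₀ p D → p < D₀ bounds cellsCell →
                      Progress D₀ (suc p) (exec choose D (p ∷ []))
    choose-progress {D} {p} prog p<cells = advance (try-succeeds 0 (pred q) D₁
        ((λ _ _ → refl) , λ _ _ _ → refl) (≤-reflexive (suc-pred q)) candidate)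
      where
      old : ℕ
      old = ⟦ potentialTerm q A r [] ⟧ D (p ∷ [])
      D₁ : Memory
      D₁ = upd D scratch 0 old
      candidate : ∃[ u ] (0 ≤ u × u ≤ pred q × Φ (upd D₁ colours p (suc u)) ≤ D₁ scratch 0)
      candidate with average prog p<cells
      ... | u , u<q , le = u , z≤n , s≤s⁻¹ (≤-trans u<q (≤-reflexive (sym (suc-pred q)))) ,
        ≤-trans le (≤-reflexive (sym (⟦potentialTerm⟧ q A r [] D (p ∷ []))))
      advance : ∀ {E} → Success D₁ p E → Progress D₀ (suc p) E
      advance {E} (v , v<q , painted , le) = record
        { given = given′
        ; blank = λ x p<x → trans (elsewhere painted x (<⇒≢ p<x)) (blank prog x (<⇒≤ p<x))
        ; kept  = λ B x B≢ B≢′ → trans (frame painted B x B≢) (trans (write-elsewhere D 0 old x B≢′) (kept prog B x B≢ B≢′))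
        ; small = ≤-trans le (≤-trans (≤-reflexive (⟦potentialTerm⟧ q A r [] D (p ∷ []))) (small prog))
        }
        where
        given′ : ∀ x → x < suc p → ∃[ v ] (v < q × E colours x ≡ suc v)
        given′ x x<1+p with m≤n⇒m<n∨m≡n (s≤s⁻¹ x<1+p)
        ... | inj₂ refl = v , v<q , there painted
        ... | inj₁ x<p  with given prog x x<p
        ...   | u , u<q , eq = u , u<q , trans (elsewhere painted x (λ p≡x → <⇒≢ x<p (sym p≡x))) eq

    paint-progress : (∀ x → D₀ colours x ≡ 0) → Progress D₀ (D₀ bounds cellsCell) (exec paint D₀ [])
    paint-progress zeros = loop (D₀ bounds cellsCell) ≤-refl
      where
      loop : ∀ y → y ≤ D₀ bounds cellsCell →
        Progress D₀ y (recur (λ x E → exec choose E (x ∷ [])) D₀ y)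
      loop zero    y≤ = record
        { given = λ _ () ; blank = λ x _ → zeros x ; kept = λ _ _ _ _ → refl ; small = ≤-refl }
      loop (suc y) y< = choose-progress (loop y (<⇒≤ y<)) y<

  keeps-try : ∀ v l → KeepsBounds (try v l)
  keeps-try v zero    D ρ b = refl
  keeps-try v (suc l) D ρ b = branch (⟦ potentialTerm q A r [] ⊟ arr scratch (lit 0) ⟧ D′ ρ)
    where
    D′ : Memory
    D′ = upd D colours (⟦ var zero ⟧ D ρ) (suc v)
    branch : ∀ c → ifzeroᴹ c D′ (exec (try (suc v) l) D′ ρ) bounds b ≡ D bounds b
    branch zero    = refl
    branch (suc _) = keeps-try (suc v) l D′ ρ b

  steady-try : ∀ v l → Steady (try v l)
  steady-try v zero    = set
  steady-try v (suc l) = both (λ _ _ _ → refl) set (ifz done (steady-try (suc v) l))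

  steady-paint : Steady paint
  steady-paint = for (λ D ρ b → keeps-try 0 (pred q) _ ρ b) (both (λ _ _ _ → refl) set (steady-try 0 (pred q)))

-- Computing the loop bounds

-- Loops run as often as some cell of `bounds` says. To iterate `f` exactly x times inside a loop of
-- t ≥ x rounds, the rounds with index y ≥ x are made idle.
module Guarded (f : ℕ → ℕ) (z x : ℕ) where

  step : ℕ → ℕ → ℕ
  step y a = ifzero (suc y ∸ x) (f a) a

  below : ∀ t → t ≤ x → recur step z t ≡ recur (λ _ → f) z t
  below zero    t≤x = refl
  below (suc t) t<x rewrite m≤n⇒m∸n≡0 t<x = cong f (below t (<⇒≤ t<x))

  guarded : ∀ t → x ≤ t → recur step z t ≡ recur (λ _ → f) z x
  guarded zero    z≤n = refl
  guarded (suc t) x≤ with m≤n⇒m<n∨m≡n x≤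
  ... | inj₂ refl = below x ≤-refl
  ... | inj₁ x<1+t = trans (beyond (suc t ∸ x) (m>n⇒m∸n≢0 x<1+t)) (guarded t (s≤s⁻¹ x<1+t))
    where
    beyond : ∀ c {a b} → c ≢ 0 → ifzero c a b ≡ b
    beyond zero    c≢0 = ⊥-elim (c≢0 refl)
    beyond (suc c) c≢0 = refl

-- Linear search in a loop without exit: the accumulator advances while the test gives zero and
-- stays put afterwards. If nothing is found within `t` rounds the result is `t`.
search : (ℕ → ℕ) → ℕ → ℕ
search g = recur (λ _ a → ifzero (g a) (a + 1) a) 0

search-finds : ∀ g t → (∀ y → y < search g t → g y ≡ 0) × (g (search g t) ≢ 0 ⊎ search g t ≡ t)
search-finds g zero    = (λ _ ()) , inj₂ refl
search-finds g (suc t) = extend (g a) refl (search-finds g t)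
  where
  a : ℕ
  a = search g t
  extend : ∀ c → g a ≡ c → (∀ y → y < a → g y ≡ 0) × (g a ≢ 0 ⊎ a ≡ t) →
    let a′ = ifzero c (a + 1) a in (∀ y → y < a′ → g y ≡ 0) × (g a′ ≢ 0 ⊎ a′ ≡ suc t)
  extend (suc _) eq (below , _)        = below , inj₁ (λ eq′ → 1+n≢0 (trans (sym eq) eq′))
  extend zero    eq (below , inj₁ neq) = ⊥-elim (neq eq)
  extend zero    eq (below , inj₂ end) = below′ , inj₂ (trans (+-comm a 1) (cong suc end))
    where
    below′ : ∀ y → y < a + 1 → g y ≡ 0
    below′ y y< with m≤n⇒m<n∨m≡n (s≤s⁻¹ (subst (y <_) (+-comm a 1) y<))
    ... | inj₁ y<a  = below y y<a
    ... | inj₂ refl = eq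

search-≤ : ∀ g t → search g t ≤ t
search-≤ g zero    = z≤n
search-≤ g (suc t) with g (search g t)
... | zero  = subst (_≤ suc t) (+-comm 1 _) (s≤s (search-≤ g t))
... | suc _ = m≤n⇒m≤1+n (search-≤ g t)

doubleTerm : ∀ {v} → Fin v → Term v
doubleTerm x = iter nCell (lit 2)
  (ifz ((lit 1 ⊞ var zero) ⊟ var (suc (suc x))) (var (suc zero) ⊞ var (suc zero)) (var (suc zero)))

⟦doubleTerm⟧ : ∀ {v} (x : Fin v) D ρ → lookup ρ x ≤ D bounds nCell → ⟦ doubleTerm x ⟧ D ρ ≡ 2 ^ suc (lookup ρ x)
⟦doubleTerm⟧ x D ρ x≤ = trans (Guarded.guarded (λ a → a + a) 2 (lookup ρ x) (D bounds nCell) x≤) (power (lookup ρ x))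
  where
  power : ∀ x → recur (λ _ a → a + a) 2 x ≡ 2 ^ suc x
  power zero    = refl
  power (suc x) = trans (cong₂ _+_ (power x) (power x)) (cong (2 ^ suc x +_) (sym (+-identityʳ (2 ^ suc x))))

timesTerm : ∀ {v} → Fin v → Fin v → Term v
timesTerm c x = iter nCell (lit 0)
  (ifz ((lit 1 ⊞ var zero) ⊟ var (suc (suc x))) (var (suc (suc c)) ⊞ var (suc zero)) (var (suc zero)))

⟦timesTerm⟧ : ∀ {v} (c x : Fin v) D ρ → lookup ρ x ≤ D bounds nCell →
              ⟦ timesTerm c x ⟧ D ρ ≡ lookup ρ x * lookup ρ c
⟦timesTerm⟧ c x D ρ x≤ =
  trans (Guarded.guarded (lookup ρ c +_) 0 (lookup ρ x) (D bounds nCell) x≤) (times (lookup ρ x))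
  where
  times : ∀ x → recur (λ _ a → lookup ρ c + a) 0 x ≡ x * lookup ρ c
  times zero    = refl
  times (suc x) = cong (lookup ρ c +_) (times x)

powerTerm : ∀ {v} → ℕ → Fin v → Term v
powerTerm zero    x = lit 1
powerTerm (suc r) x = lett (powerTerm r x) (timesTerm zero (suc x))

⟦powerTerm⟧ : ∀ {v} r (x : Fin v) D ρ → lookup ρ x ≤ D bounds nCell → ⟦ powerTerm r x ⟧ D ρ ≡ lookup ρ x ^ r
⟦powerTerm⟧ zero    x D ρ x≤ = refl
⟦powerTerm⟧ (suc r) x D ρ x≤ = trans (⟦timesTerm⟧ zero (suc x) D (⟦ powerTerm r x ⟧ D ρ ∷ ρ) x≤)
  (cong (lookup ρ x *_) (⟦powerTerm⟧ r x D ρ x≤))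

-- Inside `searchTerm` the environment also contains the round number, whereas `search` expects a
-- test of the accumulator alone.
powerTerm-local : ∀ {v} r (x : Fin v) D ρ ρ′ → lookup ρ x ≡ lookup ρ′ x →
                  ⟦ powerTerm r x ⟧ D ρ ≡ ⟦ powerTerm r x ⟧ D ρ′
powerTerm-local zero    x D ρ ρ′ eq = refl
powerTerm-local (suc r) x D ρ ρ′ eq =
  cong₂ (λ c a → recur (λ y z → ifzero (suc y ∸ a) (c + z) z) 0 (D bounds nCell))
    (powerTerm-local r x D ρ ρ′ eq) eq

searchTerm : ∀ {v} → Term (suc (suc v)) → Term v
searchTerm test = iter nCell (lit 0) (ifz test (var (suc zero) ⊞ lit 1) (var (suc zero)))

-- The first `s` with 2^(s+1) > n is the binary logarithm rounded down.
sTerm : Term 0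
sTerm = searchTerm (doubleTerm (suc zero) ⊟ arr bounds (lit nCell))

wTerm : ℕ → Term 0
wTerm r = searchTerm (powerTerm r (suc zero) ⊟ arr bounds (lit sCell))

kTerm : ℕ → ℕ → Term 0
kTerm r κ = lett (arr bounds (lit wCell)) (scale κ (powerTerm r zero))

cellsTerm : Term 0
cellsTerm = lett (arr bounds (lit kCell)) (timesN zero)

m<2^m : ∀ m → m < 2 ^ m
m<2^m zero    = ≤-refl
m<2^m (suc m) = begin
  suc (suc m)        ≤⟨ s≤s (m<2^m m) ⟩
  1 + 2 ^ m          ≤⟨ +-monoˡ-≤ (2 ^ m) (m^n>0 2 m) ⟩
  2 ^ m + 2 ^ m      ≡⟨ cong (2 ^ m +_) (+-identityʳ (2 ^ m)) ⟨
  2 ^ suc m          ∎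
  where open ≤-Reasoning

record IsLog (n s : ℕ) : Set where
  field
    lower : 2 ^ s ≤ n
    upper : n < 2 ^ suc s
    pos   : 1 ≤ s
    small : s ≤ n

sTerm-log : ∀ D → 2 ≤ D bounds nCell → IsLog (D bounds nCell) (⟦ sTerm ⟧ D [])
sTerm-log D 2≤n = record
  { lower = lower s s≤n below
  ; upper = upper s s≤n found
  ; pos   = positive s s≤n found
  ; small = s≤n
  }
  where
  n s : ℕ
  n = D bounds nCell
  s = ⟦ sTerm ⟧ D []
  test : ℕ → ℕ
  test a = ⟦ doubleTerm zero ⟧ D (a ∷ []) ∸ n
  below : ∀ y → y < s → test y ≡ 0
  below = proj₁ (search-finds test n)
  found : test s ≢ 0 ⊎ s ≡ n
  found = proj₂ (search-finds test n)
  s≤n : s ≤ n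
  s≤n = search-≤ test n
  value : ∀ a → a ≤ n → ⟦ doubleTerm zero ⟧ D (a ∷ []) ≡ 2 ^ suc a
  value a a≤n = ⟦doubleTerm⟧ zero D (a ∷ []) a≤n
  lower : ∀ s → s ≤ n → (∀ y → y < s → test y ≡ 0) → 2 ^ s ≤ n
  lower zero    s≤n below = ≤-trans (n≤1+n 1) 2≤n
  lower (suc s) s<n below = subst (_≤ n) (value s (<⇒≤ s<n)) (m∸n≡0⇒m≤n (below s ≤-refl))
  upper : ∀ s → s ≤ n → test s ≢ 0 ⊎ s ≡ n → n < 2 ^ suc s
  upper s s≤n (inj₁ neq) = ≰⇒> (λ le → neq (m≤n⇒m∸n≡0 (subst (_≤ n) (sym (value s s≤n)) le)))
  upper s s≤n (inj₂ eq)  = subst (λ x → n < 2 ^ suc x) (sym eq) (≤-trans (m<2^m n) (m≤m+n (2 ^ n) _))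
  positive : ∀ s → s ≤ n → test s ≢ 0 ⊎ s ≡ n → 1 ≤ s
  positive (suc s) s≤n _          = s≤s z≤n
  positive zero    s≤n (inj₁ neq) =
    ⊥-elim (neq (m≤n⇒m∸n≡0 (subst (_≤ n) (sym (value 0 z≤n)) 2≤n)))
  positive zero    s≤n (inj₂ eq)  = ⊥-elim (n≮0 (subst (1 ≤_) (sym eq) (≤-trans (n≤1+n 1) 2≤n)))

record IsRoot (r s w : ℕ) : Set where
  field
    lower : s < w ^ r
    upper : w ^ r ≤ 2 ^ r * s
    pos   : 1 ≤ w

-- The search cannot run out of rounds before s < w^r holds, because s < n ≤ n^r. The predecessor of
-- `w` failed the test, and `w` is at most twice its predecessor, which gives the upper bound.
wTerm-root : ∀ r D → 1 ≤ r → 2 ≤ D bounds nCell → 1 ≤ D bounds sCell → D bounds sCell < D bounds nCell →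
  IsRoot r (D bounds sCell) (⟦ wTerm r ⟧ D []) × ⟦ wTerm r ⟧ D [] ≤ D bounds nCell
wTerm-root r@(suc r′) D _ 2≤n 1≤s s<n = record
  { lower = lower w w≤n found
  ; upper = upper w w≤n below found
  ; pos   = positive w found
  } , w≤n
  where
  n s w : ℕ
  n = D bounds nCell
  s = D bounds sCell
  w = ⟦ wTerm r ⟧ D []
  test : ℕ → ℕ
  test a = ⟦ powerTerm r (suc zero) ⟧ D (0 ∷ a ∷ []) ∸ s
  tests : ∀ t → recur (λ x a → ifzero (⟦ powerTerm r (suc zero) ⟧ D (x ∷ a ∷ []) ∸ s) (a + 1) a) 0 t ≡ search test t
  tests zero    = refl
  tests (suc t) = trans
    (cong (λ a → ifzero (⟦ powerTerm r (suc zero) ⟧ D (t ∷ a ∷ []) ∸ s) (a + 1) a) (tests t))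
    (cong (λ z → ifzero (z ∸ s) (search test t + 1) (search test t))
      (powerTerm-local r (suc zero) D (t ∷ search test t ∷ []) (0 ∷ search test t ∷ []) refl))
  w≡ : w ≡ search test n
  w≡ = tests n
  below : ∀ y → y < w → test y ≡ 0
  below y y<w = proj₁ (search-finds test n) y (subst (y <_) w≡ y<w)
  found : test w ≢ 0 ⊎ w ≡ n
  found = subst (λ a → test a ≢ 0 ⊎ a ≡ n) (sym w≡) (proj₂ (search-finds test n))
  w≤n : w ≤ n
  w≤n = subst (_≤ n) (sym w≡) (search-≤ test n)
  value : ∀ a → a ≤ n → ⟦ powerTerm r (suc zero) ⟧ D (0 ∷ a ∷ []) ≡ a ^ r
  value a a≤n = ⟦powerTerm⟧ r (suc zero) D (0 ∷ a ∷ []) a≤n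
  root : ∀ n → 1 ≤ n → n ≤ n ^ r
  root n 1≤n = m≤m*n n (n ^ r′) {{m^n≢0 n r′ {{>-nonZero 1≤n}}}}
  lower : ∀ w → w ≤ n → test w ≢ 0 ⊎ w ≡ n → s < w ^ r
  lower w w≤n (inj₁ neq) = ≰⇒> (λ le → neq (m≤n⇒m∸n≡0 (subst (_≤ s) (sym (value w w≤n)) le)))
  lower w w≤n (inj₂ eq)  =
    subst (λ x → s < x ^ r) (sym eq) (≤-trans s<n (root n (≤-trans (n≤1+n 1) 2≤n)))
  positive : ∀ w → test w ≢ 0 ⊎ w ≡ n → 1 ≤ w
  positive (suc w) _          = s≤s z≤n
  positive zero    (inj₁ neq) =
    ⊥-elim (neq (m≤n⇒m∸n≡0 (subst (_≤ s) (sym (value 0 z≤n)) z≤n)))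
  positive zero    (inj₂ eq)  = ⊥-elim (n≮0 (subst (1 ≤_) (sym eq) (≤-trans (n≤1+n 1) 2≤n)))
  upper : ∀ w → w ≤ n → (∀ y → y < w → test y ≡ 0) → test w ≢ 0 ⊎ w ≡ n → w ^ r ≤ 2 ^ r * s
  upper zero          w≤n below found = z≤n
  -- Doubling the predecessor fails for w = 1; this value is excluded since 1^r does not exceed s
  -- and n ≥ 2.
  upper 1             w≤n below (inj₁ neq) = ⊥-elim (neq (m≤n⇒m∸n≡0
    (subst (_≤ s) (sym (trans (value 1 w≤n) (^-zeroˡ r))) 1≤s)))
  upper 1             w≤n below (inj₂ eq)  = ⊥-elim (<-irrefl eq 2≤n)
  upper (suc (suc w)) w≤n below found = begin
    (2 + w) ^ r              ≤⟨ ^-monoˡ-≤ r (double w) ⟩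
    (2 * suc w) ^ r          ≡⟨ ^-distrib-* r 2 (suc w) ⟩
    2 ^ r * suc w ^ r        ≤⟨ *-monoʳ-≤ (2 ^ r) (subst (_≤ s) (value (suc w) (<⇒≤ w≤n))
                                  (m∸n≡0⇒m≤n (below (suc w) ≤-refl))) ⟩
    2 ^ r * s                ∎
    where
    open ≤-Reasoning
    double : ∀ w → 2 + w ≤ 2 * suc w
    double w = s≤s (subst (suc w ≤_) (sym (+-suc w (w + 0))) (s≤s (m≤m+n w (w + 0))))

⟦kTerm⟧ : ∀ r κ D → D bounds wCell ≤ D bounds nCell → ⟦ kTerm r κ ⟧ D [] ≡ κ * D bounds wCell ^ r
⟦kTerm⟧ r κ D w≤ = trans (⟦scale⟧ κ (powerTerm r zero) D _) (cong (κ *_) (⟦powerTerm⟧ r zero D _ w≤))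

⟦cellsTerm⟧ : ∀ D → ⟦ cellsTerm ⟧ D [] ≡ D bounds nCell * D bounds kCell
⟦cellsTerm⟧ D = ⟦timesN⟧ zero D (D bounds kCell ∷ [])

-- Writing the coefficients

-- `S` is the number of forms per row, 1 in (a) and r in (b). Form `τ` of a row gives a variable of
-- colour c the coefficient `out τ c` divided by `δ * w`.
module Output (S q δ : ℕ) (out : ℕ → ℕ → ℕ) where

  colourTerm : ∀ {v} → ℕ → Fin v → Fin v → Term v
  colourTerm τ i m = sumTerms q (λ u → ifz (distanceTerm (cellAt i m) (lit (suc u))) (lit (out τ u)) (lit 0))

  ⟦colourTerm⟧ : ∀ {v} τ (i m : Fin v) D ρ {c} → colouring D (lookup ρ i) (lookup ρ m) ≡ suc c → c < q →
    ⟦ colourTerm τ i m ⟧ D ρ ≡ out τ c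
  ⟦colourTerm⟧ τ i m D ρ {c} eq c<q = begin
    ⟦ colourTerm τ i m ⟧ D ρ
      ≡⟨ ⟦sumTerms⟧ q _ D ρ (λ u → cong (λ z → ifzero (distance z (suc u)) (out τ u) 0) (trans (⟦cellAt⟧ i m D ρ) eq)) ⟩
    sumTo q (λ u → ifzero (distance (suc c) (suc u)) (out τ u) 0)
      ≡⟨ sumTo-spike _ c<q (λ u _ u≢c → miss u u≢c) ⟩
    ifzero (distance (suc c) (suc c)) (out τ c) 0
      ≡⟨ cong (λ d → ifzero d (out τ c) 0) (distance-refl (suc c)) ⟩
    out τ c ∎
    where
    open ≡-Reasoning
    miss : ∀ u → u ≢ c → ifzero (distance (suc c) (suc u)) (out τ u) 0 ≡ 0
    miss u u≢c with distance (suc c) (suc u) in eq′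
    ... | zero  = ⊥-elim (u≢c (sym (suc-injective (distance≡0⇒≡ eq′))))
    ... | suc _ = refl

  position : ℕ → ℕ → ℕ → ℕ → ℕ
  position n i τ m = n * (S * i + τ) + m

  positionTerm : ℕ → Term 2
  positionTerm τ = lett (scale S (var (suc zero)) ⊞ lit τ) (timesN zero ⊞ var (suc zero))

  ⟦positionTerm⟧ : ∀ τ D m i → ⟦ positionTerm τ ⟧ D (m ∷ i ∷ []) ≡ position (D bounds nCell) i τ m
  ⟦positionTerm⟧ τ D m i = cong (_+ m) (trans (⟦timesN⟧ zero D (_ ∷ m ∷ i ∷ []))
    (cong (λ z → D bounds nCell * (z + τ)) (⟦scale⟧ S (var (suc zero)) D (m ∷ i ∷ []))))

  -- One is subtracted because a stored s stands for the denominator s + 1.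
  denominatorTerm : Term 2
  denominatorTerm = scale δ (arr bounds (lit wCell)) ⊟ lit 1

  ⟦denominatorTerm⟧ : ∀ D ρ → ⟦ denominatorTerm ⟧ D ρ ≡ δ * D bounds wCell ∸ 1
  ⟦denominatorTerm⟧ D ρ = cong (_∸ 1) (⟦scale⟧ δ (arr bounds (lit wCell)) D ρ)

  writeSlot : ℕ → Stmt 2
  writeSlot τ = set numerators (positionTerm τ) (colourTerm τ (suc zero) zero) ⨟
                set denominators (positionTerm τ) denominatorTerm

  writeSlots : ℕ → Stmt 2
  writeSlots zero    = done
  writeSlots (suc τ) = writeSlots τ ⨟ writeSlot τ

  emit : Stmt 0
  emit = for kCell (for nCell (writeSlots S))

  keeps-slots : ∀ τ → KeepsBounds (writeSlots τ)
  keeps-slots zero    D ρ b = refl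
  keeps-slots (suc τ) D ρ b = keeps-slots τ D ρ b

  steady-slots : ∀ τ → Steady (writeSlots τ)
  steady-slots zero    = done
  steady-slots (suc τ) = both (keeps-slots τ) (steady-slots τ) (both (λ _ _ _ → refl) set set)

  keeps-row : KeepsBounds (for nCell (writeSlots S))
  keeps-row D ρ b = loop (D bounds nCell)
    where
    loop : ∀ y → recur (λ x E → exec (writeSlots S) E (x ∷ ρ)) D y bounds b ≡ D bounds b
    loop zero    = refl
    loop (suc y) = trans (keeps-slots S _ _ b) (loop y)

  steady-emit : Steady emit
  steady-emit = for keeps-row (for (keeps-slots S) (steady-slots S))

  module _ (D : Memory) (col : Coloured q (D bounds nCell) (D bounds kCell) (colouring D)) where

    private
      n k : ℕ
      n = D bounds nCell
      k = D bounds kCell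

    Frame : Memory → Set
    Frame E = ∀ B x → B ≢ numerators → B ≢ denominators → E B x ≡ D B x

    record Correct (E : Memory) (i τ m : ℕ) : Set where
      constructor correct
      field
        numerator   : ∀ {c} → colouring D i m ≡ suc c → E numerators (position n i τ m) ≡ out τ c
        denominator : E denominators (position n i τ m) ≡ δ * D bounds wCell ∸ 1

    record Step (E E′ : Memory) : Set where
      field
        frame : Frame E′
        keep  : ∀ {i τ m} → i < k → τ < S → m < n → Correct E i τ m → Correct E′ i τ m
    open Step

    step-trans : ∀ {E E′ E″} → Step E E′ → Step E′ E″ → Step E E″
    step-trans s s′ = record
      { frame = frame s′ ; keep = λ i<k τ<S m<n c → keep s′ i<k τ<S m<n (keep s i<k τ<S m<n c) }

    step-refl : ∀ {E} → Frame E → Step E E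
    step-refl fr = record { frame = fr ; keep = λ _ _ _ c → c }

    slot-step : ∀ {E i τ m} → Frame E → i < k → τ < S → m < n →
      let E′ = exec (writeSlot τ) E (m ∷ i ∷ []) in Step E E′ × Correct E′ i τ m
    slot-step {E} {i} {τ} {m} fr i<k τ<S m<n = record { frame = frame′ ; keep = keep′ } , this
      where
      P₁ P₂ v₁ v₂ : ℕ
      E₁ E′ : Memory
      P₁ = ⟦ positionTerm τ ⟧ E (m ∷ i ∷ [])
      v₁ = ⟦ colourTerm τ (suc zero) zero ⟧ E (m ∷ i ∷ [])
      E₁ = upd E numerators P₁ v₁
      P₂ = ⟦ positionTerm τ ⟧ E₁ (m ∷ i ∷ [])
      v₂ = ⟦ denominatorTerm ⟧ E₁ (m ∷ i ∷ [])
      E′ = upd E₁ denominators P₂ v₂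
      nE : ∀ b → E bounds b ≡ D bounds b
      nE b = fr bounds b (λ ()) (λ ())
      P₁≡ : P₁ ≡ position n i τ m
      P₁≡ = trans (⟦positionTerm⟧ τ E m i) (cong (λ z → position z i τ m) (nE nCell))
      P₂≡ : P₂ ≡ position n i τ m
      P₂≡ = trans (⟦positionTerm⟧ τ E₁ m i) (cong (λ z → position z i τ m) (nE nCell))
      v₂≡ : v₂ ≡ δ * D bounds wCell ∸ 1
      v₂≡ = trans (⟦denominatorTerm⟧ E₁ (m ∷ i ∷ [])) (cong (λ z → δ * z ∸ 1) (nE wCell))
      v₁≡ : ∀ {c} → colouring D i m ≡ suc c → v₁ ≡ out τ c
      v₁≡ {c} eq = ⟦colourTerm⟧ τ (suc zero) zero E (m ∷ i ∷ [])
        (trans (trans (fr colours _ (λ ()) (λ ())) (cong (λ z → D colours (z * i + m)) (nE nCell))) eq)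
        c<q
        where
        c<q : c < q
        c<q with Coloured.colour col i m i<k m<n
        ... | v , v<q , eq′ = subst (_< q) (suc-injective (trans (sym eq′) eq)) v<q
      frame′ : Frame E′
      frame′ B x B≢ B≢′ = trans (write-elsewhere E₁ P₂ v₂ x B≢′)
        (trans (write-elsewhere E P₁ v₁ x B≢) (fr B x B≢ B≢′))
      this : Correct E′ i τ m
      this = correct
        (λ eq → trans (cong (E₁ numerators) (sym P₁≡)) (trans (write-hit E numerators P₁ v₁) (v₁≡ eq)))
        (trans (cong (E′ denominators) (sym P₂≡)) (trans (write-hit E₁ denominators P₂ v₂) v₂≡))
      -- Two divisions with remainder recover row, form and variable from a position, so a write
      -- hits either the same slot, now correct anyway, or a different cell.
      keep′ : ∀ {i′ τ′ m′} → i′ < k → τ′ < S → m′ < n → Correct E i′ τ′ m′ → Correct E′ i′ τ′ m′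
      keep′ {i′} {τ′} {m′} i′<k τ′<S m′<n (correct numer denom)
        with position n i τ m ≟ position n i′ τ′ m′
      ... | yes eq with divMod-unique {n} {S * i + τ} m<n m′<n eq
      ...   | eq₁ , refl with divMod-unique {S} {i} τ<S τ′<S eq₁
      ...     | refl , refl = this
      keep′ {i′} {τ′} {m′} i′<k τ′<S m′<n (correct numer denom) | no neq = correct
        (λ eq → trans (write-miss E numerators v₁ numerators (λ e → neq (trans (sym P₁≡) e))) (numer eq))
        (trans (write-miss E₁ denominators v₂ denominators (λ e → neq (trans (sym P₂≡) e))) denom)

    slots-step : ∀ {E i m} t → t ≤ S → Frame E → i < k → m < n →
      let E′ = exec (writeSlots t) E (m ∷ i ∷ []) in Step E E′ × (∀ τ → τ < t → Correct E′ i τ m)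
    slots-step zero    t≤S fr i<k m<n = step-refl fr , λ _ ()
    slots-step {E} {i} {m} (suc t) t<S fr i<k m<n
      with slots-step {E} {i} {m} t (<⇒≤ t<S) fr i<k m<n
    ... | st , ok with slot-step {i = i} {t} {m} (frame st) i<k t<S m<n
    ...   | st′ , ok′ = step-trans st st′ , all
      where
      all : ∀ τ → τ < suc t → Correct _ i τ m
      all τ τ<1+t with m≤n⇒m<n∨m≡n (s≤s⁻¹ τ<1+t)
      ... | inj₁ τ<t  = keep st′ i<k (≤-trans τ<t (<⇒≤ t<S)) m<n (ok τ τ<t)
      ... | inj₂ refl = ok′

    row-step : ∀ {E i} y → y ≤ n → Frame E → i < k →
      let E′ = recur (λ x F → exec (writeSlots S) F (x ∷ i ∷ [])) E y in
      Step E E′ × (∀ τ m → τ < S → m < y → Correct E′ i τ m)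
    row-step zero    y≤n fr i<k = step-refl fr , λ _ _ _ ()
    row-step {E} {i} (suc y) y<n fr i<k with row-step {E} {i} y (<⇒≤ y<n) fr i<k
    ... | st , ok with slots-step {i = i} {y} S ≤-refl (frame st) i<k y<n
    ...   | st′ , ok′ = step-trans st st′ , all
      where
      all : ∀ τ m → τ < S → m < suc y → Correct _ i τ m
      all τ m τ<S m<1+y with m≤n⇒m<n∨m≡n (s≤s⁻¹ m<1+y)
      ... | inj₁ m<y  = keep st′ i<k τ<S (≤-trans m<y (<⇒≤ y<n)) (ok τ m τ<S m<y)
      ... | inj₂ refl = ok′ τ τ<S

    rows-step : ∀ y → y ≤ k →
      let E′ = recur (λ x F → exec (for nCell (writeSlots S)) F (x ∷ [])) D y in
      Step D E′ × (∀ i τ m → i < y → τ < S → m < n → Correct E′ i τ m)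
    rows-step zero    y≤k = step-refl (λ _ _ _ _ → refl) , λ _ _ _ ()
    rows-step (suc y) y<k with rows-step y (<⇒≤ y<k)
    ... | st , ok with row-step {i = y} n ≤-refl (frame st) y<k
    -- The inner loop reads its bound in the memory left by the earlier rows; the frame condition
    -- identifies it with `n`.
    ...   | st′ , ok′ = subst (λ z → Step D (rows z) × (∀ i τ m → i < suc y → τ < S → m < n → Correct (rows z) i τ m))
        (sym (frame st bounds nCell (λ ()) (λ ()))) (step-trans st st′ , all)
      where
      rows : ℕ → Memory
      rows z = recur (λ x F → exec (writeSlots S) F (x ∷ y ∷ []))
                     (recur (λ x F → exec (for nCell (writeSlots S)) F (x ∷ [])) D y) z
      all : ∀ i τ m → i < suc y → τ < S → m < n → Correct _ i τ m
      all i τ m i<1+y τ<S m<n with m≤n⇒m<n∨m≡n (s≤s⁻¹ i<1+y)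
      ... | inj₁ i<y  = keep st′ (≤-trans i<y (<⇒≤ y<k)) τ<S m<n (ok i τ m i<y τ<S m<n)
      ... | inj₂ refl = ok′ τ m τ<S m<n

    emit-correct : Frame (exec emit D []) ×
      (∀ i τ m → i < k → τ < S → m < n → Correct (exec emit D []) i τ m)
    emit-correct = let st , ok = rows-step k ≤-refl in frame st , ok

bounded-upd : ∀ D {B} i v → v ≤ B → Bounded D B → Bounded (upd D bounds i v) B
bounded-upd D {B} i v v≤ bound b with i ≟ b
... | yes refl = subst (_≤ B) (sym (write-hit D bounds i v)) v≤
... | no  i≢b  = subst (_≤ B) (sym (write-miss D bounds v bounds i≢b)) (bound b)

-- Abstract, so that the running time of a concrete statement is not evaluated.
abstract

  stmtCost : Stmt 0 → ℕ → ℕ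
  stmtCost = stmtTime

  stmtCost-poly : ∀ p → PolyBounded (stmtCost p)
  stmtCost-poly = stmtTime-poly

  runs-stmt : ∀ {p} → Steady p → ∀ D {B σ} → Bounded D B → Agree D σ →
    Runs (compileStmt 1 [] p) σ (stmtCost p B) (Agree (exec p D []))
  runs-stmt steady D bound agree =
    runs-weaken proj₂ (compileStmt-runs steady 1 [] [] D _ _ (environment λ ()) agree bound)

-- The complete program and its running time

module Algorithm (r q S δ κ A : ℕ) .{{q≢0 : NonZero q}} (1≤r : 1 ≤ r) (out : ℕ → ℕ → ℕ) where

  open Painting q A r
  open Output S q δ out

  run : Stmt 0 → Program
  run = compileStmt 1 []

  param : ℕ → Term 0 → Program
  param i t = run (set bounds (lit i) t)

  program : Program
  program =
    -- The input sits in register 0. All compiled code works from register 1 on, and the last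
    -- instruction overwrites register 0 with the number of rows.
    put (suc bounds) (const nCell) (register 0) ⨾
    param sCell sTerm ⨾ param wCell (wTerm r) ⨾ param kCell (kTerm r κ) ⨾ param cellsCell cellsTerm ⨾
    run paint ⨾ run emit ⨾
    put 0 (const 0) (suc bounds at const kCell)

  time : ℕ → ℕ
  time B = 4 + (stmtCost (set bounds (lit sCell) sTerm) B + (stmtCost (set bounds (lit wCell) (wTerm r)) B +
    (stmtCost (set bounds (lit kCell) (kTerm r κ)) B + (stmtCost (set bounds (lit cellsCell) cellsTerm) B +
    (stmtCost paint B + (stmtCost emit B + 4))))))

  record Emitted (n k w : ℕ) (σ : Store) : Set where
    field
      f            : Colouring
      is-coloured  : Coloured q n k f
      balanced     : potential q n k A f r [] ≤ (1 + n * q) ^ r * suc A ^ k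
      count-cell   : σ 0 0 ≡ k
      numerator    : ∀ {i τ m c} → i < k → τ < S → m < n → f i m ≡ suc c → σ 1 (position n i τ m) ≡ out τ c
      nothing      : ∀ x → σ 2 x ≡ 0
      denominator  : ∀ {i τ m} → i < k → τ < S → m < n → σ 3 (position n i τ m) ≡ δ * w ∸ 1

  Outcome : ℕ → Store → Set
  Outcome n σ = ∃[ s ] ∃[ w ] (IsLog n s × IsRoot r s w × Emitted n (κ * w ^ r) w σ)

  -- Dominates all loop bounds: the largest is the number n κ w^r of cells with w ≤ n, and the
  -- successor of κ also covers n itself.
  limit : ℕ → ℕ
  limit n = suc κ * n ^ suc r

  n≤limit : ∀ n → 2 ≤ n → n ≤ limit n
  n≤limit n 2≤n = ≤-trans (m≤m*n n (n ^ r) {{m^n≢0 n r {{>-nonZero (≤-trans (n≤1+n 1) 2≤n)}}}}) (m≤m+n _ _)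

  colour-and-emit : Program
  colour-and-emit = run paint ⨾ run emit ⨾ put 0 (const 0) (suc bounds at const kCell)

  module _ (D : Memory) (n≢0 : NonZero (D bounds nCell))
           (cells≡ : D bounds cellsCell ≡ D bounds nCell * D bounds kCell)
           (blank : ∀ x → D colours x ≡ 0) (unused : ∀ x → D 1 x ≡ 0) where

    private
      n k : ℕ
      n = D bounds nCell
      k = D bounds kCell

      D₁ D₂ : Memory
      D₁ = exec paint D []
      D₂ = exec emit D₁ []

      progress : Progress D (D bounds cellsCell) D₁
      progress = paint-progress n≢0 cells≡ blank

      same-bounds : ∀ b → D₁ bounds b ≡ D bounds b
      same-bounds b = Progress.kept progress bounds b (λ ()) (λ ())

      is-coloured₁ : Coloured q (D₁ bounds nCell) (D₁ bounds kCell) (colouring D₁)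
      is-coloured₁ = coloured λ i j i<k j<n → Progress.given progress (D₁ bounds nCell * i + j)
        (subst (D₁ bounds nCell * i + j <_)
          (trans (cong₂ _*_ (same-bounds nCell) (same-bounds kCell)) (sym cells≡)) (within i<k j<n))
        where
        within : ∀ {n k i j} → i < k → j < n → n * i + j < n * k
        within {n} {k} {i} {j} i<k j<n = begin
          suc (n * i + j)    ≡⟨ +-suc (n * i) j ⟨
          n * i + suc j      ≤⟨ +-monoʳ-≤ (n * i) j<n ⟩
          n * i + n          ≡⟨ trans (+-comm (n * i) n) (sym (*-suc n i)) ⟩
          n * suc i          ≤⟨ *-monoʳ-≤ n i<k ⟩
          n * k              ∎
          where open ≤-Reasoning

      small : Φ D ≤ (1 + n * q) ^ r * suc A ^ k
      small = Uncoloured.potential-blank (λ i j → blank (n * i + j)) k A r []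

      emitted : ∀ {σ} → Agree D₂ σ → Emitted n k (D bounds wCell) (write σ 0 0 (σ (suc bounds) kCell))
      emitted {σ} agree = subst (λ n → Emitted n k (D bounds wCell) τ) (same-bounds nCell)
        (subst₂ (λ k w → Emitted (D₁ bounds nCell) k w τ) (same-bounds kCell) (same-bounds wCell) (record
          { f           = colouring D₁
          ; is-coloured = is-coloured₁
          ; balanced    = ≤-trans (Progress.small progress) (≤-trans small (≤-reflexive
              (cong₂ (λ n k → (1 + n * q) ^ r * suc A ^ k) (sym (same-bounds nCell)) (sym (same-bounds kCell)))))
          ; count-cell  = trans (Agree.cell agree bounds kCell) (proj₁ ok bounds kCell (λ ()) (λ ()))
          ; numerator   = λ i<k τ<S m<n eq → trans (Agree.cell agree numerators _)
              (Correct.numerator (proj₂ ok _ _ _ i<k τ<S m<n) eq)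
          ; nothing     = λ x → trans (Agree.cell agree 1 x) (trans (proj₁ ok 1 x (λ ()) (λ ()))
              (trans (Progress.kept progress 1 x (λ ()) (λ ())) (unused x)))
          ; denominator = λ i<k τ<S m<n → trans (Agree.cell agree denominators _)
              (Correct.denominator (proj₂ ok _ _ _ i<k τ<S m<n))
          }))
        where
        τ : Store
        τ = write σ 0 0 (σ (suc bounds) kCell)
        ok : Frame D₁ is-coloured₁ D₂ × (∀ i τ m → i < D₁ bounds kCell → τ < S → m < D₁ bounds nCell →
               Correct D₁ is-coloured₁ D₂ i τ m)
        ok = emit-correct D₁ is-coloured₁

    colour-and-emit-runs : ∀ {B σ} → Bounded D B → Agree D σ →
      Runs colour-and-emit σ (stmtCost paint B + (stmtCost emit B + 4)) (Emitted n k (D bounds wCell))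
    colour-and-emit-runs bound agree =
      runs-⨾ (runs-stmt steady-paint D bound agree) λ a₁ →
      runs-⨾ (runs-stmt steady-emit D₁ (bounded-keeps D D₁ same-bounds bound) a₁) λ a₂ →
      runs-put (emitted a₂)

  module _ (n : ℕ) (2≤n : 2 ≤ n) where

    private
      D₁ : Memory
      D₁ = upd (λ _ _ → 0) bounds nCell n

      instance
        n≢0 : NonZero n
        n≢0 = >-nonZero (≤-trans (n≤1+n 1) 2≤n)

      B : ℕ
      B = limit n

      module _ (s : ℕ) (is-log : IsLog n s) (s≡ : ⟦ sTerm ⟧ D₁ [] ≡ s) where

        D₂ : Memory
        D₂ = upd D₁ bounds sCell s

        module _ (w : ℕ) (is-root : IsRoot r s w) (w≤n : w ≤ n) (w≡ : ⟦ wTerm r ⟧ D₂ [] ≡ w) where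

          D₃ D₄ D₅ : Memory
          D₃ = upd D₂ bounds wCell w
          D₄ = upd D₃ bounds kCell (κ * w ^ r)
          D₅ = upd D₄ bounds cellsCell (n * (κ * w ^ r))

          k≤ : κ * w ^ r ≤ κ * n ^ r
          k≤ = *-monoʳ-≤ κ (^-monoˡ-≤ r w≤n)

          k≤limit : κ * w ^ r ≤ limit n
          k≤limit = ≤-trans k≤ (≤-trans (*-monoʳ-≤ κ (m≤n*m (n ^ r) n)) (m≤n+m _ _))

          cells≤limit : n * (κ * w ^ r) ≤ limit n
          cells≤limit = begin
            n * (κ * w ^ r)      ≤⟨ *-monoʳ-≤ n k≤ ⟩
            n * (κ * n ^ r)      ≡⟨ x∙yz≈y∙xz n κ (n ^ r) ⟩
            κ * n ^ suc r        ≤⟨ m≤n+m _ _ ⟩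
            limit n              ∎
            where
            open ≤-Reasoning

          b₁ : Bounded D₁ B
          b₁ = bounded-upd (λ _ _ → 0) nCell n (n≤limit n 2≤n) (λ _ → z≤n)
          b₂ : Bounded D₂ B
          b₂ = bounded-upd D₁ sCell s (≤-trans (IsLog.small is-log) (n≤limit n 2≤n)) b₁
          b₃ : Bounded D₃ B
          b₃ = bounded-upd D₂ wCell w (≤-trans w≤n (n≤limit n 2≤n)) b₂
          b₄ : Bounded D₄ B
          b₄ = bounded-upd D₃ kCell (κ * w ^ r) k≤limit b₃
          b₅ : Bounded D₅ B
          b₅ = bounded-upd D₄ cellsCell (n * (κ * w ^ r)) cells≤limit b₄

          runs-param : ∀ i t v D {σ} → ⟦ t ⟧ D [] ≡ v → Bounded D B → Agree D σ →
            Runs (param i t) σ (stmtCost (set bounds (lit i) t) B) (Agree (upd D bounds i v))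
          runs-param i t v D refl bound agree = runs-stmt set D bound agree

          start : Agree D₁ (write (input n) (suc bounds) nCell n)
          start = agree-write bounds nCell n (agrees (λ _ _ → refl))

          program-runs′ : Runs program (input n) (time B) (Outcome n)
          program-runs′ =
            runs-⨾ (runs-put {Post = Agree D₁} start) λ a₁ →
            runs-⨾ (runs-param sCell sTerm s D₁ s≡ b₁ a₁) λ a₂ →
            runs-⨾ (runs-param wCell (wTerm r) w D₂ w≡ b₂ a₂) λ a₃ →
            runs-⨾ (runs-param kCell (kTerm r κ) (κ * w ^ r) D₃ (⟦kTerm⟧ r κ D₃ w≤n) b₃ a₃) λ a₄ →
            runs-⨾ (runs-param cellsCell cellsTerm (n * (κ * w ^ r)) D₄ (⟦cellsTerm⟧ D₄) b₄ a₄) λ a₅ →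
            runs-weaken (λ e → s , w , is-log , is-root , e)
              (colour-and-emit-runs D₅ n≢0 refl (λ _ → refl) (λ _ → refl) b₅ a₅)

    program-runs : Runs program (input n) (time (limit n)) (Outcome n)
    program-runs = program-runs′ s is-log refl w (proj₁ root) (proj₂ root) refl
      where
      s w : ℕ
      s = ⟦ sTerm ⟧ D₁ []
      is-log : IsLog n s
      is-log = sTerm-log D₁ 2≤n
      w = ⟦ wTerm r ⟧ (upd D₁ bounds sCell s) []
      root : IsRoot r s w × w ≤ n
      root = wTerm-root r (upd D₁ bounds sCell s) 1≤r 2≤n (IsLog.pos is-log)
        (≤-trans (m<2^m s) (IsLog.lower is-log))

  time-poly : PolyBounded time
  time-poly = poly-+ (poly-const 4) (poly-+ (stmtCost-poly (set bounds (lit sCell) sTerm))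
    (poly-+ (stmtCost-poly (set bounds (lit wCell) (wTerm r))) (poly-+ (stmtCost-poly (set bounds (lit kCell) (kTerm r κ)))
    (poly-+ (stmtCost-poly (set bounds (lit cellsCell) cellsTerm)) (poly-+ (stmtCost-poly paint)
    (poly-+ (stmtCost-poly emit) (poly-const 4)))))))

  program-polytime : ∀ {Spec : ℕ → Store → Set} → (∀ n σ → 2 ≤ n → Outcome n σ → Spec n σ) →
                     PolyTime program Spec
  program-polytime spec with time-poly
  ... | c , d , bound = c * suc κ ^ d , suc r * d , λ n 2≤n → finish n 2≤n (program-runs n 2≤n)
    where
    finish : ∀ n → 2 ≤ n → Runs program (input n) (time (limit n)) (Outcome n) → _
    finish n 2≤n (σ , t , run , t≤ , outcome) = σ , t , run , (begin
      t                               ≤⟨ t≤ ⟩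
      time (limit n)                  ≤⟨ bound (limit n) (≤-trans (n≤1+n 1) (≤-trans 2≤n (n≤limit n 2≤n))) ⟩
      c * limit n ^ d                 ≡⟨ cong (c *_) (trans (^-distrib-* d (suc κ) (n ^ suc r))
                                           (cong (suc κ ^ d *_) (^-*-assoc n (suc r) d))) ⟩
      c * (suc κ ^ d * n ^ (suc r * d)) ≡⟨ *-assoc c _ _ ⟨
      c * suc κ ^ d * n ^ (suc r * d) ∎) , spec n σ 2≤n outcome
      where open ≤-Reasoning

-- Polynomial identities over the rationals

infixr 8 _^ℚ_
_^ℚ_ : ℚ → ℕ → ℚ
x ^ℚ zero  = 1ℚ
x ^ℚ suc n = x ℚ.* x ^ℚ n

^ℚ-distrib-* : ∀ x y n → (x ℚ.* y) ^ℚ n ≡ x ^ℚ n ℚ.* y ^ℚ n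
^ℚ-distrib-* x y zero    = refl
^ℚ-distrib-* x y (suc n) = trans (cong (x ℚ.* y ℚ.*_) (^ℚ-distrib-* x y n)) (*ℚ-interchange x y (x ^ℚ n) (y ^ℚ n))

zero-*ˡ : ∀ {a b} → a ≡ 0ℚ → a ℚ.* b ≡ 0ℚ
zero-*ˡ {b = b} refl = ℚP.*-zeroˡ b

∑ℚ ∏ℚ : {A : Set} → List A → (A → ℚ) → ℚ
∑ℚ []       f = 0ℚ
∑ℚ (x ∷ xs) f = f x ℚ.+ ∑ℚ xs f
∏ℚ []       f = 1ℚ
∏ℚ (x ∷ xs) f = f x ℚ.* ∏ℚ xs f

module _ {A : Set} where

  ∑ℚ-cong : ∀ (xs : List A) {f g} → (∀ x → f x ≡ g x) → ∑ℚ xs f ≡ ∑ℚ xs g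
  ∑ℚ-cong []       eq = refl
  ∑ℚ-cong (x ∷ xs) eq = cong₂ ℚ._+_ (eq x) (∑ℚ-cong xs eq)

  ∏ℚ-cong : ∀ (xs : List A) {f g} → (∀ x → f x ≡ g x) → ∏ℚ xs f ≡ ∏ℚ xs g
  ∏ℚ-cong []       eq = refl
  ∏ℚ-cong (x ∷ xs) eq = cong₂ ℚ._*_ (eq x) (∏ℚ-cong xs eq)

  ∑ℚ-++ : ∀ (xs ys : List A) f → ∑ℚ (xs ++ ys) f ≡ ∑ℚ xs f ℚ.+ ∑ℚ ys f
  ∑ℚ-++ []       ys f = sym (ℚP.+-identityˡ _)
  ∑ℚ-++ (x ∷ xs) ys f = trans (cong (f x ℚ.+_) (∑ℚ-++ xs ys f)) (sym (ℚP.+-assoc (f x) (∑ℚ xs f) (∑ℚ ys f)))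

  ∑ℚ-+ : ∀ (xs : List A) f g → ∑ℚ xs (λ x → f x ℚ.+ g x) ≡ ∑ℚ xs f ℚ.+ ∑ℚ xs g
  ∑ℚ-+ []       f g = refl
  ∑ℚ-+ (x ∷ xs) f g = trans (cong (f x ℚ.+ g x ℚ.+_) (∑ℚ-+ xs f g)) (interchange (f x) (g x) (∑ℚ xs f) (∑ℚ xs g))
    where
    interchange : ∀ a b c d → (a ℚ.+ b) ℚ.+ (c ℚ.+ d) ≡ (a ℚ.+ c) ℚ.+ (b ℚ.+ d)
    interchange = solve 4 (λ a b c d → (a :+ b) :+ (c :+ d) := (a :+ c) :+ (b :+ d)) refl
      where open +-*-Solver

  ∑ℚ-*ˡ : ∀ (xs : List A) c f → ∑ℚ xs (λ x → c ℚ.* f x) ≡ c ℚ.* ∑ℚ xs f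
  ∑ℚ-*ˡ []       c f = sym (ℚP.*-zeroʳ c)
  ∑ℚ-*ˡ (x ∷ xs) c f = trans (cong (c ℚ.* f x ℚ.+_) (∑ℚ-*ˡ xs c f)) (sym (ℚP.*-distribˡ-+ c (f x) (∑ℚ xs f)))

  ∑ℚ-zero : ∀ (xs : List A) {f} → (∀ x → f x ≡ 0ℚ) → ∑ℚ xs f ≡ 0ℚ
  ∑ℚ-zero []       eq = refl
  ∑ℚ-zero (x ∷ xs) eq = trans (cong₂ ℚ._+_ (eq x) (∑ℚ-zero xs eq)) (ℚP.+-identityˡ 0ℚ)

  ∑ℚ-filter : ∀ {P : A → Set} (P? : Decidable P) (xs : List A) f →
              (∀ x → f x ≡ 0ℚ ⊎ P x) → ∑ℚ (filter P? xs) f ≡ ∑ℚ xs f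
  ∑ℚ-filter P? []       f ok = refl
  ∑ℚ-filter P? (x ∷ xs) f ok with P? x | ok x
  ... | yes _ | _       = cong (f x ℚ.+_) (∑ℚ-filter P? xs f ok)
  ... | no ¬p | inj₂ p  = ⊥-elim (¬p p)
  ... | no ¬p | inj₁ eq = trans (∑ℚ-filter P? xs f ok)
    (trans (sym (ℚP.+-identityˡ _)) (cong (ℚ._+ ∑ℚ xs f) (sym eq)))

  ∏ℚ-*ˡ : ∀ (xs : List A) c f → ∏ℚ xs (λ x → c ℚ.* f x) ≡ c ^ℚ length xs ℚ.* ∏ℚ xs f
  ∏ℚ-*ˡ []       c f = refl
  ∏ℚ-*ˡ (x ∷ xs) c f = trans (cong (c ℚ.* f x ℚ.*_) (∏ℚ-*ˡ xs c f)) (interchange c (f x) (c ^ℚ length xs) (∏ℚ xs f))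
    where
    interchange : ∀ a b c d → (a ℚ.* b) ℚ.* (c ℚ.* d) ≡ (a ℚ.* c) ℚ.* (b ℚ.* d)
    interchange = solve 4 (λ a b c d → (a :* b) :* (c :* d) := (a :* c) :* (b :* d)) refl
      where open +-*-Solver

∑ℚ-map : ∀ {A B : Set} (h : A → B) xs f → ∑ℚ (map h xs) f ≡ ∑ℚ xs (λ x → f (h x))
∑ℚ-map h []       f = refl
∑ℚ-map h (x ∷ xs) f = cong (f (h x) ℚ.+_) (∑ℚ-map h xs f)

∑ℚ-swap : ∀ {A B : Set} (xs : List A) (ys : List B) (f : A → B → ℚ) →
          ∑ℚ xs (λ x → ∑ℚ ys (f x)) ≡ ∑ℚ ys (λ y → ∑ℚ xs (λ x → f x y))
∑ℚ-swap []       ys f = sym (∑ℚ-zero ys (λ _ → refl))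
∑ℚ-swap (x ∷ xs) ys f = trans (cong (∑ℚ ys (f x) ℚ.+_) (∑ℚ-swap xs ys f))
  (sym (∑ℚ-+ ys (f x) (λ y → ∑ℚ xs (λ x → f x y))))

∑ℚ-product : ∀ {A B C : Set} (h : A → B → C) xs ys f →
             ∑ℚ (cartesianProductWith h xs ys) f ≡ ∑ℚ xs (λ x → ∑ℚ ys (λ y → f (h x y)))
∑ℚ-product h []       ys f = refl
∑ℚ-product h (x ∷ xs) ys f = trans (∑ℚ-++ (map (h x) ys) _ f)
  (cong₂ ℚ._+_ (∑ℚ-map (h x) ys f) (∑ℚ-product h xs ys f))

∑ᶠ ∏ᶠ : (n : ℕ) → (Fin n → ℚ) → ℚ
∑ᶠ zero    f = 0ℚ
∑ᶠ (suc n) f = f zero ℚ.+ ∑ᶠ n (λ i → f (suc i))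
∏ᶠ zero    f = 1ℚ
∏ᶠ (suc n) f = f zero ℚ.* ∏ᶠ n (λ i → f (suc i))

∑ℚ-tabulate : ∀ {A : Set} {n} (g : Fin n → A) f → ∑ℚ (tabulate g) f ≡ ∑ᶠ n (λ i → f (g i))
∑ℚ-tabulate {n = zero}  g f = refl
∑ℚ-tabulate {n = suc n} g f = cong (f (g zero) ℚ.+_) (∑ℚ-tabulate (λ i → g (suc i)) f)

∏ℚ-tabulate : ∀ {A : Set} {n} (g : Fin n → A) f → ∏ℚ (tabulate g) f ≡ ∏ᶠ n (λ i → f (g i))
∏ℚ-tabulate {n = zero}  g f = refl
∏ℚ-tabulate {n = suc n} g f = cong (f (g zero) ℚ.*_) (∏ℚ-tabulate (λ i → g (suc i)) f)

∏ᶠ-cong : ∀ n {f g : Fin n → ℚ} → (∀ i → f i ≡ g i) → ∏ᶠ n f ≡ ∏ᶠ n g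
∏ᶠ-cong zero    eq = refl
∏ᶠ-cong (suc n) eq = cong₂ ℚ._*_ (eq zero) (∏ᶠ-cong n (λ i → eq (suc i)))

∑ᶠ-cong : ∀ n {f g : Fin n → ℚ} → (∀ i → f i ≡ g i) → ∑ᶠ n f ≡ ∑ᶠ n g
∑ᶠ-cong zero    eq = refl
∑ᶠ-cong (suc n) eq = cong₂ ℚ._+_ (eq zero) (∑ᶠ-cong n (λ i → eq (suc i)))

∑ᶠ-*ˡ : ∀ n c (f : Fin n → ℚ) → ∑ᶠ n (λ i → c ℚ.* f i) ≡ c ℚ.* ∑ᶠ n f
∑ᶠ-*ˡ zero    c f = sym (ℚP.*-zeroʳ c)
∑ᶠ-*ˡ (suc n) c f = trans (cong (c ℚ.* f zero ℚ.+_) (∑ᶠ-*ˡ n c _)) (sym (ℚP.*-distribˡ-+ c (f zero) _))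

multinomial-vanishes : ∀ {m} t (a : Vec ℕ m) → multinomial t a ≡ 0 ⊎ sum a ≡ t
multinomial-vanishes zero    []       = inj₂ refl
multinomial-vanishes (suc t) []       = inj₁ refl
multinomial-vanishes t       (a ∷ as) with a ≤? t | multinomial-vanishes (t ∸ a) as
... | no  a≰t | _       = inj₁ (cong (_* multinomial (t ∸ a) as) (binom-zero (≰⇒> a≰t)))
... | yes a≤t | inj₁ eq = inj₁ (trans (cong (binom t a *_) eq) (*-zeroʳ (binom t a)))
... | yes a≤t | inj₂ eq = inj₂ (trans (cong (a +_) eq) (m+[n∸m]≡n a≤t))

picks-All : ∀ {A : Set} {P : A → Set} {U} → All P U → All (λ (v , V) → P v × All P V) (picks U)
picks-All []                 = []
picks-All {P = P} {u ∷ U} (p ∷ ps) = (p , ps) ∷ extend (picks-All ps)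
  where
  extend : ∀ {qs} → All (λ (v , V) → P v × All P V) qs →
           All (λ (v , V) → P v × All P V) (map (λ (y , ys) → y , u ∷ ys) qs)
  extend []              = []
  extend ((q , qs) ∷ rs) = (q , p ∷ qs) ∷ extend rs

Distinct : List ℕ → Set
Distinct = AllPairs _≢_

picks-distinct : ∀ {U} → Distinct U → All (λ (v , V) → Distinct V) (picks U)
picks-distinct [] = []
picks-distinct {u ∷ U} (new ∷ dist) = dist ∷ extend (picks-All new) (picks-distinct dist)
  where
  extend : ∀ {qs} → All (λ (v , V) → u ≢ v × All (u ≢_) V) qs → All (λ (v , V) → Distinct V) qs →
           All (λ (v , V) → Distinct V) (map (λ (y , ys) → y , u ∷ ys) qs)
  extend []                   []       = []
  extend ((_ , new′) ∷ news) (d ∷ ds) = (new′ ∷ d) ∷ extend news ds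

∑ℚ-cong-All : ∀ {A : Set} {P : A → Set} {xs f g} → (∀ {x} → P x → f x ≡ g x) → All P xs → ∑ℚ xs f ≡ ∑ℚ xs g
∑ℚ-cong-All eq []       = refl
∑ℚ-cong-All eq (p ∷ ps) = cong₂ ℚ._+_ (eq p) (∑ℚ-cong-All eq ps)

-- At most one of the numbers e u is nonzero, so the product is linear in x.
product-picks : ∀ (e R : ℕ → ℚ) x → (∀ {u v} → u ≢ v → e u ℚ.* e v ≡ 0ℚ) → ∀ {U} → Distinct U →
  ∏ℚ U (λ u → e u ℚ.* x ℚ.+ R u) ≡ ∑ℚ (picks U) (λ (v , V) → (e v ℚ.* x) ℚ.* ∏ℚ V R) ℚ.+ ∏ℚ U R
product-picks e R x orth [] = sym (ℚP.+-identityˡ 1ℚ)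
product-picks e R x orth {u ∷ U} (new ∷ dist) = begin
  (e u ℚ.* x ℚ.+ R u) ℚ.* ∏ℚ U (λ u → e u ℚ.* x ℚ.+ R u)
    ≡⟨ cong ((e u ℚ.* x ℚ.+ R u) ℚ.*_) (product-picks e R x orth dist) ⟩
  (e u ℚ.* x ℚ.+ R u) ℚ.* (S ℚ.+ ∏ℚ U R)
    ≡⟨ expand (e u) x (R u) S (∏ℚ U R) ⟩
  x ℚ.* (e u ℚ.* S) ℚ.+ ((e u ℚ.* x) ℚ.* ∏ℚ U R ℚ.+ R u ℚ.* S ℚ.+ R u ℚ.* ∏ℚ U R)
    ≡⟨ cong₂ (λ a b → x ℚ.* a ℚ.+ ((e u ℚ.* x) ℚ.* ∏ℚ U R ℚ.+ b ℚ.+ R u ℚ.* ∏ℚ U R)) vanish extend ⟩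
  x ℚ.* 0ℚ ℚ.+ ((e u ℚ.* x) ℚ.* ∏ℚ U R ℚ.+ S′ ℚ.+ R u ℚ.* ∏ℚ U R)
    ≡⟨ cong (ℚ._+ ((e u ℚ.* x) ℚ.* ∏ℚ U R ℚ.+ S′ ℚ.+ R u ℚ.* ∏ℚ U R)) (ℚP.*-zeroʳ x) ⟩
  0ℚ ℚ.+ ((e u ℚ.* x) ℚ.* ∏ℚ U R ℚ.+ S′ ℚ.+ R u ℚ.* ∏ℚ U R)
    ≡⟨ ℚP.+-identityˡ _ ⟩
  (e u ℚ.* x) ℚ.* ∏ℚ U R ℚ.+ S′ ℚ.+ R u ℚ.* ∏ℚ U R ∎
  where
  open ≡-Reasoning
  term : ℕ × List ℕ → ℚ
  term (v , V) = (e v ℚ.* x) ℚ.* ∏ℚ V R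
  S S′ : ℚ
  S  = ∑ℚ (picks U) term
  S′ = ∑ℚ (map (λ (y , ys) → y , u ∷ ys) (picks U)) term
  expand : ∀ e x r s p → (e ℚ.* x ℚ.+ r) ℚ.* (s ℚ.+ p) ≡
           x ℚ.* (e ℚ.* s) ℚ.+ ((e ℚ.* x) ℚ.* p ℚ.+ r ℚ.* s ℚ.+ r ℚ.* p)
  expand = solve 5 (λ e x r s p → (e :* x :+ r) :* (s :+ p) :=
           x :* (e :* s) :+ ((e :* x) :* p :+ r :* s :+ r :* p)) refl
    where open +-*-Solver
  vanish : e u ℚ.* S ≡ 0ℚ
  vanish = trans (sym (∑ℚ-*ˡ (picks U) (e u) term)) (trans
    (∑ℚ-cong-All {g = λ _ → 0ℚ} (λ { {v , V} (u≢v , _) → trans (rearrange (e u) (e v) x (∏ℚ V R))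
      (zero-*ˡ (orth u≢v)) }) (picks-All new))
    (∑ℚ-zero (picks U) (λ _ → refl)))
    where
    rearrange : ∀ a b c d → a ℚ.* ((b ℚ.* c) ℚ.* d) ≡ (a ℚ.* b) ℚ.* (c ℚ.* d)
    rearrange = solve 4 (λ a b c d → a :* ((b :* c) :* d) := (a :* b) :* (c :* d)) refl
      where open +-*-Solver
  extend : R u ℚ.* S ≡ S′
  extend = trans (sym (∑ℚ-*ˡ (picks U) (R u) term)) (trans
    (∑ℚ-cong (picks U) (λ (v , V) → rearrange (R u) (e v ℚ.* x) (∏ℚ V R)))
    (sym (∑ℚ-map _ (picks U) term)))
    where
    rearrange : ∀ a b c → a ℚ.* (b ℚ.* c) ≡ b ℚ.* (a ℚ.* c)
    rearrange = solve 3 (λ a b c → a :* (b :* c) := b :* (a :* c)) refl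
      where open +-*-Solver

squarefreeᶠ : ∀ {n} → (Fin n → ℚ) → Subset n → ℚ
squarefreeᶠ x []            = 1ℚ
squarefreeᶠ x (inside ∷ I)  = x zero ℚ.* squarefreeᶠ (λ i → x (suc i)) I
squarefreeᶠ x (outside ∷ I) = squarefreeᶠ (λ i → x (suc i)) I

-- Stated for an arbitrary enumeration `c`, because the tails of the list of all indices are no
-- longer of that form.
∏ℚ-suc : ∀ {m n} (c : Fin m → Fin n) (x : Fin (suc n) → ℚ) b I →
  ∏ℚ (filter (_∈? (b ∷ I)) (tabulate (λ i → suc (c i)))) x ≡ ∏ℚ (filter (_∈? I) (tabulate c)) (λ i → x (suc i))
∏ℚ-suc {zero}  c x b I = refl
∏ℚ-suc {suc m} c x b I with does (c zero ∈? I)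
... | true  = cong (x (suc (c zero)) ℚ.*_) (∏ℚ-suc (λ i → c (suc i)) x b I)
... | false = ∏ℚ-suc (λ i → c (suc i)) x b I

∏ℚ-subset : ∀ {n} (x : Fin n → ℚ) (I : Subset n) → ∏ℚ (filter (_∈? I) (allFin n)) x ≡ squarefreeᶠ x I
∏ℚ-subset x []            = refl
∏ℚ-subset x (inside ∷ I)  = cong (x zero ℚ.*_)
  (trans (∏ℚ-suc (λ i → i) x inside I) (∏ℚ-subset (λ i → x (suc i)) I))
∏ℚ-subset x (outside ∷ I) = trans (∏ℚ-suc (λ i → i) x outside I) (∏ℚ-subset (λ i → x (suc i)) I)

-- A set of the wrong size has no bijection to the colours, so a sum over all words reduces to the
-- subsets of size r.
bijections-vanish : ∀ {m} f i j U (I : Subset m) → bijections f i j U I ≡ 0 ⊎ ∣ I ∣ ≡ length U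
bijections-vanish f i j []      []            = inj₂ refl
bijections-vanish f i j (u ∷ U) []            = inj₁ refl
bijections-vanish f i j U       (outside ∷ I) = bijections-vanish f i (suc j) U I
bijections-vanish f i j U       (inside ∷ I)  = terms (lengths U)
  where
  lengths : ∀ U → All (λ (v , V) → suc (length V) ≡ length U) (picks U)
  lengths []      = []
  lengths (u ∷ U) = refl ∷ extend (lengths U)
    where
    extend : ∀ {ps} → All (λ (v , V) → suc (length V) ≡ length U) ps →
             All (λ (v , V) → suc (length V) ≡ suc (length U)) (map (λ (y , ys) → y , u ∷ ys) ps)
    extend []         = []
    extend (eq ∷ eqs) = cong suc eq ∷ extend eqs
  terms : ∀ {ps} → All (λ (v , V) → suc (length V) ≡ length U) ps →
    sumList ps (λ (v , V) → isColour v (f i j) * bijections f i (suc j) V I) ≡ 0 ⊎ suc ∣ I ∣ ≡ length U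
  terms []                         = inj₁ refl
  terms {(v , V) ∷ ps} (len ∷ lens) with bijections-vanish f i (suc j) V I | terms lens
  ... | inj₂ eq | _        = inj₂ (trans (cong suc eq) len)
  ... | inj₁ _  | inj₂ eq  = inj₂ eq
  ... | inj₁ eq | inj₁ eq′ = inj₁ (cong₂ _+_ (trans (cong (isColour v (f i j) *_) eq) (*-zeroʳ (isColour v (f i j)))) eq′)

-- The polynomial identities rest on these four laws, so that no fraction is normalised in their
-- proofs.
module Embedding (ι : ℕ → ℚ) (ι0 : ι 0 ≡ 0ℚ) (ι1 : ι 1 ≡ 1ℚ)
                 (ι-+ : ∀ m n → ι (m + n) ≡ ι m ℚ.+ ι n) (ι-* : ∀ m n → ι (m * n) ≡ ι m ℚ.* ι n) where

  ι-^ : ∀ a n → ι (a ^ n) ≡ ι a ^ℚ n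
  ι-^ a zero    = ι1
  ι-^ a (suc n) = trans (ι-* a (a ^ n)) (cong (ι a ℚ.*_) (ι-^ a n))

  ι-sumList : ∀ {A : Set} (xs : List A) g → ι (sumList xs g) ≡ ∑ℚ xs (λ x → ι (g x))
  ι-sumList []       g = ι0
  ι-sumList (x ∷ xs) g = trans (ι-+ (g x) _) (cong (ι (g x) ℚ.+_) (ι-sumList xs g))

  ι-sumTo : ∀ n g → ι (sumTo n g) ≡ ∑ᶠ n (λ i → ι (g (toℕ i)))
  ι-sumTo zero    g = ι0
  ι-sumTo (suc n) g = trans (cong ι (sumTo-front n g))
    (trans (ι-+ (g 0) _) (cong (ι (g 0) ℚ.+_) (ι-sumTo n (λ i → g (suc i)))))

  -- The sum runs up to r for every t ≤ r because all entries of `words` come from one list; the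
  -- terms beyond t vanish with their binomial coefficient.
  binomial : ∀ (z y : ℚ) r t → t ≤ r → ∀ f → (∀ a → f a ≡ ι (binom t a) ℚ.* (z ^ℚ a ℚ.* y ^ℚ (t ∸ a))) →
             ∑ℚ (upTo (suc r)) f ≡ (z ℚ.+ y) ^ℚ t
  binomial z y r t t≤r f eq = trans (∑ℚ-cong (upTo (suc r)) eq) (expansion r t t≤r)
    where
    open ≡-Reasoning
    term : ℕ → ℕ → ℚ
    term t a = ι (binom t a) ℚ.* (z ^ℚ a ℚ.* y ^ℚ (t ∸ a))
    ∑ℚ-shift : ∀ n (g : ℕ → ℕ) (h : ℕ → ℚ) → ∑ℚ (applyUpTo g n) h ≡ ∑ℚ (upTo n) (λ a → h (g a))
    ∑ℚ-shift zero    g h = refl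
    ∑ℚ-shift (suc n) g h = cong (h (g 0) ℚ.+_)
      (trans (∑ℚ-shift n (λ a → g (suc a)) h) (sym (∑ℚ-shift n suc (λ a → h (g a)))))
    first : ∀ t → term t 0 ≡ y ^ℚ t
    first t = trans (cong₂ ℚ._*_ ι1 (ℚP.*-identityˡ (y ^ℚ t))) (ℚP.*-identityˡ (y ^ℚ t))
    lower : ∀ t a → ι (binom t (suc a)) ℚ.* (z ^ℚ suc a ℚ.* y ^ℚ (t ∸ a)) ≡ y ℚ.* term t (suc a)
    lower t a with suc a ≤? t
    ... | yes a<t = trans (cong (λ e → ι (binom t (suc a)) ℚ.* (z ^ℚ suc a ℚ.* y ^ℚ e)) (peel a<t))
        (rearrange (ι (binom t (suc a))) (z ^ℚ suc a) y (y ^ℚ (t ∸ suc a)))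
      where
      peel : ∀ {a t} → a < t → t ∸ a ≡ suc (t ∸ suc a)
      peel {zero}  {suc t} _         = refl
      peel {suc a} {suc t} (s≤s a<t) = peel a<t
      rearrange : ∀ a b c d → a ℚ.* (b ℚ.* (c ℚ.* d)) ≡ c ℚ.* (a ℚ.* (b ℚ.* d))
      rearrange = solve 4 (λ a b c d → a :* (b :* (c :* d)) := c :* (a :* (b :* d))) refl
        where open +-*-Solver
    ... | no a≮t = trans (zero-*ˡ zero≡)
        (sym (trans (cong (y ℚ.*_) (zero-*ˡ zero≡)) (ℚP.*-zeroʳ y)))
      where
      zero≡ : ι (binom t (suc a)) ≡ 0ℚ
      zero≡ = trans (cong ι (binom-zero (≰⇒> a≮t))) ι0
    split : ∀ t a → term (suc t) (suc a) ≡ z ℚ.* term t a ℚ.+ y ℚ.* term t (suc a)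
    split t a = begin
      ι (binom t a + binom t (suc a)) ℚ.* (z ℚ.* z ^ℚ a ℚ.* y ^ℚ (t ∸ a))
        ≡⟨ cong (ℚ._* (z ℚ.* z ^ℚ a ℚ.* y ^ℚ (t ∸ a))) (ι-+ (binom t a) (binom t (suc a))) ⟩
      (ι (binom t a) ℚ.+ ι (binom t (suc a))) ℚ.* (z ℚ.* z ^ℚ a ℚ.* y ^ℚ (t ∸ a))
        ≡⟨ rearrange (ι (binom t a)) (ι (binom t (suc a))) z (z ^ℚ a) (y ^ℚ (t ∸ a)) ⟩
      z ℚ.* term t a ℚ.+ ι (binom t (suc a)) ℚ.* (z ℚ.* z ^ℚ a ℚ.* y ^ℚ (t ∸ a))
        ≡⟨ cong (z ℚ.* term t a ℚ.+_) (lower t a) ⟩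
      z ℚ.* term t a ℚ.+ y ℚ.* term t (suc a) ∎
      where
      rearrange : ∀ a b z p q → (a ℚ.+ b) ℚ.* (z ℚ.* p ℚ.* q) ≡ z ℚ.* (a ℚ.* (p ℚ.* q)) ℚ.+ b ℚ.* (z ℚ.* p ℚ.* q)
      rearrange = solve 5 (λ a b z p q → (a :+ b) :* (z :* p :* q) := z :* (a :* (p :* q)) :+ b :* (z :* p :* q)) refl
        where open +-*-Solver
    expansion : ∀ r t → t ≤ r → ∑ℚ (upTo (suc r)) (term t) ≡ (z ℚ.+ y) ^ℚ t
    expansion r zero t≤r = begin
      term 0 0 ℚ.+ ∑ℚ (applyUpTo suc r) (term 0)   ≡⟨ cong₂ ℚ._+_ (first 0) (∑ℚ-shift r suc (term 0)) ⟩
      1ℚ ℚ.+ ∑ℚ (upTo r) (λ a → term 0 (suc a))    ≡⟨ cong (1ℚ ℚ.+_) (∑ℚ-zero (upTo r) (λ a →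
                                                        zero-*ˡ ι0)) ⟩
      1ℚ ℚ.+ 0ℚ                                    ≡⟨ ℚP.+-identityʳ 1ℚ ⟩
      1ℚ                                           ∎
    expansion (suc r) (suc t) (s≤s t≤r) = begin
      term (suc t) 0 ℚ.+ ∑ℚ (applyUpTo suc (suc r)) (term (suc t))
        ≡⟨ cong₂ ℚ._+_ (first (suc t)) (∑ℚ-shift (suc r) suc (term (suc t))) ⟩
      y ℚ.* y ^ℚ t ℚ.+ ∑ℚ (upTo (suc r)) (λ a → term (suc t) (suc a))
        ≡⟨ cong (y ℚ.* y ^ℚ t ℚ.+_) (trans (∑ℚ-cong (upTo (suc r)) (split t))
             (trans (∑ℚ-+ (upTo (suc r)) (λ a → z ℚ.* term t a) (λ a → y ℚ.* term t (suc a)))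
               (cong₂ ℚ._+_ (∑ℚ-*ˡ (upTo (suc r)) z (term t)) (∑ℚ-*ˡ (upTo (suc r)) y (λ a → term t (suc a)))))) ⟩
      y ℚ.* y ^ℚ t ℚ.+ (z ℚ.* ∑ℚ (upTo (suc r)) (term t) ℚ.+ y ℚ.* Y)
        ≡⟨ rearrange y (y ^ℚ t) (z ℚ.* ∑ℚ (upTo (suc r)) (term t)) Y ⟩
      z ℚ.* ∑ℚ (upTo (suc r)) (term t) ℚ.+ y ℚ.* (y ^ℚ t ℚ.+ Y)
        ≡⟨ cong₂ (λ a b → z ℚ.* a ℚ.+ y ℚ.* b) (expansion r t t≤r)
             (trans (cong₂ ℚ._+_ (sym (first t)) (sym (∑ℚ-shift (suc r) suc (term t)))) (expansion (suc r) t (m≤n⇒m≤1+n t≤r))) ⟩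
      z ℚ.* (z ℚ.+ y) ^ℚ t ℚ.+ y ℚ.* (z ℚ.+ y) ^ℚ t
        ≡⟨ ℚP.*-distribʳ-+ ((z ℚ.+ y) ^ℚ t) z y ⟨
      (z ℚ.+ y) ℚ.* (z ℚ.+ y) ^ℚ t ∎
      where
      Y : ℚ
      Y = ∑ℚ (upTo (suc r)) (λ a → term t (suc a))
      rearrange : ∀ a b c d → a ℚ.* b ℚ.+ (c ℚ.+ a ℚ.* d) ≡ c ℚ.+ a ℚ.* (b ℚ.+ d)
      rearrange = solve 4 (λ a b c d → a :* b :+ (c :+ a :* d) := c :+ a :* (b :+ d)) refl
        where open +-*-Solver

  -- The first variable is split off by the binomial theorem, and the remaining sum is expanded with
  -- the exponent t - a.
  multinomial-theorem : ∀ r t n (z : Fin n → ℚ) → t ≤ r → (∑ᶠ n z) ^ℚ t ≡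
    ∑ℚ (words (upTo (suc r)) n) (λ a → ι (multinomial t a) ℚ.* ∏ᶠ n (λ j → z j ^ℚ lookup a j))
  multinomial-theorem r zero    zero z t≤r = sym (trans (ℚP.+-identityʳ _) (trans (ℚP.*-identityʳ _) ι1))
  multinomial-theorem r (suc t) zero z t≤r = trans (zero-*ˡ {0ℚ} {0ℚ ^ℚ t} refl)
    (sym (trans (ℚP.+-identityʳ _) (trans (ℚP.*-identityʳ _) ι0)))
  multinomial-theorem r t (suc n) z t≤r = sym (trans
    (∑ℚ-product _∷_ (upTo (suc r)) (words (upTo (suc r)) n) _)
    (binomial (z zero) (∑ᶠ n z′) r t t≤r _ inner))
    where
    open ≡-Reasoning
    W : List (Vec ℕ n)
    W = words (upTo (suc r)) n
    z′ : Fin n → ℚ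
    z′ j = z (suc j)
    P : Vec ℕ n → ℚ
    P w = ∏ᶠ n (λ j → z′ j ^ℚ lookup w j)
    inner : ∀ a → ∑ℚ W (λ w → ι (binom t a * multinomial (t ∸ a) w) ℚ.* (z zero ^ℚ a ℚ.* P w)) ≡
                  ι (binom t a) ℚ.* (z zero ^ℚ a ℚ.* (∑ᶠ n z′) ^ℚ (t ∸ a))
    inner a = begin
      ∑ℚ W (λ w → ι (binom t a * multinomial (t ∸ a) w) ℚ.* (z zero ^ℚ a ℚ.* P w))
        ≡⟨ ∑ℚ-cong W (λ w → trans
             (cong (ℚ._* (z zero ^ℚ a ℚ.* P w)) (ι-* (binom t a) (multinomial (t ∸ a) w)))
             (rearrange (ι (binom t a)) (ι (multinomial (t ∸ a) w)) (z zero ^ℚ a) (P w))) ⟩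
      ∑ℚ W (λ w → (ι (binom t a) ℚ.* z zero ^ℚ a) ℚ.* (ι (multinomial (t ∸ a) w) ℚ.* P w))
        ≡⟨ ∑ℚ-*ˡ W (ι (binom t a) ℚ.* z zero ^ℚ a) _ ⟩
      (ι (binom t a) ℚ.* z zero ^ℚ a) ℚ.* ∑ℚ W (λ w → ι (multinomial (t ∸ a) w) ℚ.* P w)
        ≡⟨ cong ((ι (binom t a) ℚ.* z zero ^ℚ a) ℚ.*_)
             (multinomial-theorem r (t ∸ a) n z′ (≤-trans (m∸n≤m t a) t≤r)) ⟨
      (ι (binom t a) ℚ.* z zero ^ℚ a) ℚ.* (∑ᶠ n z′) ^ℚ (t ∸ a)
        ≡⟨ ℚP.*-assoc (ι (binom t a)) (z zero ^ℚ a) _ ⟩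
      ι (binom t a) ℚ.* (z zero ^ℚ a ℚ.* (∑ᶠ n z′) ^ℚ (t ∸ a)) ∎
      where
      rearrange : ∀ a b c d → (a ℚ.* b) ℚ.* (c ℚ.* d) ≡ (a ℚ.* c) ℚ.* (b ℚ.* d)
      rearrange = solve 4 (λ a b c d → (a :* b) :* (c :* d) := (a :* c) :* (b :* d)) refl
        where open +-*-Solver

  -- Column `j` has at most one colour, so the product is linear in the first variable. By
  -- `product-picks` the linear part removes that colour from `U` and gives the sets containing the
  -- column; the constant part gives the others.
  colour-product : ∀ (f : Colouring) i n j (x : Fin n → ℚ) U → Distinct U →
    ∏ℚ U (λ u → ∑ᶠ n (λ m → ι (isColour u (f i (j + toℕ m))) ℚ.* x m)) ≡
    ∑ℚ (words (inside ∷ outside ∷ []) n) (λ I → ι (bijections f i j U I) ℚ.* squarefreeᶠ x I)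
  colour-product f i zero j x [] dist = sym (trans (ℚP.+-identityʳ _) (trans (ℚP.*-identityʳ _) ι1))
  colour-product f i zero j x (u ∷ U) dist = trans (zero-*ˡ {0ℚ} {∏ℚ U (λ _ → 0ℚ)} refl)
    (sym (trans (ℚP.+-identityʳ _) (trans (ℚP.*-identityʳ _) ι0)))
  colour-product f i (suc n) j x U dist = begin
    ∏ℚ U (λ u → ι (isColour u (f i (j + 0))) ℚ.* x zero ℚ.+ ∑ᶠ n (λ m → ι (isColour u (f i (j + suc (toℕ m)))) ℚ.* x′ m))
      ≡⟨ ∏ℚ-cong U (λ u → cong₂ (λ c s → ι (isColour u (f i c)) ℚ.* x zero ℚ.+ s) (+-identityʳ j)
           (∑ᶠ-cong n (λ m → cong (λ c → ι (isColour u (f i c)) ℚ.* x′ m) (+-suc j (toℕ m))))) ⟩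
    ∏ℚ U (λ u → e u ℚ.* x zero ℚ.+ R u)
      ≡⟨ product-picks e R (x zero) orthogonal dist ⟩
    ∑ℚ (picks U) (λ (v , V) → (e v ℚ.* x zero) ℚ.* ∏ℚ V R) ℚ.+ ∏ℚ U R
      ≡⟨ cong₂ ℚ._+_ (∑ℚ-cong-All (λ { {v , V} dV → cong ((e v ℚ.* x zero) ℚ.*_)
           (colour-product f i n (suc j) x′ V dV) }) (picks-distinct dist)) (colour-product f i n (suc j) x′ U dist) ⟩
    ∑ℚ (picks U) (λ (v , V) → (e v ℚ.* x zero) ℚ.* ∑ℚ W (λ I → ι (bijections f i (suc j) V I) ℚ.* squarefreeᶠ x′ I))
      ℚ.+ outsides
      ≡⟨ cong (ℚ._+ outsides) (trans (∑ℚ-cong (picks U) (λ (v , V) → sym (∑ℚ-*ˡ W (e v ℚ.* x zero)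
                (λ I → ι (bijections f i (suc j) V I) ℚ.* squarefreeᶠ x′ I))))
           (trans (∑ℚ-swap (picks U) W term)
             (∑ℚ-cong W collect))) ⟩
    ∑ℚ W (λ I → ι (bijections f i j U (inside ∷ I)) ℚ.* squarefreeᶠ x (inside ∷ I)) ℚ.+ outsides
      ≡⟨ cong (∑ℚ W (λ I → ι (bijections f i j U (inside ∷ I)) ℚ.* squarefreeᶠ x (inside ∷ I)) ℚ.+_)
           (ℚP.+-identityʳ outsides) ⟨
    ∑ℚ W (λ I → ι (bijections f i j U (inside ∷ I)) ℚ.* squarefreeᶠ x (inside ∷ I)) ℚ.+ (outsides ℚ.+ 0ℚ)
      ≡⟨ ∑ℚ-product _∷_ (inside ∷ outside ∷ []) W (λ I → ι (bijections f i j U I) ℚ.* squarefreeᶠ x I) ⟨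
    ∑ℚ (words (inside ∷ outside ∷ []) (suc n)) (λ I → ι (bijections f i j U I) ℚ.* squarefreeᶠ x I) ∎
    where
    open ≡-Reasoning
    W : List (Subset n)
    W = words (inside ∷ outside ∷ []) n
    x′ : Fin n → ℚ
    x′ m = x (suc m)
    e R : ℕ → ℚ
    e u = ι (isColour u (f i j))
    R u = ∑ᶠ n (λ m → ι (isColour u (f i (suc j + toℕ m))) ℚ.* x′ m)
    outsides : ℚ
    outsides = ∑ℚ W (λ I → ι (bijections f i (suc j) U I) ℚ.* squarefreeᶠ x′ I)
    term : ℕ × List ℕ → Subset n → ℚ
    term (v , V) I = (e v ℚ.* x zero) ℚ.* (ι (bijections f i (suc j) V I) ℚ.* squarefreeᶠ x′ I)
    orthogonal : ∀ {u v} → u ≢ v → e u ℚ.* e v ≡ 0ℚ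
    orthogonal {u} {v} u≢v with f i j ≟ suc u
    ... | no  c≢   = zero-*ˡ (trans (cong ι (isColour-miss c≢)) ι0)
    ... | yes c≡ = trans (cong (e u ℚ.*_) (trans (cong ι (isColour-miss (λ c≡′ →
      u≢v (suc-injective (trans (sym c≡) c≡′))))) ι0)) (ℚP.*-zeroʳ (e u))
    collect : ∀ I → ∑ℚ (picks U) (λ (v , V) → (e v ℚ.* x zero) ℚ.* (ι (bijections f i (suc j) V I) ℚ.* squarefreeᶠ x′ I)) ≡
              ι (bijections f i j U (inside ∷ I)) ℚ.* squarefreeᶠ x (inside ∷ I)
    collect I = begin
      ∑ℚ (picks U) (λ (v , V) → (e v ℚ.* x zero) ℚ.* (ι (bijections f i (suc j) V I) ℚ.* squarefreeᶠ x′ I))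
        ≡⟨ ∑ℚ-cong (picks U) (λ (v , V) → trans
             (rearrange (e v) (x zero) (ι (bijections f i (suc j) V I)) (squarefreeᶠ x′ I))
             (cong (Z ℚ.*_) (sym (ι-* (isColour v (f i j)) (bijections f i (suc j) V I))))) ⟩
      ∑ℚ (picks U) (λ (v , V) → Z ℚ.* ι (isColour v (f i j) * bijections f i (suc j) V I))
        ≡⟨ ∑ℚ-*ˡ (picks U) Z _ ⟩
      Z ℚ.* ∑ℚ (picks U) (λ (v , V) → ι (isColour v (f i j) * bijections f i (suc j) V I))
        ≡⟨ cong (Z ℚ.*_) (ι-sumList (picks U) _) ⟨
      Z ℚ.* ι (bijections f i j U (inside ∷ I))
        ≡⟨ ℚP.*-comm Z _ ⟩
      ι (bijections f i j U (inside ∷ I)) ℚ.* Z ∎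
      where
      Z : ℚ
      Z = x zero ℚ.* squarefreeᶠ x′ I
      rearrange : ∀ a b c d → (a ℚ.* b) ℚ.* (c ℚ.* d) ≡ (b ℚ.* d) ℚ.* (a ℚ.* c)
      rearrange = solve 4 (λ a b c d → (a :* b) :* (c :* d) := (b :* d) :* (a :* c)) refl
        where open +-*-Solver

-- Natural numbers as rational numbers

-- Abstract, because unfolding a fraction with symbolic entries unfolds a gcd.
abstract

  frac : ℕ → ℕ → ℚ
  frac a d = ℤ.+ a ℚ./ suc d

  ι : ℕ → ℚ
  ι n = ℤ.+ n ℚ./ 1

  frac-def : ∀ a d → frac a d ≡ ℤ.+ a ℚ./ suc d
  frac-def a d = refl

  ι-def : ∀ n → ι n ≡ ℤ.+ n ℚ./ 1
  ι-def n = refl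

  ι0 : ι 0 ≡ 0ℚ
  ι0 = refl

  ι1 : ι 1 ≡ 1ℚ
  ι1 = refl

  toℚᵘ-frac : ∀ a d → ℚ.toℚᵘ (frac a d) ℚᵘ.≃ ℚᵘ.mkℚᵘ (ℤ.+ a) d
  toℚᵘ-frac a d = ℚP.toℚᵘ-fromℚᵘ (ℚᵘ.mkℚᵘ (ℤ.+ a) d)

  toℚᵘ-ι : ∀ n → ℚ.toℚᵘ (ι n) ℚᵘ.≃ ℚᵘ.mkℚᵘ (ℤ.+ n) 0
  toℚᵘ-ι n = ℚP.toℚᵘ-fromℚᵘ (ℚᵘ.mkℚᵘ (ℤ.+ n) 0)

  frac-mono : ∀ a b c d → a * suc d ≤ c * suc b → frac a b ℚ.≤ frac c d
  frac-mono a b c d = LnCauchy./-mono a (suc b) c (suc d)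

ι-+ : ∀ m n → ι (m + n) ≡ ι m ℚ.+ ι n
ι-+ m n = sym (ℚP.toℚᵘ-injective
  (ℚᵘP.≃-trans (ℚP.toℚᵘ-homo-+ (ι m) (ι n))
  (ℚᵘP.≃-trans (ℚᵘP.+-cong (toℚᵘ-ι m) (toℚᵘ-ι n))
  (ℚᵘP.≃-trans (ℚᵘ.*≡* (cong (ℤ._* ℤ.+ 1) (cong₂ ℤ._+_ (ℤP.*-identityʳ (ℤ.+ m)) (ℤP.*-identityʳ (ℤ.+ n)))))
  (ℚᵘP.≃-sym (toℚᵘ-ι (m + n)))))))

frac-* : ∀ a c d → frac a d ℚ.* ι c ≡ frac (a * c) d
frac-* a c d = ℚP.toℚᵘ-injective
  (ℚᵘP.≃-trans (ℚP.toℚᵘ-homo-* (frac a d) (ι c))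
  (ℚᵘP.≃-trans (ℚᵘP.*-cong (toℚᵘ-frac a d) (toℚᵘ-ι c))
  (ℚᵘP.≃-trans (ℚᵘ.*≡* (cong₂ ℤ._*_ (sym (ℤP.pos-* a c)) (cong ℤ.+_ (sym (*-identityʳ (suc d))))))
  (ℚᵘP.≃-sym (toℚᵘ-frac (a * c) d)))))

frac-ι : ∀ n → frac n 0 ≡ ι n
frac-ι n = ℚP.toℚᵘ-injective (ℚᵘP.≃-trans (toℚᵘ-frac n 0) (ℚᵘP.≃-sym (toℚᵘ-ι n)))

ι-* : ∀ m n → ι (m * n) ≡ ι m ℚ.* ι n
ι-* m n = trans (sym (frac-ι (m * n))) (trans (sym (frac-* m n 0)) (cong (ℚ._* ι n) (frac-ι m)))

frac-≤-ι : ∀ a d c → a ≤ c * suc d → frac a d ℚ.≤ ι c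
frac-≤-ι a d c le = subst (frac a d ℚ.≤_) (frac-ι c) (frac-mono a d c 0 (≤-trans (≤-reflexive (*-identityʳ a)) le))

ι-≤-frac : ∀ c a d → c * suc d ≤ a → ι c ℚ.≤ frac a d
ι-≤-frac c a d le =
  subst (ℚ._≤ frac a d) (frac-ι c) (frac-mono c 0 a d (≤-trans le (≤-reflexive (sym (*-identityʳ a)))))

ι-mono : ∀ {m n} → m ≤ n → ι m ℚ.≤ ι n
ι-mono {m} {n} m≤n = subst (ℚ._≤ ι n) (frac-ι m) (frac-≤-ι m 0 n (≤-trans m≤n (≤-reflexive (sym (*-identityʳ n)))))

frac-cancel : ∀ a d → frac a d ℚ.* ι (suc d) ≡ ι a
frac-cancel a d = trans (frac-* a (suc d) d)
  (ℚP.≤-antisym (frac-≤-ι (a * suc d) d a ≤-refl) (ι-≤-frac a (a * suc d) d ≤-refl))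

0≤ι : ∀ n → 0ℚ ℚ.≤ ι n
0≤ι n = subst (ℚ._≤ ι n) ι0 (ι-mono z≤n)

ι-suc : ∀ n → ι (suc n) ≡ 1ℚ ℚ.+ ι n
ι-suc n = trans (ι-+ 1 n) (cong (ℚ._+ ι n) ι1)

ι-nonNeg : ∀ n → ℚ.NonNegative (ι n)
ι-nonNeg n = ℚ.nonNegative (0≤ι n)

ι-pos : ∀ n .{{_ : NonZero n}} → ℚ.Positive (ι n)
ι-pos (suc n) = ℚ.positive (ℚP.<-≤-trans (ℚP.positive⁻¹ 1ℚ) (subst (ℚ._≤ ι (suc n)) ι1 (ι-mono (s≤s z≤n))))

ι-cancel-≤ : ∀ {m n} → ι m ℚ.≤ ι n → m ≤ n
ι-cancel-≤ {m} {n} le with m ≤? n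
... | yes m≤n = m≤n
... | no  m≰n = ⊥-elim (ℚP.<-irrefl refl (ℚP.<-≤-trans smaller (ℚP.≤-trans (ι-mono (≰⇒> m≰n)) le)))
  where
  smaller : ι n ℚ.< ι (suc n)
  smaller = subst₂ ℚ._<_ (ℚP.+-identityˡ (ι n)) (sym (ι-suc n)) (ℚP.+-monoˡ-< (ι n) (ℚP.positive⁻¹ 1ℚ))

+ℚ-cancelʳ-≤ : ∀ r {p q} → p ℚ.+ r ℚ.≤ q ℚ.+ r → p ℚ.≤ q
+ℚ-cancelʳ-≤ r {p} {q} le = subst₂ ℚ._≤_ (cancel p r) (cancel q r) (ℚP.+-monoˡ-≤ (ℚ.- r) le)
  where
  cancel : ∀ a b → a ℚ.+ b ℚ.- b ≡ a
  cancel = solve 2 (λ a b → a :+ b :- b := a) refl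
    where open +-*-Solver

*-mono-≤-nonNeg : ∀ {a b c d} → 0ℚ ℚ.≤ c → 0ℚ ℚ.≤ b → a ℚ.≤ b → c ℚ.≤ d → a ℚ.* c ℚ.≤ b ℚ.* d
*-mono-≤-nonNeg {a} {b} {c} {d} 0≤c 0≤b a≤b c≤d = ℚP.≤-trans
  (ℚP.*-monoʳ-≤-nonNeg c {{ℚ.nonNegative 0≤c}} a≤b)
  (ℚP.*-monoˡ-≤-nonNeg b {{ℚ.nonNegative 0≤b}} c≤d)

^ℚ-nonNeg : ∀ {a} n → 0ℚ ℚ.≤ a → 0ℚ ℚ.≤ a ^ℚ n
^ℚ-nonNeg zero    0≤a = ℚP.nonNegative⁻¹ 1ℚ
^ℚ-nonNeg {a} (suc n) 0≤a = subst (ℚ._≤ a ℚ.* a ^ℚ n) (ℚP.*-zeroˡ 0ℚ)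
  (*-mono-≤-nonNeg ℚP.≤-refl 0≤a 0≤a (^ℚ-nonNeg n 0≤a))

^ℚ-mono : ∀ {a b} n → 0ℚ ℚ.≤ a → a ℚ.≤ b → a ^ℚ n ℚ.≤ b ^ℚ n
^ℚ-mono zero    0≤a a≤b = ℚP.≤-refl
^ℚ-mono (suc n) 0≤a a≤b =
  *-mono-≤-nonNeg (^ℚ-nonNeg n 0≤a) (ℚP.≤-trans 0≤a a≤b) a≤b (^ℚ-mono n 0≤a a≤b)

p≤∣p∣ : ∀ p → p ℚ.≤ ℚ.∣ p ∣
p≤∣p∣ p with ℚP.∣p∣≡p∨∣p∣≡-p p
... | inj₁ eq = ℚP.≤-reflexive (sym eq)
... | inj₂ eq with ℚP.≤-total p 0ℚ
...   | inj₁ p≤0 = ℚP.≤-trans p≤0 (ℚP.0≤∣p∣ p)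
...   | inj₂ 0≤p = ℚP.≤-reflexive (sym (ℚP.0≤p⇒∣p∣≡p 0≤p))

∣^ℚ∣ : ∀ a n → ℚ.∣ a ^ℚ n ∣ ≡ ℚ.∣ a ∣ ^ℚ n
∣^ℚ∣ a zero    = refl
∣^ℚ∣ a (suc n) = trans (ℚP.∣p*q∣≡∣p∣*∣q∣ a (a ^ℚ n)) (cong (ℚ.∣ a ∣ ℚ.*_) (∣^ℚ∣ a n))

-- Real numbers given pointwise

seq-^ : ∀ x n m → seq (x ^ᴿ n) m ≡ seq x m ^ℚ n
seq-^ x zero    m = refl
seq-^ x (suc n) m = cong (seq x m ℚ.*_) (seq-^ x n m)

-- Sums and products of reals act index by index, so an identity between polynomials need only be
-- proved over the rationals.
pointwise-≃ : ∀ {x y} → (∀ m → seq x m ≡ seq y m) → x ≃ᴿ y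
pointwise-≃ {x} {y} eq δ 0<δ = 0 , λ m _ → subst (ℚ._≤ δ) (sym (cong ℚ.∣_∣
  (trans (cong (ℚ._- seq y m) (eq m)) (ℚP.+-inverseʳ (seq y m))))) (ℚP.<⇒≤ 0<δ)

eventually-≤ : ∀ {x y} → ∃[ N ] (∀ m → N ≤ m → seq x m ℚ.≤ seq y m) → x ≤ᴿ y
eventually-≤ {x} {y} (N , le) δ 0<δ = N , λ m m≥ → ℚP.≤-trans (le m m≥)
  (subst (ℚ._≤ seq y m ℚ.+ δ) (ℚP.+-identityʳ (seq y m)) (ℚP.+-monoʳ-≤ (seq y m) (ℚP.<⇒≤ 0<δ)))

-- The interval from X/Y to (X + 1)/Y eventually lies between |1 - ε| and 1 + ε.
record Window (ε : ℝ) (X Y : ℕ) : Set where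
  field
    Y≢0   : NonZero Y
    from : ℕ
    below : ∀ m → from ≤ m → ℚ.∣ 1ℚ ℚ.- seq ε m ∣ ℚ.* ι Y ℚ.≤ ι X
    above : ∀ m → from ≤ m → ι (suc X) ℚ.≤ (1ℚ ℚ.+ seq ε m) ℚ.* ι Y

frac-pos : ∀ d → 0ℚ ℚ.< frac 1 d
frac-pos d = subst (0ℚ ℚ.<_) (sym (frac-def 1 d)) (ℚP.positive⁻¹ (ℤ.+ 1 ℚ./ suc d) {{ℚP.normalize-pos 1 (suc d)}})

floor : ∀ p → 0ℚ ℚ.≤ p → ∃[ F ] (ι F ℚ.≤ p × p ℚ.≤ ι (suc F))
floor p@(ℚ.mkℚ (ℤ.+ a) d _) 0≤p = F ,
  subst (ι F ℚ.≤_) p≡ (ι-≤-frac F a d (m/n*n≤m a (suc d))) ,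
  subst (ℚ._≤ ι (suc F)) p≡ (frac-≤-ι a d (suc F) (begin
    a                             ≡⟨ m≡m%n+[m/n]*n a (suc d) ⟩
    a % suc d + F * suc d  ≤⟨ +-monoˡ-≤ (F * suc d) (<⇒≤ (m%n<n a (suc d))) ⟩
    suc d + F * suc d             ∎))
  where
  open ≤-Reasoning
  F : ℕ
  F = a / suc d
  p≡ : frac a d ≡ p
  p≡ = trans (frac-def a d) (ℚP.↥p/↧p≡p p)
floor (ℚ.mkℚ ℤ.-[1+ _ ] d _) (ℚ.*≤* ())

-- `Y` is chosen so large that Yε ≥ 3 eventually, and the index M so late that ε varies by at most
-- 1/Y. If F is the floor of Yε at M, then F - 1 ≤ Yε ≤ F + 2 from M on, and X = Y + F - 2 fits. In
-- the code F is written as a double successor, which 3 ≤ F + 1 justifies.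
window : ∀ ε → 0ᴿ <ᴿ ε → ∃[ X ] ∃[ Y ] Window ε X Y
window ε (δ , 0<δ , N , pos) with LnCauchy.archimedean δ 0<δ
... | N₁ , 1/N₁≤δ with cauchy ε (frac 1 (2 + 3 * N₁)) (frac-pos (2 + 3 * N₁))
... | c = found (floor (e ℚ.* ι Y) 0≤eY)
  where
  open ℚP.≤-Reasoning
  Y M : ℕ
  Y = 3 + 3 * N₁
  M = N ⊔ proj₁ c
  e : ℚ
  e = seq ε M
  3≤δY : ι 3 ℚ.≤ δ ℚ.* ι Y
  3≤δY = begin
    ι 3                                          ≡⟨ ℚP.*-identityˡ (ι 3) ⟨
    1ℚ ℚ.* ι 3                                   ≡⟨ cong (ℚ._* ι 3) (trans (frac-cancel 1 N₁) ι1) ⟨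
    (frac 1 N₁ ℚ.* ι (suc N₁)) ℚ.* ι 3           ≡⟨ ℚP.*-assoc (frac 1 N₁) (ι (suc N₁)) (ι 3) ⟩
    frac 1 N₁ ℚ.* (ι (suc N₁) ℚ.* ι 3)           ≡⟨ cong (frac 1 N₁ ℚ.*_) (trans (sym (ι-* (suc N₁) 3)) (cong ι (*-comm (suc N₁) 3))) ⟩
    frac 1 N₁ ℚ.* ι (3 * suc N₁)                 ≡⟨ cong (λ y → frac 1 N₁ ℚ.* ι y) (*-suc 3 N₁) ⟩
    frac 1 N₁ ℚ.* ι Y                            ≤⟨ ℚP.*-monoʳ-≤-nonNeg (ι Y) {{ι-nonNeg Y}}
                                                     (subst (ℚ._≤ δ) (sym (frac-def 1 N₁)) 1/N₁≤δ) ⟩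
    δ ℚ.* ι Y                                    ∎
  δ≤e : δ ℚ.≤ e
  δ≤e = subst (ℚ._≤ e) (ℚP.+-identityˡ δ) (pos M (m≤m⊔n N (proj₁ c)))
  3≤eY : ι 3 ℚ.≤ e ℚ.* ι Y
  3≤eY = ℚP.≤-trans 3≤δY (ℚP.*-monoʳ-≤-nonNeg (ι Y) {{ι-nonNeg Y}} δ≤e)
  0≤eY : 0ℚ ℚ.≤ e ℚ.* ι Y
  0≤eY = ℚP.≤-trans (0≤ι 3) 3≤eY
  close : ∀ a b → ℚ.∣ a ℚ.- b ∣ ℚ.≤ frac 1 (2 + 3 * N₁) → a ℚ.* ι Y ℚ.≤ b ℚ.* ι Y ℚ.+ 1ℚ
  close a b le = begin
    a ℚ.* ι Y                            ≡⟨ split a b (ι Y) ⟩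
    b ℚ.* ι Y ℚ.+ (a ℚ.- b) ℚ.* ι Y      ≤⟨ ℚP.+-monoʳ-≤ (b ℚ.* ι Y) (ℚP.*-monoʳ-≤-nonNeg (ι Y) {{ι-nonNeg Y}}
                                             (ℚP.≤-trans (p≤∣p∣ (a ℚ.- b)) le)) ⟩
    b ℚ.* ι Y ℚ.+ frac 1 (2 + 3 * N₁) ℚ.* ι Y   ≡⟨ cong (b ℚ.* ι Y ℚ.+_) (trans (frac-cancel 1 (2 + 3 * N₁)) ι1) ⟩
    b ℚ.* ι Y ℚ.+ 1ℚ                     ∎
    where
    split : ∀ a b y → a ℚ.* y ≡ b ℚ.* y ℚ.+ (a ℚ.- b) ℚ.* y
    split = solve 3 (λ a b y → a :* y := b :* y :+ (a :- b) :* y) refl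
      where open +-*-Solver
  found : ∃[ F ] (ι F ℚ.≤ e ℚ.* ι Y × e ℚ.* ι Y ℚ.≤ ι (suc F)) → ∃[ X ] ∃[ Y ] Window ε X Y
  found (F , F≤ , ≤F) with ι-cancel-≤ {3} {suc F} (ℚP.≤-trans 3≤eY ≤F)
  found (suc (suc F) , F≤ , ≤F) | _ = Y + F , Y , record
    { Y≢0 = _ ; from = M ; below = below ; above = above }
    where
    lower : ∀ m → M ≤ m → ι (suc F) ℚ.≤ seq ε m ℚ.* ι Y
    lower m m≥ = +ℚ-cancelʳ-≤ 1ℚ (begin
      ι (suc F) ℚ.+ 1ℚ              ≡⟨ ℚP.+-comm (ι (suc F)) 1ℚ ⟩
      1ℚ ℚ.+ ι (suc F)              ≡⟨ ι-suc (suc F) ⟨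
      ι (suc (suc F))               ≤⟨ F≤ ⟩
      e ℚ.* ι Y                     ≤⟨ close e (seq ε m) (proj₂ c M m (m≤n⊔m N _) (≤-trans (m≤n⊔m N _) m≥)) ⟩
      seq ε m ℚ.* ι Y ℚ.+ 1ℚ        ∎)
    upper : ∀ m → M ≤ m → seq ε m ℚ.* ι Y ℚ.≤ ι (4 + F)
    upper m m≥ = begin
      seq ε m ℚ.* ι Y               ≤⟨ close (seq ε m) e (proj₂ c m M (≤-trans (m≤n⊔m N _) m≥) (m≤n⊔m N _)) ⟩
      e ℚ.* ι Y ℚ.+ 1ℚ              ≤⟨ ℚP.+-monoˡ-≤ 1ℚ ≤F ⟩
      ι (3 + F) ℚ.+ 1ℚ              ≡⟨ trans (ℚP.+-comm (ι (3 + F)) 1ℚ) (sym (ι-suc (3 + F))) ⟩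
      ι (4 + F)                     ∎
    above : ∀ m → M ≤ m → ι (suc (Y + F)) ℚ.≤ (1ℚ ℚ.+ seq ε m) ℚ.* ι Y
    above m m≥ = begin
      ι (suc (Y + F))               ≡⟨ cong ι (sym (+-suc Y F)) ⟩
      ι (Y + suc F)                 ≡⟨ ι-+ Y (suc F) ⟩
      ι Y ℚ.+ ι (suc F)             ≤⟨ ℚP.+-monoʳ-≤ (ι Y) (lower m m≥) ⟩
      ι Y ℚ.+ seq ε m ℚ.* ι Y       ≡⟨ collect (ι Y) (seq ε m) ⟩
      (1ℚ ℚ.+ seq ε m) ℚ.* ι Y      ∎
      where
      collect : ∀ y e → y ℚ.+ e ℚ.* y ≡ (1ℚ ℚ.+ e) ℚ.* y
      collect = solve 2 (λ y e → y :+ e :* y := (con 1ℚ :+ e) :* y) refl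
        where open +-*-Solver
    below : ∀ m → M ≤ m → ℚ.∣ 1ℚ ℚ.- seq ε m ∣ ℚ.* ι Y ℚ.≤ ι (Y + F)
    below m m≥ with ℚP.∣p∣≡p∨∣p∣≡-p (1ℚ ℚ.- seq ε m)
    ... | inj₁ eq = begin
      ℚ.∣ 1ℚ ℚ.- seq ε m ∣ ℚ.* ι Y  ≡⟨ cong (ℚ._* ι Y) eq ⟩
      (1ℚ ℚ.- seq ε m) ℚ.* ι Y      ≡⟨ expand (ι Y) (seq ε m) ⟩
      ι Y ℚ.- seq ε m ℚ.* ι Y       ≤⟨ ℚP.+-monoʳ-≤ (ι Y) (ℚP.neg-antimono-≤ (ℚP.≤-trans (0≤ι (suc F)) (lower m m≥))) ⟩
      ι Y ℚ.+ 0ℚ                    ≡⟨ ℚP.+-identityʳ (ι Y) ⟩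
      ι Y                           ≤⟨ ι-mono (m≤m+n Y F) ⟩
      ι (Y + F)                     ∎
      where
      expand : ∀ y e → (1ℚ ℚ.- e) ℚ.* y ≡ y ℚ.- e ℚ.* y
      expand = solve 2 (λ y e → (con 1ℚ :- e) :* y := y :- e :* y) refl
        where open +-*-Solver
    ... | inj₂ eq = begin
      ℚ.∣ 1ℚ ℚ.- seq ε m ∣ ℚ.* ι Y  ≡⟨ cong (ℚ._* ι Y) eq ⟩
      ℚ.- (1ℚ ℚ.- seq ε m) ℚ.* ι Y  ≡⟨ expand (ι Y) (seq ε m) ⟩
      seq ε m ℚ.* ι Y ℚ.- ι Y       ≤⟨ ℚP.+-monoˡ-≤ (ℚ.- ι Y) (upper m m≥) ⟩
      ι (4 + F) ℚ.- ι Y             ≤⟨ ℚP.+-monoˡ-≤ (ℚ.- ι Y) (ι-mono 4+F≤) ⟩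
      ι (Y + F + Y) ℚ.- ι Y         ≡⟨ cong (ℚ._- ι Y) (ι-+ (Y + F) Y) ⟩
      ι (Y + F) ℚ.+ ι Y ℚ.- ι Y     ≡⟨ cancel (ι (Y + F)) (ι Y) ⟩
      ι (Y + F)                     ∎
      where
      expand : ∀ y e → ℚ.- (1ℚ ℚ.- e) ℚ.* y ≡ e ℚ.* y ℚ.- y
      expand = solve 2 (λ y e → :- (con 1ℚ :- e) :* y := e :* y :- y) refl
        where open +-*-Solver
      cancel : ∀ a b → a ℚ.+ b ℚ.- b ≡ a
      cancel = solve 2 (λ a b → a :+ b :- b := a) refl
        where open +-*-Solver
      3≤Y : 3 ≤ Y
      3≤Y = m≤m+n 3 (3 * N₁)
      4+F≤ : 4 + F ≤ Y + F + Y
      4+F≤ = ≤-trans (≤-reflexive (rearrange F))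
        (+-mono-≤ (+-monoˡ-≤ F (≤-trans (n≤1+n 2) 3≤Y)) (≤-trans (n≤1+n 2) 3≤Y))
        where
        rearrange : ∀ F → 4 + F ≡ 2 + F + 2
        rearrange = solve-∀
  found (zero , F≤ , ≤F)        | s≤s ()
  found (suc zero , F≤ , ≤F)    | s≤s (s≤s ())

-- 1 - ε may be negative, and an even power would then lose its sign; the lower bound therefore
-- passes through |1 - ε|. Everything is compared after multiplication by Y^r.
window-≤ : ∀ {ε X Y} r h → Window ε X Y →
  ι X ^ℚ r ℚ.≤ h ℚ.* ι Y ^ℚ r → h ℚ.* ι Y ^ℚ r ℚ.≤ ι (suc X) ^ℚ r →
  (1ᴿ -ᴿ ε) ^ᴿ r ≤ᴿ fromℚ h × fromℚ h ≤ᴿ (1ᴿ +ᴿ ε) ^ᴿ r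
window-≤ {ε} {X} {Y} r h win lower upper =
  eventually-≤ {(1ᴿ -ᴿ ε) ^ᴿ r} {fromℚ h} (from , λ m m≥ →
    ℚP.≤-trans (ℚP.≤-reflexive (seq-^ (1ᴿ -ᴿ ε) r m)) (cancel (begin
      (1ℚ ℚ.- seq ε m) ^ℚ r ℚ.* ι Y ^ℚ r
        ≤⟨ ℚP.*-monoʳ-≤-nonNeg (ι Y ^ℚ r) {{ℚ.nonNegative (^ℚ-nonNeg r (0≤ι Y))}}
             (ℚP.≤-trans (p≤∣p∣ ((1ℚ ℚ.- seq ε m) ^ℚ r)) (ℚP.≤-reflexive (∣^ℚ∣ (1ℚ ℚ.- seq ε m) r))) ⟩
      ℚ.∣ 1ℚ ℚ.- seq ε m ∣ ^ℚ r ℚ.* ι Y ^ℚ r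
        ≡⟨ ^ℚ-distrib-* ℚ.∣ 1ℚ ℚ.- seq ε m ∣ (ι Y) r ⟨
      (ℚ.∣ 1ℚ ℚ.- seq ε m ∣ ℚ.* ι Y) ^ℚ r
        ≤⟨ ^ℚ-mono r (subst (ℚ._≤ ℚ.∣ 1ℚ ℚ.- seq ε m ∣ ℚ.* ι Y) (ℚP.*-zeroˡ (ι Y))
             (ℚP.*-monoʳ-≤-nonNeg (ι Y) {{ι-nonNeg Y}} (ℚP.0≤∣p∣ (1ℚ ℚ.- seq ε m)))) (below m m≥) ⟩
      ι X ^ℚ r
        ≤⟨ lower ⟩
      h ℚ.* ι Y ^ℚ r ∎))) ,
  eventually-≤ {fromℚ h} {(1ᴿ +ᴿ ε) ^ᴿ r} (from , λ m m≥ →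
    ℚP.≤-trans (cancel (begin
      h ℚ.* ι Y ^ℚ r
        ≤⟨ upper ⟩
      ι (suc X) ^ℚ r
        ≤⟨ ^ℚ-mono r (0≤ι (suc X)) (above m m≥) ⟩
      ((1ℚ ℚ.+ seq ε m) ℚ.* ι Y) ^ℚ r
        ≡⟨ ^ℚ-distrib-* (1ℚ ℚ.+ seq ε m) (ι Y) r ⟩
      (1ℚ ℚ.+ seq ε m) ^ℚ r ℚ.* ι Y ^ℚ r ∎)) (ℚP.≤-reflexive (sym (seq-^ (1ᴿ +ᴿ ε) r m))))
  where
  open Window win
  open ℚP.≤-Reasoning
  ^ℚ-pos : ∀ n → ℚ.Positive (ι Y ^ℚ n)
  ^ℚ-pos zero    = _
  ^ℚ-pos (suc n) = ℚP.pos*pos⇒pos (ι Y) {{ι-pos Y {{Y≢0}}}} (ι Y ^ℚ n) {{^ℚ-pos n}}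
  cancel : ∀ {a b} → a ℚ.* ι Y ^ℚ r ℚ.≤ b ℚ.* ι Y ^ℚ r → a ℚ.≤ b
  cancel = ℚP.*-cancelʳ-≤-pos (ι Y ^ℚ r) {{^ℚ-pos r}}

-- The natural logarithm

-- The number (2^s - 1) a of integers from a + 1 to 2^s a, arranged in s blocks, each twice as long
-- as the one before.
dyadic : ℕ → ℕ → ℕ
dyadic zero    a = 0
dyadic (suc s) a = a + dyadic s (a + a)

dyadic-length : ∀ s a → dyadic s a + a ≡ 2 ^ s * a
dyadic-length zero    a = sym (+-identityʳ a)
dyadic-length (suc s) a = begin
  a + dyadic s (a + a) + a      ≡⟨ rearrange a (dyadic s (a + a)) ⟩
  dyadic s (a + a) + (a + a)    ≡⟨ dyadic-length s (a + a) ⟩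
  2 ^ s * (a + a)               ≡⟨ rearrange′ (2 ^ s) a ⟩
  2 ^ suc s * a                 ∎
  where
  open ≡-Reasoning
  rearrange : ∀ a b → a + b + a ≡ b + (a + a)
  rearrange = solve-∀
  rearrange′ : ∀ p a → p * (a + a) ≡ 2 * p * a
  rearrange′ = solve-∀

-- The classical argument for the harmonic series: the a reciprocals from 1/(a + 1) to 1/(2a) have a
-- sum of at least 1/2. In the limit it says s ≤ 2 ln 2^s.
recipSum-dyadic : ∀ s a .{{_ : NonZero a}} → ι s ℚ.≤ ι 2 ℚ.* recipSum a (dyadic s a)
recipSum-dyadic zero    a = ℚP.≤-reflexive (trans ι0 (sym (ℚP.*-zeroʳ (ι 2))))
recipSum-dyadic (suc s) a@(suc a-1) = begin
  ι (suc s)                                             ≡⟨ ι-suc s ⟩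
  1ℚ ℚ.+ ι s                                            ≡⟨ cong (λ z → z ℚ.* ℚ.½ ℚ.+ ι s) (ι-def 2) ⟨
  ι 2 ℚ.* ℚ.½ ℚ.+ ι s                                   ≤⟨ ℚP.+-mono-≤ (ℚP.*-monoˡ-≤-nonNeg (ι 2) {{ι-nonNeg 2}} half) (recipSum-dyadic s (a + a)) ⟩
  ι 2 ℚ.* recipSum a a ℚ.+ ι 2 ℚ.* recipSum (a + a) (dyadic s (a + a))
    ≡⟨ ℚP.*-distribˡ-+ (ι 2) (recipSum a a) (recipSum (a + a) (dyadic s (a + a))) ⟨
  ι 2 ℚ.* (recipSum a a ℚ.+ recipSum (a + a) (dyadic s (a + a)))
    ≡⟨ cong (ι 2 ℚ.*_) (LnCauchy.recipSum-++ a a (dyadic s (a + a))) ⟨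
  ι 2 ℚ.* recipSum a (dyadic (suc s) a)                 ∎
  where
  open ℚP.≤-Reasoning
  half : ℚ.½ ℚ.≤ recipSum a a
  half = ℚP.≤-trans (LnCauchy./-mono 1 2 a (a + a) (≤-reflexive (rearrange a)))
                    (LnCauchy.recipSum-lower a a (a + a) ≤-refl)
    where
    rearrange : ∀ a → 1 * (a + a) ≡ a * 2
    rearrange = solve-∀

recipSum-mono : ∀ a {l l′} → l ≤ l′ → recipSum a l ℚ.≤ recipSum a l′
recipSum-mono a {l} {zero}   z≤n = ℚP.≤-refl
recipSum-mono a {l} {suc l′} l≤ with m≤n⇒m<n∨m≡n l≤
... | inj₂ refl = ℚP.≤-refl
... | inj₁ l<   = ℚP.≤-trans (recipSum-mono a (s≤s⁻¹ l<)) (LnCauchy.recipSum-snoc a l′)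

lnSeq-lower : ∀ n s m → 2 ^ s ≤ n → ι s ℚ.≤ ι 2 ℚ.* lnSeq n m
lnSeq-lower n s m 2^s≤n = ℚP.≤-trans (recipSum-dyadic s (suc m))
  (ℚP.*-monoˡ-≤-nonNeg (ι 2) {{ι-nonNeg 2}} (recipSum-mono (suc m) (begin
    dyadic s (suc m)                   ≡⟨ m+n∸n≡m _ (suc m) ⟨
    dyadic s (suc m) + suc m ∸ suc m   ≡⟨ cong (_∸ suc m) (dyadic-length s (suc m)) ⟩
    2 ^ s * suc m ∸ suc m              ≤⟨ ∸-monoˡ-≤ (suc m) (*-monoˡ-≤ (suc m) 2^s≤n) ⟩
    n * suc m ∸ suc m                  ≡⟨ cong (n * suc m ∸_) (*-identityˡ (suc m)) ⟨
    n * suc m ∸ 1 * suc m              ≡⟨ *-distribʳ-∸ (suc m) n 1 ⟨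
    (n ∸ 1) * suc m                    ∎)))
  where open ≤-Reasoning

fromℕ-≤-ln : ∀ n s k c → 2 ^ s ≤ n → k ≤ c * s → fromℕ k ≤ᴿ fromℕ (c * 2) *ᴿ ln n
fromℕ-≤-ln n s k c 2^s≤n k≤ = eventually-≤ {fromℕ k} {fromℕ (c * 2) *ᴿ ln n} (0 , λ m _ → begin
  ℤ.+ k ℚ./ 1                         ≡⟨ ι-def k ⟨
  ι k                               ≤⟨ ι-mono k≤ ⟩
  ι (c * s)                         ≡⟨ ι-* c s ⟩
  ι c ℚ.* ι s                       ≤⟨ ℚP.*-monoˡ-≤-nonNeg (ι c) {{ι-nonNeg c}} (lnSeq-lower n s m 2^s≤n) ⟩
  ι c ℚ.* (ι 2 ℚ.* lnSeq n m)       ≡⟨ ℚP.*-assoc (ι c) (ι 2) (lnSeq n m) ⟨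
  ι c ℚ.* ι 2 ℚ.* lnSeq n m         ≡⟨ cong (ℚ._* lnSeq n m) (ι-* c 2) ⟨
  ι (c * 2) ℚ.* lnSeq n m           ≡⟨ cong (ℚ._* lnSeq n m) (ι-def (c * 2)) ⟩
  (ℤ.+ (c * 2) ℚ./ 1) ℚ.* lnSeq n m   ∎)
  where open ℚP.≤-Reasoning

open Embedding ι ι0 ι1 ι-+ ι-*

-- The constants of the construction

module Scheme (r′ q X Y β b₀ ρ₀ ρ₁ : ℕ)
  {{q≢0 : NonZero q}} {{Y≢0 : NonZero Y}} {{b₀≢0 : NonZero b₀}} {{ρ₁≢0 : NonZero ρ₁}}
  (ratio : (2 * X + 1) * (b₀ * ρ₁) ≤ (2 * X + 2) * (β * ρ₀)) where

  -- The lower counts may deviate by 1/E, and `count-lower` can enlarge a deviation by Q, so 1 + D =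
  -- QE. The margin `κ′` lets `few` hold. `C` collects the constant factors of `hi w * r !`; the
  -- extra factor `C ^ r′` in the number of rows completes it to an r-th power, so that the forms
  -- can be divided by its integral root C w. Their common factor c₀/(δ w) is (X + 1)/Y times β/(ρ₁
  -- C w).
  r Q E D g κ′ C κ A δ c₀ : ℕ
  r  = suc r′
  Q  = q ^ r
  E  = 2 * X + 2
  D  = pred (Q * E)
  g  = gap D
  κ′ = r * suc q + 1
  C  = E * (Q * Q) * g * κ′ * r !
  κ  = Q * D * (g * (κ′ * C ^ r′))
  A  = tilt D * Q
  δ  = Y * C * ρ₁
  c₀ = suc X * β

  -- `hi` is the target of the balancing argument and `Λ` the largest deficit, so that `lo` is `hi`
  -- diminished by its E-th part.
  Λ hi lo : ℕ → ℕ
  Λ w  = Q * Q * (g * (w ^ r * (κ′ * C ^ r′)))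
  hi w = E * Λ w
  lo w = (2 * X + 1) * Λ w

  private instance
    Q≢0 : NonZero Q
    Q≢0 = m^n≢0 q r
    E≢0 : NonZero E
    E≢0 = >-nonZero (≤-trans (n≤1+n 1) (m≤n+m 2 (2 * X)))
    g≢0 : NonZero g
    g≢0 = gap≢0 D
    κ′≢0 : NonZero κ′
    κ′≢0 = >-nonZero (m≤n+m 1 (r * suc q))
    C≢0 : NonZero C
    C≢0 = m*n≢0 (E * (Q * Q) * g * κ′) (r !)
      {{m*n≢0 (E * (Q * Q) * g) κ′ {{m*n≢0 (E * (Q * Q)) g {{m*n≢0 E (Q * Q) {{E≢0}} {{m*n≢0 Q Q {{Q≢0}} {{Q≢0}}}}}} {{g≢0}}}} {{κ′≢0}}}} {{n!≢0 r}}
      where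
      n!≢0 : ∀ n → NonZero (n !)
      n!≢0 zero    = _
      n!≢0 (suc n) = m*n≢0 (suc n) (n !) {{_}} {{n!≢0 n}}
    δ≢0 : NonZero δ
    δ≢0 = m*n≢0 (Y * C) ρ₁ {{m*n≢0 Y C {{Y≢0}} {{C≢0}}}} {{ρ₁≢0}}

  1+D≡ : suc D ≡ Q * E
  1+D≡ = suc-pred (Q * E) {{m*n≢0 Q E {{Q≢0}} {{E≢0}}}}

  hi-factorial : ∀ w → hi w * r ! ≡ (C * w) ^ r
  hi-factorial w = begin
    E * (Q * Q * (g * (w ^ r * (κ′ * C ^ r′)))) * r !   ≡⟨ rearrange E (Q * Q) g (w ^ r) κ′ (C ^ r′) (r !) ⟩
    C ^ r * w ^ r                                       ≡⟨ ^-distrib-* r C w ⟨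
    (C * w) ^ r                                         ∎
    where
    open ≡-Reasoning
    rearrange : ∀ E Q g w k c f → E * (Q * (g * (w * (k * c)))) * f ≡ E * Q * g * k * f * c * w
    rearrange = solve-∀

  module Balanced {n s w : ℕ} {f : Colouring} (log : IsLog n s) (root : IsRoot r s w) (col : Coloured q n (κ * w ^ r) f)
                  (small : potential q n (κ * w ^ r) A f r [] ≤ (1 + n * q) ^ r * suc A ^ (κ * w ^ r)) where

    W K′ : ℕ
    W  = w ^ r
    K′ = W * (κ′ * C ^ r′)

    open Balance {q} {n} {f} D K′ r using (k; target; count-upper; count-lower)

    k≡ : κ * w ^ r ≡ k
    k≡ = rearrange (Q * D) g (κ′ * C ^ r′) (w ^ r)
      where
      rearrange : ∀ a g c w → a * (g * c) * w ≡ a * (g * (w * c))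
      rearrange = solve-∀

    1+n≤2^W : suc n ≤ 2 ^ W
    1+n≤2^W = ≤-trans (IsLog.upper log) (^-monoʳ-≤ 2 (IsRoot.lower root))

    -- Since n < 2^(s+1) ≤ 2^W, the number of patterns has at most (W + q) r bits, and W (r (1 + q)
    -- + 1) exceeds this.
    few : (1 + n * q) ^ r < 2 ^ K′
    few = begin-strict
      (1 + n * q) ^ r           ≤⟨ ^-monoˡ-≤ r (begin
        1 + n * q                  ≤⟨ s≤s (≤-trans (*-monoʳ-≤ n (n≤1+n q)) (m≤n+m (n * suc q) q)) ⟩
        suc n * suc q              ≤⟨ *-mono-≤ 1+n≤2^W (m<2^m q) ⟩
        2 ^ W * 2 ^ q              ≡⟨ ^-distribˡ-+-* 2 W q ⟨
        2 ^ (W + q)                ∎) ⟩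
      (2 ^ (W + q)) ^ r         ≡⟨ ^-*-assoc 2 (W + q) r ⟩
      2 ^ ((W + q) * r)         <⟨ ^-monoʳ-< 2 (s≤s (s≤s z≤n)) exponents< ⟩
      2 ^ K′                    ∎
      where
      open ≤-Reasoning
      W≢0 : NonZero W
      W≢0 = >-nonZero (≤-trans (s≤s z≤n) (IsRoot.lower root))
      exponents< : (W + q) * r < K′
      exponents< = begin-strict
        (W + q) * r             ≤⟨ *-monoˡ-≤ r (+-monoʳ-≤ W (m≤n*m q W {{W≢0}})) ⟩
        (W + W * q) * r         <⟨ m<m+n _ (>-nonZero⁻¹ W {{W≢0}}) ⟩
        (W + W * q) * r + W     ≡⟨ rearrange W q r ⟩
        W * κ′                  ≤⟨ *-monoʳ-≤ W (m≤m*n κ′ (C ^ r′) {{m^n≢0 C r′ {{C≢0}}}}) ⟩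
        K′                      ∎
        where
        rearrange : ∀ W q r → (W + W * q) * r + W ≡ W * (r * (1 + q) + 1)
        rearrange = solve-∀

    target≡ : target ≡ hi w
    target≡ = trans (cong (λ z → z * (g * K′) * Q) 1+D≡) (rearrange Q E (g * K′))
      where
      rearrange : ∀ Q E K → Q * E * K * Q ≡ E * (Q * Q * K)
      rearrange = solve-∀

    col′ : Coloured q n k f
    col′ = subst (λ k → Coloured q n k f) k≡ col

    small′ : potential q n k A f r [] ≤ (1 + n * q) ^ r * suc A ^ k
    small′ = subst (λ k → potential q n k A f r [] ≤ (1 + n * q) ^ r * suc A ^ k) k≡ small

    upper : ∀ {pat} → Falling n q pat → length pat ≤ r → count (κ * w ^ r) f pat * q ^ length pat ≤ hi w
    upper {pat} fall len = subst₂ (λ k t → count k f pat * q ^ length pat ≤ t) (sym k≡) target≡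
      (count-upper few col′ small′ fall len)

    -- The deficit `Q * K * q ^ length pat` is largest for patterns of length r, where it is `Λ w`.
    lower : ∀ {pat} → Falling n q pat → length pat ≤ r → lo w ≤ count (κ * w ^ r) f pat * q ^ length pat
    lower {pat} fall len = +-cancelʳ-≤ (Λ w) _ _ (begin
      lo w + Λ w                                          ≡⟨ rearrange X (Λ w) ⟩
      hi w                                                ≡⟨ target≡ ⟨
      target                                              ≤⟨ count-lower few col′ small′ fall len ⟩
      count k f pat * q ^ length pat + Q * (g * K′) * q ^ length pat
        ≤⟨ +-monoʳ-≤ (count k f pat * q ^ length pat) (*-monoʳ-≤ (Q * (g * K′)) (^-monoʳ-≤ q len)) ⟩
      count k f pat * q ^ length pat + Q * (g * K′) * Q
        ≡⟨ cong₂ (λ k z → count k f pat * q ^ length pat + z) (sym k≡) (rearrange′ Q (g * K′)) ⟩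
      count (κ * w ^ r) f pat * q ^ length pat + Λ w      ∎)
      where
      open ≤-Reasoning
      rearrange : ∀ X l → (2 * X + 1) * l + l ≡ (2 * X + 2) * l
      rearrange = solve-∀
      rearrange′ : ∀ Q K → Q * K * Q ≡ Q * Q * K
      rearrange′ = solve-∀

  -- (X/(X+1))^r ≤ ((2X+1)/(2X+2))^(r+1)
  slack : X ^ r * E ^ suc r ≤ suc X ^ r * (2 * X + 1) ^ suc r
  slack = *-cancelʳ-≤ _ _ (E ^ r′) {{m^n≢0 E r′ {{E≢0}}}} (begin
    X ^ r * E ^ suc r * E ^ r′                 ≡⟨ powers X E ⟩
    (X * (E * E)) ^ r                          ≤⟨ ^-monoˡ-≤ r (≤-trans (m≤m+n _ (suc X)) (≤-reflexive (square X))) ⟩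
    (suc X * (p * p)) ^ r                      ≡⟨ powers (suc X) p ⟨
    suc X ^ r * p ^ suc r * p ^ r′             ≤⟨ *-monoʳ-≤ (suc X ^ r * p ^ suc r) (^-monoˡ-≤ r′ (+-monoʳ-≤ (2 * X) (n≤1+n 1))) ⟩
    suc X ^ r * p ^ suc r * E ^ r′             ∎)
    where
    open ≤-Reasoning
    p : ℕ
    p = 2 * X + 1
    square : ∀ X → X * ((2 * X + 2) * (2 * X + 2)) + (1 + X) ≡ (1 + X) * ((2 * X + 1) * (2 * X + 1))
    square = solve-∀
    powers : ∀ x y → x ^ r * y ^ suc r * y ^ r′ ≡ (x * (y * y)) ^ r
    powers x y = begin-equality
      x ^ r * (y * y ^ r) * y ^ r′        ≡⟨ rearrange (x ^ r) y (y ^ r) (y ^ r′) ⟩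
      x ^ r * (y ^ r * y ^ r)             ≡⟨ cong (x ^ r *_) (^-distrib-* r y y) ⟨
      x ^ r * (y * y) ^ r                 ≡⟨ ^-distrib-* r x (y * y) ⟨
      (x * (y * y)) ^ r                   ∎
      where
      rearrange : ∀ a y b c → a * (y * b) * c ≡ a * (b * (y * c))
      rearrange = solve-∀

  coefficient : ℕ → ℚ
  coefficient w = frac c₀ (δ * w ∸ 1)

  -- `G` is a coefficient before scaling. In (a) ρ₁/β and ρ₀/b₀ are the scales of the upper and
  -- lower estimates of the moments. The common factor puts the upper estimate exactly at ((X +
  -- 1)/Y)^r, and the whole loss falls on the lower one.
  module Scaled (w G : ℕ) {{w≢0 : NonZero w}}
    (G-upper : G * β ^ r ≤ hi w * r ! * ρ₁ ^ r) (G-lower : lo w * r ! * ρ₀ ^ r ≤ G * b₀ ^ r) where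

    δw : (δ * w) ^ r ≡ Y ^ r * (hi w * r ! * ρ₁ ^ r)
    δw = trans (cong (_^ r) (rearrange′ Y C ρ₁ w)) (trans (^-distrib-* r Y (C * w * ρ₁))
      (cong (Y ^ r *_) (trans (^-distrib-* r (C * w) ρ₁) (cong (_* ρ₁ ^ r) (sym (hi-factorial w))))))
      where
      rearrange′ : ∀ a b c d → a * b * c * d ≡ a * (b * d * c)
      rearrange′ = solve-∀

    scaled-upper : c₀ ^ r * G * Y ^ r ≤ suc X ^ r * (δ * w) ^ r
    scaled-upper = begin
      (suc X * β) ^ r * G * Y ^ r             ≡⟨ cong (λ z → z * G * Y ^ r) (^-distrib-* r (suc X) β) ⟩
      suc X ^ r * β ^ r * G * Y ^ r           ≡⟨ rearrange (suc X ^ r) (β ^ r) G (Y ^ r) ⟩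
      suc X ^ r * Y ^ r * (G * β ^ r)         ≤⟨ *-monoʳ-≤ (suc X ^ r * Y ^ r) G-upper ⟩
      suc X ^ r * Y ^ r * (hi w * r ! * ρ₁ ^ r) ≡⟨ *-assoc (suc X ^ r) _ _ ⟩
      suc X ^ r * (Y ^ r * (hi w * r ! * ρ₁ ^ r)) ≡⟨ cong (suc X ^ r *_) δw ⟨
      suc X ^ r * (δ * w) ^ r                 ∎
      where
      open ≤-Reasoning
      rearrange : ∀ a b c d → a * b * c * d ≡ a * d * (c * b)
      rearrange = solve-∀

    -- The loss consists of r + 1 factors (2X + 1)/(2X + 2), one from `lo` against `hi` and r from
    -- `ratio`; `slack` pays for them.
    ratio-power : X ^ r * (E * (b₀ * ρ₁) ^ r) ≤ suc X ^ r * ((2 * X + 1) * (β * ρ₀) ^ r)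
    ratio-power = *-cancelʳ-≤ _ _ (p ^ r) {{m^n≢0 p r {{>-nonZero (m≤n+m 1 (2 * X))}}}} (begin
      X ^ r * (E * (b₀ * ρ₁) ^ r) * p ^ r          ≡⟨ rearrange₁ (X ^ r) E ((b₀ * ρ₁) ^ r) (p ^ r) ⟩
      X ^ r * E * (p ^ r * (b₀ * ρ₁) ^ r)          ≡⟨ cong (X ^ r * E *_) (^-distrib-* r p (b₀ * ρ₁)) ⟨
      X ^ r * E * (p * (b₀ * ρ₁)) ^ r              ≤⟨ *-monoʳ-≤ (X ^ r * E) (^-monoˡ-≤ r ratio) ⟩
      X ^ r * E * (E * (β * ρ₀)) ^ r               ≡⟨ cong (X ^ r * E *_) (^-distrib-* r E (β * ρ₀)) ⟩
      X ^ r * E * (E ^ r * (β * ρ₀) ^ r)           ≡⟨ rearrange₂ (X ^ r) E (E ^ r) ((β * ρ₀) ^ r) ⟩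
      X ^ r * E ^ suc r * (β * ρ₀) ^ r             ≤⟨ *-monoˡ-≤ ((β * ρ₀) ^ r) slack ⟩
      suc X ^ r * p ^ suc r * (β * ρ₀) ^ r         ≡⟨ rearrange₃ (suc X ^ r) p (p ^ r) ((β * ρ₀) ^ r) ⟩
      suc X ^ r * (p * (β * ρ₀) ^ r) * p ^ r       ∎)
      where
      open ≤-Reasoning
      p : ℕ
      p = 2 * X + 1
      rearrange₁ : ∀ a b c d → a * (b * c) * d ≡ a * b * (d * c)
      rearrange₁ = solve-∀
      rearrange₂ : ∀ a b c d → a * b * (c * d) ≡ a * (b * c) * d
      rearrange₂ = solve-∀
      rearrange₃ : ∀ a b c d → a * (b * c) * d ≡ a * (b * d) * c
      rearrange₃ = solve-∀

    scaled-lower : X ^ r * (δ * w) ^ r ≤ c₀ ^ r * G * Y ^ r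
    scaled-lower = *-cancelʳ-≤ _ _ (b₀ ^ r) {{m^n≢0 b₀ r}} (begin
      X ^ r * (δ * w) ^ r * b₀ ^ r
        ≡⟨ cong (λ z → X ^ r * z * b₀ ^ r) δw ⟩
      X ^ r * (Y ^ r * (hi w * r ! * ρ₁ ^ r)) * b₀ ^ r
        ≡⟨ rearrange₁ (X ^ r) (Y ^ r) E (Λ w) (r !) (ρ₁ ^ r) (b₀ ^ r) ⟩
      X ^ r * (E * (b₀ ^ r * ρ₁ ^ r)) * (Y ^ r * (Λ w * r !))
        ≡⟨ cong (λ z → X ^ r * (E * z) * (Y ^ r * (Λ w * r !))) (^-distrib-* r b₀ ρ₁) ⟨
      X ^ r * (E * (b₀ * ρ₁) ^ r) * (Y ^ r * (Λ w * r !))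
        ≤⟨ *-monoˡ-≤ (Y ^ r * (Λ w * r !)) ratio-power ⟩
      suc X ^ r * ((2 * X + 1) * (β * ρ₀) ^ r) * (Y ^ r * (Λ w * r !))
        ≡⟨ cong (λ z → suc X ^ r * ((2 * X + 1) * z) * (Y ^ r * (Λ w * r !))) (^-distrib-* r β ρ₀) ⟩
      suc X ^ r * ((2 * X + 1) * (β ^ r * ρ₀ ^ r)) * (Y ^ r * (Λ w * r !))
        ≡⟨ rearrange₂ (suc X ^ r) (2 * X + 1) (β ^ r) (ρ₀ ^ r) (Y ^ r) (Λ w) (r !) ⟩
      suc X ^ r * β ^ r * Y ^ r * (lo w * r ! * ρ₀ ^ r)
        ≤⟨ *-monoʳ-≤ (suc X ^ r * β ^ r * Y ^ r) G-lower ⟩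
      suc X ^ r * β ^ r * Y ^ r * (G * b₀ ^ r)
        ≡⟨ rearrange₃ (suc X ^ r * β ^ r) (Y ^ r) G (b₀ ^ r) ⟩
      suc X ^ r * β ^ r * G * Y ^ r * b₀ ^ r
        ≡⟨ cong (λ z → z * G * Y ^ r * b₀ ^ r) (^-distrib-* r (suc X) β) ⟨
      c₀ ^ r * G * Y ^ r * b₀ ^ r ∎)
      where
      open ≤-Reasoning
      rearrange₁ : ∀ x y e l f p b → x * (y * (e * l * f * p)) * b ≡ x * (e * (b * p)) * (y * (l * f))
      rearrange₁ = solve-∀
      rearrange₂ : ∀ x p b c y l f → x * (p * (b * c)) * (y * (l * f)) ≡ x * b * y * (p * l * f * c)
      rearrange₂ = solve-∀
      rearrange₃ : ∀ a y g b → a * y * (g * b) ≡ a * g * y * b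
      rearrange₃ = solve-∀

    private
      γ : ℚ
      γ = coefficient w

    bounds-hold : ∀ {ε} → Window ε X Y →
      (1ᴿ -ᴿ ε) ^ᴿ r ≤ᴿ fromℚ (coefficient w ^ℚ r ℚ.* ι G) × fromℚ (coefficient w ^ℚ r ℚ.* ι G) ≤ᴿ (1ᴿ +ᴿ ε) ^ᴿ r
    bounds-hold win = window-≤ r (γ ^ℚ r ℚ.* ι G) win
      (cancel (begin
        ι X ^ℚ r ℚ.* z                           ≡⟨ two X ⟨
        ι (X ^ r * (δ * w) ^ r)                  ≤⟨ ι-mono scaled-lower ⟩
        ι (c₀ ^ r * G * Y ^ r)                   ≡⟨ three ⟩
        γ ^ℚ r ℚ.* ι G ℚ.* ι Y ^ℚ r ℚ.* z        ∎))
      (cancel (begin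
        γ ^ℚ r ℚ.* ι G ℚ.* ι Y ^ℚ r ℚ.* z        ≡⟨ three ⟨
        ι (c₀ ^ r * G * Y ^ r)                   ≤⟨ ι-mono scaled-upper ⟩
        ι (suc X ^ r * (δ * w) ^ r)              ≡⟨ two (suc X) ⟩
        ι (suc X) ^ℚ r ℚ.* z                     ∎))
      where
      open ℚP.≤-Reasoning
      instance
        δw≢0 : NonZero (δ * w)
        δw≢0 = m*n≢0 δ w {{δ≢0}} {{w≢0}}
      z : ℚ
      z = ι (δ * w) ^ℚ r
      z≡ : z ≡ ι ((δ * w) ^ r)
      z≡ = sym (ι-^ (δ * w) r)
      cancel : ∀ {a b} → a ℚ.* z ℚ.≤ b ℚ.* z → a ℚ.≤ b
      cancel = ℚP.*-cancelʳ-≤-pos z {{subst ℚ.Positive (sym z≡) (ι-pos ((δ * w) ^ r) {{m^n≢0 (δ * w) r {{δw≢0}}}})}}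
      two : ∀ x → ι (x ^ r * (δ * w) ^ r) ≡ ι x ^ℚ r ℚ.* z
      two x = trans (ι-* (x ^ r) ((δ * w) ^ r)) (cong₂ ℚ._*_ (ι-^ x r) (ι-^ (δ * w) r))
      γz : γ ^ℚ r ℚ.* z ≡ ι c₀ ^ℚ r
      γz = trans (sym (^ℚ-distrib-* γ (ι (δ * w)) r)) (cong (_^ℚ r)
        (trans (cong (λ d → γ ℚ.* ι d) (sym (m+[n∸m]≡n (>-nonZero⁻¹ (δ * w))))) (frac-cancel c₀ (δ * w ∸ 1))))
      three : ι (c₀ ^ r * G * Y ^ r) ≡ γ ^ℚ r ℚ.* ι G ℚ.* ι Y ^ℚ r ℚ.* z
      three = trans (ι-* (c₀ ^ r * G) (Y ^ r)) (trans (cong₂ ℚ._*_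
          (trans (ι-* (c₀ ^ r) G) (cong (ℚ._* ι G) (trans (ι-^ c₀ r) (sym γz)))) (ι-^ Y r))
        (rearrange (γ ^ℚ r) z (ι G) (ι Y ^ℚ r)))
        where
        rearrange : ∀ a b c d → a ℚ.* b ℚ.* c ℚ.* d ≡ a ℚ.* c ℚ.* d ℚ.* b
        rearrange = solve 4 (λ a b c d → a :* b :* c :* d := a :* c :* d :* b) refl
          where open +-*-Solver

  -- Rounding s up to an r-th power costs at most the factor 2^r, and passing from s to the natural
  -- logarithm costs the factor 2.
  count-≤-ln : ∀ {n s w c} → IsLog n s → IsRoot r s w → κ * 2 ^ r ≤ c →
    fromℕ (κ * w ^ r) ≤ᴿ fromℕ (c * 2) *ᴿ ln n
  count-≤-ln {n} {s} {w} {c} log root le = fromℕ-≤-ln n s (κ * w ^ r) c (IsLog.lower log)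
    (≤-trans (*-monoʳ-≤ κ (IsRoot.upper root)) (≤-trans (≤-reflexive (sym (*-assoc κ (2 ^ r) s))) (*-monoˡ-≤ s le)))

-- Sample sizes for the exponential moments

module SampleSize (r X : ℕ) where

  -- With b = Zr and M = Z(b + 2r) both quotients (b + r)/(b + 1) and (M + b + 2r)/M are at most
  -- Z/(Z - 1). For Z = 4X + 4 the square of this is at most (2X + 2)/(2X + 1).
  Z b M : ℕ
  Z = 4 * X + 4
  b = Z * r
  M = Z * (b + 2 * r)

  open Moments r b M public

  ratio : (2 * X + 1) * ((b + r) * (r + M + b + r)) ≤ (2 * X + 2) * (suc b * M)
  ratio = *-cancelʳ-≤ _ _ (p * p) {{m*n≢0 p p {{p≢0}} {{p≢0}}}} (begin
    (2 * X + 1) * ((b + r) * (r + M + b + r)) * (p * p)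
      ≡⟨ rearrange₁ (2 * X + 1) (b + r) (r + M + b + r) p ⟩
    (2 * X + 1) * ((p * (b + r)) * (p * (r + M + b + r)))
      ≤⟨ *-monoʳ-≤ (2 * X + 1) (*-mono-≤ first second) ⟩
    (2 * X + 1) * ((Z * suc b) * (Z * M))
      ≡⟨ rearrange₂ (2 * X + 1) Z (suc b) M ⟩
    (2 * X + 1) * (Z * Z) * (suc b * M)
      ≤⟨ *-monoˡ-≤ (suc b * M) (≤-trans (m≤m+n ((2 * X + 1) * (Z * Z)) (2 * X + 2)) (≤-reflexive (third X))) ⟩
    (2 * X + 2) * (p * p) * (suc b * M)
      ≡⟨ xy∙z≈xz∙y (2 * X + 2) (p * p) (suc b * M) ⟩
    (2 * X + 2) * (suc b * M) * (p * p) ∎)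
    where
    open ≤-Reasoning
    p : ℕ
    p = 4 * X + 3
    p≢0 : NonZero p
    p≢0 = >-nonZero (≤-trans (s≤s z≤n) (m≤n+m 3 (4 * X)))
    rearrange₁ : ∀ a b c p → a * (b * c) * (p * p) ≡ a * ((p * b) * (p * c))
    rearrange₁ = solve-∀
    rearrange₂ : ∀ a z b m → a * ((z * b) * (z * m)) ≡ a * (z * z) * (b * m)
    rearrange₂ = solve-∀
    first : p * (b + r) ≤ Z * suc b
    first = ≤-trans (m≤m+n _ (r + Z)) (≤-reflexive (expand X r))
      where
      expand : ∀ X r → let Z = 4 * X + 4 ; b = Z * r in (4 * X + 3) * (b + r) + (r + Z) ≡ Z * (1 + b)
      expand = solve-∀
    second : p * (r + M + b + r) ≤ Z * M
    second = ≤-trans (m≤m+n _ (b + 2 * r)) (≤-reflexive (expand X r b))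
      where
      expand : ∀ X r b → let Z = 4 * X + 4 ; M = Z * (b + 2 * r) in
               (4 * X + 3) * (r + M + b + r) + (b + 2 * r) ≡ Z * M
      expand = solve-∀
    third : ∀ X → (2 * X + 1) * ((4 * X + 4) * (4 * X + 4)) + (2 * X + 2) ≡ (2 * X + 2) * ((4 * X + 3) * (4 * X + 3))
    third = solve-∀

  size≢0 : NonZero (length sample)
  size≢0 = nonempty b (r + M)
    where
    nonempty : ∀ b M → NonZero (length (simplex b M))
    nonempty zero    M       = _
    nonempty (suc b) zero    = nonempty b zero
    nonempty (suc b) (suc M) = subst NonZero (sym (trans (length-++ (simplex (suc b) M)) (+-comm (length (simplex (suc b) M)) _)))
      (>-nonZero (≤-trans (>-nonZero⁻¹ _ {{nonempty b (suc M)}}) (m≤m+n _ _)))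

  d : ℕ → ℕ
  d = nth sample

  q : ℕ
  q = length sample

  private
    rearrange′ : ∀ a b c d e f → (a * b * c) * (d * e * f) ≡ a * d * (b * e) * (c * f)
    rearrange′ = solve-∀

  -- No exponent exceeds the sum r, so `moment-upper` applies to every factor; the scales multiply
  -- to a power that depends only on the sum.
  products-upper : ∀ {m} (as : Vec ℕ m) → sum as ≤ r →
    momentProduct q d as * suc b ^ sum as ≤ factorials as * q ^ m * (r + M + b + r) ^ sum as
  products-upper []       le = ≤-refl
  products-upper {suc m} (a ∷ as) le = begin
    sumTo q (λ u → d u ^ a) * P * suc b ^ (a + sum as)
      ≡⟨ cong₂ (λ x y → x * P * y) (sumTo-nth sample (_^ a)) (^-distribˡ-+-* (suc b) a (sum as)) ⟩
    moment a * P * (suc b ^ a * suc b ^ sum as)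
      ≡⟨ *-interchange (moment a) P (suc b ^ a) _ ⟩
    (moment a * suc b ^ a) * (P * suc b ^ sum as)
      ≤⟨ *-mono-≤ (moment-upper a (≤-trans (m≤m+n a _) le)) (products-upper as (≤-trans (m≤n+m _ a) le)) ⟩
    (a ! * q * ρ ^ a) * (factorials as * q ^ m * ρ ^ sum as)
      ≡⟨ rearrange′ (a !) q (ρ ^ a) (factorials as) (q ^ m) _ ⟩
    a ! * factorials as * (q * q ^ m) * (ρ ^ a * ρ ^ sum as)
      ≡⟨ cong (a ! * factorials as * (q * q ^ m) *_) (^-distribˡ-+-* ρ a (sum as)) ⟨
    a ! * factorials as * (q * q ^ m) * ρ ^ (a + sum as) ∎
    where
    open ≤-Reasoning
    P ρ : ℕ
    P = momentProduct q d as
    ρ = r + M + b + r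

  products-lower : ∀ {m} (as : Vec ℕ m) → sum as ≤ r →
    factorials as * q ^ m * M ^ sum as ≤ momentProduct q d as * (b + r) ^ sum as
  products-lower []       le = ≤-refl
  products-lower {suc m} (a ∷ as) le = begin
    a ! * factorials as * (q * q ^ m) * M ^ (a + sum as)
      ≡⟨ cong (a ! * factorials as * (q * q ^ m) *_) (^-distribˡ-+-* M a (sum as)) ⟩
    a ! * factorials as * (q * q ^ m) * (M ^ a * M ^ sum as)
      ≡⟨ rearrange′ (a !) q (M ^ a) (factorials as) (q ^ m) _ ⟨
    (a ! * q * M ^ a) * (factorials as * q ^ m * M ^ sum as)
      ≤⟨ *-mono-≤ (moment-lower a (≤-trans (m≤m+n a _) le)) (products-lower as (≤-trans (m≤n+m _ a) le)) ⟩
    (moment a * (b + r) ^ a) * (P * (b + r) ^ sum as)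
      ≡⟨ *-interchange (moment a) P ((b + r) ^ a) _ ⟨
    moment a * P * ((b + r) ^ a * (b + r) ^ sum as)
      ≡⟨ cong₂ (λ x y → x * P * y) (sumTo-nth sample (_^ a)) (^-distribˡ-+-* (b + r) a (sum as)) ⟨
    sumTo q (λ u → d u ^ a) * P * (b + r) ^ (a + sum as) ∎
    where
    open ≤-Reasoning
    P : ℕ
    P = momentProduct q d as

-- Sums and products of reals, at one index of the Cauchy sequences

seq-∑ : ∀ {A : Set} (xs : List A) f m → seq (∑ xs f) m ≡ ∑ℚ xs (λ x → seq (f x) m)
seq-∑ []       f m = refl
seq-∑ (x ∷ xs) f m = cong (seq (f x) m ℚ.+_) (seq-∑ xs f m)

seq-∏ : ∀ {A : Set} (xs : List A) f m → seq (∏ xs f) m ≡ ∏ℚ xs (λ x → seq (f x) m)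
seq-∏ []       f m = refl
seq-∏ (x ∷ xs) f m = cong (seq (f x) m ℚ.*_) (seq-∏ xs f m)

seq-form : ∀ {n} (ℓ : LinearForm n) x m → seq (ℓ ⟨ x ⟩) m ≡ ∑ᶠ n (λ j → seq (ℓ j) m ℚ.* seq (x j) m)
seq-form ℓ x m = trans (seq-∑ (allFin _) (λ j → ℓ j *ᴿ x j) m)
  (∑ℚ-tabulate (λ i → i) (λ j → seq (ℓ j) m ℚ.* seq (x j) m))

seq-monomial : ∀ {n} (x : Point n) a m → seq (monomial x a) m ≡ ∏ᶠ n (λ i → seq (x i) m ^ℚ lookup a i)
seq-monomial {n} x a m = trans (seq-∏ (allFin n) (λ i → x i ^ᴿ lookup a i) m)
  (trans (∏ℚ-tabulate (λ i → i) (λ i → seq (x i ^ᴿ lookup a i) m)) (∏ᶠ-cong n (λ i → seq-^ (x i) (lookup a i) m)))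

seq-squarefree : ∀ {n} (x : Point n) I m → seq (squarefree x I) m ≡ squarefreeᶠ (λ i → seq (x i) m) I
seq-squarefree x I m = trans (seq-∏ (filter (_∈? I) (allFin _)) x m) (∏ℚ-subset (λ i → seq (x i) m) I)

outputCoeff-value : ∀ σ x a d m → σ 1 x ≡ a → σ 2 x ≡ 0 → σ 3 x ≡ d → seq (outputCoeff σ x) m ≡ frac a d
outputCoeff-value σ x a d m eq₁ eq₂ eq₃ rewrite eq₁ | eq₂ | eq₃ = sym (frac-def a d)

row-monomial : ∀ (d : ℕ → ℕ) f i n j (x : Fin n → ℚ) a →
  ∏ᶠ n (λ m → (ι (valueAt d (f i (j + toℕ m))) ℚ.* x m) ^ℚ lookup a m) ≡
  ι (rowProduct d f i j a) ℚ.* ∏ᶠ n (λ m → x m ^ℚ lookup a m)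
row-monomial d f i zero    j x []       = sym (trans (ℚP.*-identityʳ _) ι1)
row-monomial d f i (suc n) j x (a ∷ as) = begin
  (ι (valueAt d (f i (j + 0))) ℚ.* x zero) ^ℚ a ℚ.*
    ∏ᶠ n (λ m → (ι (valueAt d (f i (j + suc (toℕ m)))) ℚ.* x (suc m)) ^ℚ lookup as m)
    ≡⟨ cong₂ (λ c p → (ι (valueAt d (f i c)) ℚ.* x zero) ^ℚ a ℚ.* p) (+-identityʳ j)
         (∏ᶠ-cong n (λ m → cong (λ c → (ι (valueAt d (f i c)) ℚ.* x (suc m)) ^ℚ lookup as m) (+-suc j (toℕ m)))) ⟩
  (ι v ℚ.* x zero) ^ℚ a ℚ.* ∏ᶠ n (λ m → (ι (valueAt d (f i (suc j + toℕ m))) ℚ.* x (suc m)) ^ℚ lookup as m)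
    ≡⟨ cong₂ ℚ._*_ (^ℚ-distrib-* (ι v) (x zero) a) (row-monomial d f i n (suc j) (λ m → x (suc m)) as) ⟩
  (ι v ^ℚ a ℚ.* x zero ^ℚ a) ℚ.* (ι (rowProduct d f i (suc j) as) ℚ.* P)
    ≡⟨ cong (λ z → (z ℚ.* x zero ^ℚ a) ℚ.* (ι (rowProduct d f i (suc j) as) ℚ.* P)) (ι-^ v a) ⟨
  (ι (v ^ a) ℚ.* x zero ^ℚ a) ℚ.* (ι (rowProduct d f i (suc j) as) ℚ.* P)
    ≡⟨ *ℚ-interchange (ι (v ^ a)) (x zero ^ℚ a) (ι (rowProduct d f i (suc j) as)) P ⟩
  (ι (v ^ a) ℚ.* ι (rowProduct d f i (suc j) as)) ℚ.* (x zero ^ℚ a ℚ.* P)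
    ≡⟨ cong (ℚ._* (x zero ^ℚ a ℚ.* P)) (ι-* (v ^ a) (rowProduct d f i (suc j) as)) ⟨
  ι (v ^ a * rowProduct d f i (suc j) as) ℚ.* (x zero ^ℚ a ℚ.* P) ∎
  where
  open ≡-Reasoning
  v : ℕ
  v = valueAt d (f i j)
  P : ℚ
  P = ∏ᶠ n (λ m → x (suc m) ^ℚ lookup as m)

∑ᶠ-∑ℚ : ∀ {A : Set} k (xs : List A) (f : Fin k → A → ℚ) →
         ∑ᶠ k (λ i → ∑ℚ xs (f i)) ≡ ∑ℚ xs (λ x → ∑ᶠ k (λ i → f i x))
∑ᶠ-∑ℚ zero    xs f = sym (∑ℚ-zero xs (λ _ → refl))
∑ᶠ-∑ℚ (suc k) xs f = trans (cong (∑ℚ xs (f zero) ℚ.+_) (∑ᶠ-∑ℚ k xs (λ i → f (suc i))))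
  (sym (∑ℚ-+ xs (f zero) (λ x → ∑ᶠ k (λ i → f (suc i) x))))

-- Each row is expanded by the multinomial theorem, which factors into row products. Then rows and
-- exponent vectors change places, and the words with another sum drop out.
power-sum-expansion : ∀ (γ : ℚ) (d : ℕ → ℕ) f k n r (x : Fin n → ℚ) →
  ∑ᶠ k (λ i → (∑ᶠ n (λ j → (γ ℚ.* ι (valueAt d (f (toℕ i) (toℕ j)))) ℚ.* x j)) ^ℚ r) ≡
  ∑ℚ (exponents n r) (λ a →
    (γ ^ℚ r ℚ.* ι (multinomial r a * sumTo k (λ i → rowProduct d f i 0 a))) ℚ.* ∏ᶠ n (λ j → x j ^ℚ lookup a j))
power-sum-expansion γ d f k n r x = begin
  ∑ᶠ k (λ i → (∑ᶠ n (λ j → (γ ℚ.* ι (v i j)) ℚ.* x j)) ^ℚ r)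
    ≡⟨ ∑ᶠ-cong k row ⟩
  ∑ᶠ k (λ i → ∑ℚ W (term i))
    ≡⟨ ∑ᶠ-∑ℚ k W term ⟩
  ∑ℚ W (λ a → ∑ᶠ k (λ i → term i a))
    ≡⟨ ∑ℚ-cong W column ⟩
  ∑ℚ W (λ a → (γ ^ℚ r ℚ.* ι (multinomial r a * sumTo k (λ i → rowProduct d f i 0 a))) ℚ.* X a)
    ≡⟨ ∑ℚ-filter (λ a → sum a ≟ r) W _ vanish ⟨
  ∑ℚ (exponents n r) (λ a → (γ ^ℚ r ℚ.* ι (multinomial r a * sumTo k (λ i → rowProduct d f i 0 a))) ℚ.* X a) ∎
  where
  open ≡-Reasoning
  W : List (Vec ℕ n)
  W = words (upTo (suc r)) n
  v : Fin k → Fin n → ℕ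
  v i j = valueAt d (f (toℕ i) (toℕ j))
  X : Vec ℕ n → ℚ
  X a = ∏ᶠ n (λ j → x j ^ℚ lookup a j)
  term : Fin k → Vec ℕ n → ℚ
  term i a = γ ^ℚ r ℚ.* (ι (multinomial r a) ℚ.* (ι (rowProduct d f (toℕ i) 0 a) ℚ.* X a))
  row : ∀ i → (∑ᶠ n (λ j → (γ ℚ.* ι (v i j)) ℚ.* x j)) ^ℚ r ≡ ∑ℚ W (term i)
  row i = begin
    (∑ᶠ n (λ j → (γ ℚ.* ι (v i j)) ℚ.* x j)) ^ℚ r
      ≡⟨ cong (_^ℚ r) (trans (∑ᶠ-cong n (λ j → ℚP.*-assoc γ (ι (v i j)) (x j))) (∑ᶠ-*ˡ n γ (λ j → ι (v i j) ℚ.* x j))) ⟩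
    (γ ℚ.* ∑ᶠ n (λ j → ι (v i j) ℚ.* x j)) ^ℚ r
      ≡⟨ ^ℚ-distrib-* γ _ r ⟩
    γ ^ℚ r ℚ.* (∑ᶠ n (λ j → ι (v i j) ℚ.* x j)) ^ℚ r
      ≡⟨ cong (γ ^ℚ r ℚ.*_) (trans (multinomial-theorem r r n (λ j → ι (v i j) ℚ.* x j) ≤-refl)
           (∑ℚ-cong W (λ a → cong (ι (multinomial r a) ℚ.*_) (row-monomial d f (toℕ i) n 0 x a)))) ⟩
    γ ^ℚ r ℚ.* ∑ℚ W (λ a → ι (multinomial r a) ℚ.* (ι (rowProduct d f (toℕ i) 0 a) ℚ.* X a))
      ≡⟨ ∑ℚ-*ˡ W (γ ^ℚ r) (λ a → ι (multinomial r a) ℚ.* (ι (rowProduct d f (toℕ i) 0 a) ℚ.* X a)) ⟨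
    ∑ℚ W (term i) ∎
  column : ∀ a → ∑ᶠ k (λ i → term i a) ≡
    (γ ^ℚ r ℚ.* ι (multinomial r a * sumTo k (λ i → rowProduct d f i 0 a))) ℚ.* X a
  column a = begin
    ∑ᶠ k (λ i → term i a)
      ≡⟨ ∑ᶠ-cong k (λ i → rearrange (γ ^ℚ r) (ι (multinomial r a)) (ι (rowProduct d f (toℕ i) 0 a)) (X a)) ⟩
    ∑ᶠ k (λ i → c ℚ.* ι (rowProduct d f (toℕ i) 0 a))
      ≡⟨ ∑ᶠ-*ˡ k c (λ i → ι (rowProduct d f (toℕ i) 0 a)) ⟩
    c ℚ.* ∑ᶠ k (λ i → ι (rowProduct d f (toℕ i) 0 a))
      ≡⟨ cong (c ℚ.*_) (ι-sumTo k (λ i → rowProduct d f i 0 a)) ⟨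
    c ℚ.* ι S
      ≡⟨ rearrange (γ ^ℚ r) (ι (multinomial r a)) (ι S) (X a) ⟨
    γ ^ℚ r ℚ.* (ι (multinomial r a) ℚ.* (ι S ℚ.* X a))
      ≡⟨ rearrange′ (γ ^ℚ r) (ι (multinomial r a)) (ι S) (X a) ⟩
    (γ ^ℚ r ℚ.* (ι (multinomial r a) ℚ.* ι S)) ℚ.* X a
      ≡⟨ cong (λ z → (γ ^ℚ r ℚ.* z) ℚ.* X a) (ι-* (multinomial r a) S) ⟨
    (γ ^ℚ r ℚ.* ι (multinomial r a * S)) ℚ.* X a ∎
    where
    S : ℕ
    S = sumTo k (λ i → rowProduct d f i 0 a)
    c : ℚ
    c = γ ^ℚ r ℚ.* ι (multinomial r a) ℚ.* X a
    rearrange : ∀ g m p x → g ℚ.* (m ℚ.* (p ℚ.* x)) ≡ (g ℚ.* m ℚ.* x) ℚ.* p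
    rearrange = solve 4 (λ g m p x → g :* (m :* (p :* x)) := (g :* m :* x) :* p) refl
      where open +-*-Solver
    rearrange′ : ∀ g m p x → g ℚ.* (m ℚ.* (p ℚ.* x)) ≡ (g ℚ.* (m ℚ.* p)) ℚ.* x
    rearrange′ = solve 4 (λ g m p x → g :* (m :* (p :* x)) := (g :* (m :* p)) :* x) refl
      where open +-*-Solver
  vanish : ∀ a → (γ ^ℚ r ℚ.* ι (multinomial r a * sumTo k (λ i → rowProduct d f i 0 a))) ℚ.* X a ≡ 0ℚ ⊎ sum a ≡ r
  vanish a with multinomial-vanishes r a
  ... | inj₂ eq = inj₂ eq
  ... | inj₁ eq = inj₁ (zero-*ˡ (trans (cong (γ ^ℚ r ℚ.*_)
    (trans (cong (λ z → ι (z * sumTo k (λ i → rowProduct d f i 0 a))) eq) ι0)) (ℚP.*-zeroʳ (γ ^ℚ r))))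

colours-of : ℕ → List ℕ
colours-of r = map toℕ (allFin r)

colours-distinct : ∀ r → Distinct (colours-of r)
colours-distinct r = map⁺ toℕ-injective (allFin⁺ r)

colours-length : ∀ r → length (colours-of r) ≡ r
colours-length r = trans (length-map toℕ (allFin r)) (length-tabulate (λ i → i))

colours-< : ∀ r → All (_< r) (colours-of r)
colours-< r = AllP.map⁺ (AllP.tabulate⁺ toℕ<n)

∏ℚ-map : ∀ {A B : Set} (h : A → B) xs f → ∏ℚ (map h xs) f ≡ ∏ℚ xs (λ x → f (h x))
∏ℚ-map h []       f = refl
∏ℚ-map h (x ∷ xs) f = cong (f (h x) ℚ.*_) (∏ℚ-map h xs f)

product-sum-expansion : ∀ (γ : ℚ) f k n r (x : Fin n → ℚ) →
  ∑ᶠ k (λ i → ∏ℚ (allFin r) (λ τ → ∑ᶠ n (λ j → (γ ℚ.* ι (isColour (toℕ τ) (f (toℕ i) (toℕ j)))) ℚ.* x j))) ≡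
  ∑ℚ (subsets n r) (λ I →
    (γ ^ℚ r ℚ.* ι (sumTo k (λ i → bijections f i 0 (colours-of r) I))) ℚ.* squarefreeᶠ x I)
product-sum-expansion γ f k n r x = begin
  ∑ᶠ k (λ i → ∏ℚ (allFin r) (λ τ → ∑ᶠ n (λ j → (γ ℚ.* ι (c i (toℕ τ) j)) ℚ.* x j)))
    ≡⟨ ∑ᶠ-cong k row ⟩
  ∑ᶠ k (λ i → ∑ℚ W (term i))
    ≡⟨ ∑ᶠ-∑ℚ k W term ⟩
  ∑ℚ W (λ I → ∑ᶠ k (λ i → term i I))
    ≡⟨ ∑ℚ-cong W column ⟩
  ∑ℚ W (λ I → (γ ^ℚ r ℚ.* ι (S I)) ℚ.* squarefreeᶠ x I)
    ≡⟨ ∑ℚ-filter (λ I → ∣ I ∣ ≟ r) W _ vanish ⟨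
  ∑ℚ (subsets n r) (λ I → (γ ^ℚ r ℚ.* ι (S I)) ℚ.* squarefreeᶠ x I) ∎
  where
  open ≡-Reasoning
  W : List (Subset n)
  W = words (inside ∷ outside ∷ []) n
  U : List ℕ
  U = colours-of r
  c : Fin k → ℕ → Fin n → ℕ
  c i τ j = isColour τ (f (toℕ i) (toℕ j))
  S : Subset n → ℕ
  S I = sumTo k (λ i → bijections f i 0 U I)
  term : Fin k → Subset n → ℚ
  term i I = γ ^ℚ r ℚ.* (ι (bijections f (toℕ i) 0 U I) ℚ.* squarefreeᶠ x I)
  row : ∀ i → ∏ℚ (allFin r) (λ τ → ∑ᶠ n (λ j → (γ ℚ.* ι (c i (toℕ τ) j)) ℚ.* x j)) ≡ ∑ℚ W (term i)
  row i = begin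
    ∏ℚ (allFin r) (λ τ → ∑ᶠ n (λ j → (γ ℚ.* ι (c i (toℕ τ) j)) ℚ.* x j))
      ≡⟨ ∏ℚ-cong (allFin r) (λ τ → trans (∑ᶠ-cong n (λ j → ℚP.*-assoc γ (ι (c i (toℕ τ) j)) (x j)))
           (∑ᶠ-*ˡ n γ (λ j → ι (c i (toℕ τ) j) ℚ.* x j))) ⟩
    ∏ℚ (allFin r) (λ τ → γ ℚ.* R (toℕ τ))
      ≡⟨ ∏ℚ-map toℕ (allFin r) (λ τ → γ ℚ.* R τ) ⟨
    ∏ℚ U (λ τ → γ ℚ.* R τ)
      ≡⟨ ∏ℚ-*ˡ U γ R ⟩
    γ ^ℚ length U ℚ.* ∏ℚ U R
      ≡⟨ cong₂ (λ l p → γ ^ℚ l ℚ.* p) (colours-length r) (colour-product f (toℕ i) n 0 x U (colours-distinct r)) ⟩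
    γ ^ℚ r ℚ.* ∑ℚ W (λ I → ι (bijections f (toℕ i) 0 U I) ℚ.* squarefreeᶠ x I)
      ≡⟨ ∑ℚ-*ˡ W (γ ^ℚ r) (λ I → ι (bijections f (toℕ i) 0 U I) ℚ.* squarefreeᶠ x I) ⟨
    ∑ℚ W (term i) ∎
    where
    R : ℕ → ℚ
    R τ = ∑ᶠ n (λ j → ι (c i τ j) ℚ.* x j)
  column : ∀ I → ∑ᶠ k (λ i → term i I) ≡ (γ ^ℚ r ℚ.* ι (S I)) ℚ.* squarefreeᶠ x I
  column I = begin
    ∑ᶠ k (λ i → term i I)
      ≡⟨ ∑ᶠ-cong k (λ i → rearrange (γ ^ℚ r) (ι (bijections f (toℕ i) 0 U I)) (squarefreeᶠ x I)) ⟩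
    ∑ᶠ k (λ i → (γ ^ℚ r ℚ.* squarefreeᶠ x I) ℚ.* ι (bijections f (toℕ i) 0 U I))
      ≡⟨ ∑ᶠ-*ˡ k (γ ^ℚ r ℚ.* squarefreeᶠ x I) (λ i → ι (bijections f (toℕ i) 0 U I)) ⟩
    (γ ^ℚ r ℚ.* squarefreeᶠ x I) ℚ.* ∑ᶠ k (λ i → ι (bijections f (toℕ i) 0 U I))
      ≡⟨ cong ((γ ^ℚ r ℚ.* squarefreeᶠ x I) ℚ.*_) (ι-sumTo k (λ i → bijections f i 0 U I)) ⟨
    (γ ^ℚ r ℚ.* squarefreeᶠ x I) ℚ.* ι (S I)
      ≡⟨ rearrange (γ ^ℚ r) (ι (S I)) (squarefreeᶠ x I) ⟨
    γ ^ℚ r ℚ.* (ι (S I) ℚ.* squarefreeᶠ x I)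
      ≡⟨ ℚP.*-assoc (γ ^ℚ r) (ι (S I)) (squarefreeᶠ x I) ⟨
    (γ ^ℚ r ℚ.* ι (S I)) ℚ.* squarefreeᶠ x I ∎
    where
    rearrange : ∀ g p x → g ℚ.* (p ℚ.* x) ≡ (g ℚ.* x) ℚ.* p
    rearrange = solve 3 (λ g p x → g :* (p :* x) := (g :* x) :* p) refl
      where open +-*-Solver
  vanish : ∀ I → (γ ^ℚ r ℚ.* ι (S I)) ℚ.* squarefreeᶠ x I ≡ 0ℚ ⊎ ∣ I ∣ ≡ r
  vanish I with rows k
    where
    rows : ∀ k → sumTo k (λ i → bijections f i 0 U I) ≡ 0 ⊎ ∣ I ∣ ≡ r
    rows zero    = inj₁ refl
    rows (suc k) with rows k | bijections-vanish f k 0 U I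
    ... | inj₂ eq | _        = inj₂ eq
    ... | inj₁ _  | inj₂ eq  = inj₂ (trans eq (colours-length r))
    ... | inj₁ eq | inj₁ eq′ = inj₁ (cong₂ _+_ eq eq′)
  ... | inj₂ eq = inj₂ eq
  ... | inj₁ eq = inj₁ (zero-*ˡ (trans (cong (γ ^ℚ r ℚ.*_) (trans (cong ι eq) ι0)) (ℚP.*-zeroʳ (γ ^ℚ r))))

-- The specifications of the two algorithms

PowerSumsType : ℕ → ℝ → ℝ → ℕ → Store → Set
PowerSumsType r ε κ n σ =
  fromℕ (outputCount σ) ≤ᴿ κ *ᴿ ln n
  × (Σ[ h ∈ (Vec ℕ n → ℝ) ]
      ((x : Point n) →
        (∑[ i ← allFin (outputCount σ) ] (outputForms σ n i ⟨ x ⟩) ^ᴿ r)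
          ≃ᴿ (∑[ a ← exponents n r ] h a *ᴿ monomial x a))
      × ((a : Vec ℕ n) → sum a ≡ r →
          (1ᴿ -ᴿ ε) ^ᴿ r ≤ᴿ h a × h a ≤ᴿ (1ᴿ +ᴿ ε) ^ᴿ r))

ProductSumsType : ℕ → ℝ → ℝ → ℕ → Store → Set
ProductSumsType r ε κ n σ =
  fromℕ (outputCount σ) ≤ᴿ κ *ᴿ ln n
  × (Σ[ e ∈ (Subset n → ℝ) ]
      ((x : Point n) →
        (∑[ i ← allFin (outputCount σ) ] ∏[ j ← allFin r ] outputFormFamily σ r n i j ⟨ x ⟩)
          ≃ᴿ (∑[ I ← subsets n r ] e I *ᴿ squarefree x I))
      × ((I : Subset n) → ∣ I ∣ ≡ r →
          (1ᴿ -ᴿ ε) ^ᴿ r ≤ᴿ e I × e I ≤ᴿ (1ᴿ +ᴿ ε) ^ᴿ r))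

-- Abstract, because comparing two instances unfolds the Cauchy sequences.
abstract

  PowerSums : ℕ → ℝ → ℝ → ℕ → Store → Set
  PowerSums = PowerSumsType

  ProductSums : ℕ → ℝ → ℝ → ℕ → Store → Set
  ProductSums = ProductSumsType

  power-sums : ∀ {r ε κ n σ} → PowerSumsType r ε κ n σ → PowerSums r ε κ n σ
  power-sums p = p

  power-sums⁻¹ : ∀ {r ε κ n σ} → PowerSums r ε κ n σ → PowerSumsType r ε κ n σ
  power-sums⁻¹ p = p

  product-sums : ∀ {r ε κ n σ} → ProductSumsType r ε κ n σ → ProductSums r ε κ n σ
  product-sums p = p

  product-sums⁻¹ : ∀ {r ε κ n σ} → ProductSums r ε κ n σ → ProductSumsType r ε κ n σ
  product-sums⁻¹ p = p

-- The program meets its specification for all constants from some point on, so that one κ can be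
-- chosen for (a) and (b) together.
Solvable : (ℝ → ℕ → Store → Set) → Set
Solvable Spec = ∃[ P ] ∃[ c₀ ] (∀ c → c₀ ≤ c → PolyTime P (Spec (fromℕ (c * 2))))

-- Sums of powers of linear forms

module PowerSum (r′ X Y : ℕ) {ε : ℝ} (win : Window ε X Y) where

  r : ℕ
  r = suc r′

  module Size = SampleSize r X
  open Size using (b; M; q; d)

  instance
    q≢0 : NonZero q
    q≢0 = Size.size≢0
    Y≢0 : NonZero Y
    Y≢0 = Window.Y≢0 win
    b+r≢0 : NonZero (b + r)
    b+r≢0 = >-nonZero (≤-trans (s≤s z≤n) (m≤n+m r b))
    ρ≢0 : NonZero (r + M + b + r)
    ρ≢0 = >-nonZero (≤-trans (s≤s z≤n) (m≤n+m r (r + M + b)))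

  module Sch = Scheme r′ q X Y (suc b) (b + r) M (r + M + b + r) {{q≢0}} {{Y≢0}} {{b+r≢0}} {{ρ≢0}} Size.ratio
  open Sch using (κ; A; δ; c₀; hi; lo; coefficient)

  out : ℕ → ℕ → ℕ
  out _ c = c₀ * d c

  module Alg = Algorithm r q 1 δ κ A {{q≢0}} (s≤s z≤n) out

  module _ {n : ℕ} {σ : Store} {s w : ℕ} (log : IsLog n s) (root : IsRoot r s w) (em : Alg.Emitted n (κ * w ^ r) w σ) where

    open Alg.Emitted em

    private
      k : ℕ
      k = outputCount σ
      γ : ℚ
      γ = coefficient w
      instance
        w≢0 : NonZero w
        w≢0 = >-nonZero (IsRoot.pos root)

    rows : Vec ℕ n → ℕ
    rows a = sumTo k (λ i → rowProduct d f i 0 a)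

    total : Vec ℕ n → ℕ
    total a = multinomial r a * rows a

    form-value : ∀ i j m → seq (outputForms σ n i j) m ≡ γ ℚ.* ι (valueAt d (f (toℕ i) (toℕ j)))
    form-value i j m with Coloured.colour is-coloured (toℕ i) (toℕ j) (subst (toℕ i <_) count-cell (toℕ<n i)) (toℕ<n j)
    ... | c , _ , eq = begin
      seq (outputCoeff σ (toℕ (combine i j))) m
        ≡⟨ outputCoeff-value σ (toℕ (combine i j)) (c₀ * d c) (δ * w ∸ 1) m
             (trans (cong (σ 1) place) (numerator i<k (s≤s z≤n) (toℕ<n j) eq))
             (nothing (toℕ (combine i j)))
             (trans (cong (σ 3) place) (denominator i<k (s≤s z≤n) (toℕ<n j))) ⟩
      frac (c₀ * d c) (δ * w ∸ 1)               ≡⟨ frac-* c₀ (d c) (δ * w ∸ 1) ⟨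
      γ ℚ.* ι (d c)                             ≡⟨ cong (λ z → γ ℚ.* ι (valueAt d z)) eq ⟨
      γ ℚ.* ι (valueAt d (f (toℕ i) (toℕ j)))   ∎
      where
      open ≡-Reasoning
      i<k : toℕ i < κ * w ^ r
      i<k = subst (toℕ i <_) count-cell (toℕ<n i)
      place : toℕ (combine i j) ≡ n * (1 * toℕ i + 0) + toℕ j
      place = trans (toℕ-combine i j) (cong (λ z → n * z + toℕ j)
        (sym (trans (+-identityʳ (1 * toℕ i)) (*-identityˡ (toℕ i)))))

    expansion : (x : Point n) → (∑[ i ← allFin k ] (outputForms σ n i ⟨ x ⟩) ^ᴿ r)
                ≃ᴿ (∑[ a ← exponents n r ] fromℚ (γ ^ℚ r ℚ.* ι (total a)) *ᴿ monomial x a)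
    expansion x = pointwise-≃
      {∑[ i ← allFin k ] (outputForms σ n i ⟨ x ⟩) ^ᴿ r}
      {∑[ a ← exponents n r ] fromℚ (γ ^ℚ r ℚ.* ι (total a)) *ᴿ monomial x a} λ m → begin
      seq (∑[ i ← allFin k ] (outputForms σ n i ⟨ x ⟩) ^ᴿ r) m
        ≡⟨ trans (seq-∑ (allFin k) (λ i → (outputForms σ n i ⟨ x ⟩) ^ᴿ r) m)
             (∑ℚ-tabulate (λ i → i) (λ i → seq ((outputForms σ n i ⟨ x ⟩) ^ᴿ r) m)) ⟩
      ∑ᶠ k (λ i → seq ((outputForms σ n i ⟨ x ⟩) ^ᴿ r) m)
        ≡⟨ ∑ᶠ-cong k (λ i → trans (seq-^ (outputForms σ n i ⟨ x ⟩) r m) (cong (_^ℚ r)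
             (trans (seq-form (outputForms σ n i) x m)
               (∑ᶠ-cong n (λ j → cong (ℚ._* seq (x j) m) (form-value i j m)))))) ⟩
      ∑ᶠ k (λ i → (∑ᶠ n (λ j → (γ ℚ.* ι (valueAt d (f (toℕ i) (toℕ j)))) ℚ.* seq (x j) m)) ^ℚ r)
        ≡⟨ power-sum-expansion γ d f k n r (λ j → seq (x j) m) ⟩
      ∑ℚ (exponents n r) (λ a → (γ ^ℚ r ℚ.* ι (total a)) ℚ.* ∏ᶠ n (λ j → seq (x j) m ^ℚ lookup a j))
        ≡⟨ ∑ℚ-cong (exponents n r) (λ a → cong ((γ ^ℚ r ℚ.* ι (total a)) ℚ.*_) (seq-monomial x a m)) ⟨
      ∑ℚ (exponents n r) (λ a → (γ ^ℚ r ℚ.* ι (total a)) ℚ.* seq (monomial x a) m)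
        ≡⟨ seq-∑ (exponents n r) (λ a → fromℚ (γ ^ℚ r ℚ.* ι (total a)) *ᴿ monomial x a) m ⟨
      seq (∑[ a ← exponents n r ] fromℚ (γ ^ℚ r ℚ.* ι (total a)) *ᴿ monomial x a) m ∎
      where open ≡-Reasoning

    private
      module B = Sch.Balanced log root is-coloured balanced
      module Up = Squeeze _≤_ ≤-refl +-mono-≤ (λ c → *-monoʳ-≤ c) is-coloured r (hi w) B.upper
      module Low = Squeeze _≥_ ≤-refl +-mono-≤ (λ c → *-monoʳ-≤ c) is-coloured r (lo w) B.lower

      rows≡ : ∀ a → sumTo (κ * w ^ r) (λ i → 1 * rowProduct d f i 0 a) ≡ rows a
      rows≡ a = trans (sumTo-cong (κ * w ^ r) (λ i _ → *-identityˡ _))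
        (cong (λ k → sumTo k (λ i → rowProduct d f i 0 a)) (sym count-cell))

      rows-upper : ∀ a → sum a ≡ r → rows a * q ^ n ≤ hi w * momentProduct q d a
      rows-upper a sum≡ = subst (_≤ hi w * momentProduct q d a) (cong₂ _*_ (rows≡ a) (*-identityˡ (q ^ n)))
        (Up.rowSum-≼ d [] a [] z≤n ≤-refl (≤-reflexive sum≡))

      rows-lower : ∀ a → sum a ≡ r → lo w * momentProduct q d a ≤ rows a * q ^ n
      rows-lower a sum≡ = subst (lo w * momentProduct q d a ≤_) (cong₂ _*_ (rows≡ a) (*-identityˡ (q ^ n)))
        (Low.rowSum-≼ d [] a [] z≤n ≤-refl (≤-reflexive sum≡))

      weights : ∀ (a : Vec ℕ n) → sum a ≡ r → multinomial r a * factorials a ≡ r !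
      weights a sum≡ = subst (λ t → multinomial t a * factorials a ≡ t !) sum≡ (multinomial-factorials a)

      instance
        q^n≢0 : NonZero (q ^ n)
        q^n≢0 = m^n≢0 q n

    private
      rearrange₁ : ∀ a b c d → a * b * c * d ≡ a * (b * d) * c
      rearrange₁ = solve-∀
      rearrange₂ : ∀ a b c d → a * (b * c) * d ≡ a * b * (c * d)
      rearrange₂ = solve-∀
      rearrange₃ : ∀ a b c d e → a * b * (c * d * e) ≡ b * (a * c) * e * d
      rearrange₃ = solve-∀

    -- Two estimates are chained, row products against products of moments and these against
    -- factorials. Both carry a factor `q ^ n`, which cancels at the end.
    total-upper : ∀ a → sum a ≡ r → total a * suc b ^ r ≤ hi w * r ! * (r + M + b + r) ^ r
    total-upper a sum≡ = *-cancelʳ-≤ _ _ (q ^ n) {{q^n≢0}} (begin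
      N * rows a * suc b ^ r * q ^ n                   ≡⟨ rearrange₁ N (rows a) (suc b ^ r) (q ^ n) ⟩
      N * (rows a * q ^ n) * suc b ^ r                 ≤⟨ *-monoˡ-≤ (suc b ^ r) (*-monoʳ-≤ N (rows-upper a sum≡)) ⟩
      N * (hi w * P) * suc b ^ r                       ≡⟨ rearrange₂ N (hi w) P (suc b ^ r) ⟩
      N * hi w * (P * suc b ^ r)                       ≤⟨ *-monoʳ-≤ (N * hi w) products ⟩
      N * hi w * (factorials a * q ^ n * ρ ^ r)        ≡⟨ rearrange₃ N (hi w) (factorials a) (q ^ n) (ρ ^ r) ⟩
      hi w * (N * factorials a) * ρ ^ r * q ^ n        ≡⟨ cong (λ z → hi w * z * ρ ^ r * q ^ n) (weights a sum≡) ⟩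
      hi w * r ! * ρ ^ r * q ^ n                       ∎)
      where
      open ≤-Reasoning
      N P ρ : ℕ
      N = multinomial r a
      P = momentProduct q d a
      ρ = r + M + b + r
      products : P * suc b ^ r ≤ factorials a * q ^ n * ρ ^ r
      products = subst (λ t → P * suc b ^ t ≤ factorials a * q ^ n * ρ ^ t) sum≡
        (Size.products-upper a (≤-reflexive sum≡))

    total-lower : ∀ a → sum a ≡ r → lo w * r ! * M ^ r ≤ total a * (b + r) ^ r
    total-lower a sum≡ = *-cancelʳ-≤ _ _ (q ^ n) {{q^n≢0}} (begin
      lo w * r ! * M ^ r * q ^ n                       ≡⟨ cong (λ z → lo w * z * M ^ r * q ^ n) (weights a sum≡) ⟨
      lo w * (N * factorials a) * M ^ r * q ^ n        ≡⟨ rearrange₃ N (lo w) (factorials a) (q ^ n) (M ^ r) ⟨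
      N * lo w * (factorials a * q ^ n * M ^ r)        ≤⟨ *-monoʳ-≤ (N * lo w) products ⟩
      N * lo w * (P * (b + r) ^ r)                     ≡⟨ rearrange₂ N (lo w) P ((b + r) ^ r) ⟨
      N * (lo w * P) * (b + r) ^ r                     ≤⟨ *-monoˡ-≤ ((b + r) ^ r) (*-monoʳ-≤ N (rows-lower a sum≡)) ⟩
      N * (rows a * q ^ n) * (b + r) ^ r               ≡⟨ rearrange₁ N (rows a) ((b + r) ^ r) (q ^ n) ⟨
      N * rows a * (b + r) ^ r * q ^ n                 ∎)
      where
      open ≤-Reasoning
      N P : ℕ
      N = multinomial r a
      P = momentProduct q d a
      products : factorials a * q ^ n * M ^ r ≤ P * (b + r) ^ r
      products = subst (λ t → factorials a * q ^ n * M ^ t ≤ P * (b + r) ^ t) sum≡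
        (Size.products-lower a (≤-reflexive sum≡))

    few : ∀ {c} → κ * 2 ^ r ≤ c → fromℕ k ≤ᴿ fromℕ (c * 2) *ᴿ ln n
    few {c} le = subst (λ k → fromℕ k ≤ᴿ fromℕ (c * 2) *ᴿ ln n) (sym count-cell) (Sch.count-≤-ln log root le)

    close : ∀ a → sum a ≡ r →
      (1ᴿ -ᴿ ε) ^ᴿ r ≤ᴿ fromℚ (γ ^ℚ r ℚ.* ι (total a)) × fromℚ (γ ^ℚ r ℚ.* ι (total a)) ≤ᴿ (1ᴿ +ᴿ ε) ^ᴿ r
    close a sum≡ = Sch.Scaled.bounds-hold w (total a) (total-upper a sum≡) (total-lower a sum≡) win

    spec : ∀ {c} → κ * 2 ^ r ≤ c → PowerSums r ε (fromℕ (c * 2)) n σ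
    spec le = power-sums (few le , (λ a → fromℚ (γ ^ℚ r ℚ.* ι (total a))) , expansion , close)

  solvable : Solvable (PowerSums r ε)
  solvable = Alg.program , κ * 2 ^ r , λ c le →
    Alg.program-polytime {PowerSums r ε (fromℕ (c * 2))} (λ { n σ _ (s , w , log , root , em) → spec log root em le })

-- Sums of products of linear forms

size-∣∣ : ∀ {n} (I : Subset n) → size I ≡ ∣ I ∣
size-∣∣ []            = refl
size-∣∣ (inside ∷ I)  = cong suc (size-∣∣ I)
size-∣∣ (outside ∷ I) = size-∣∣ I

module ProductSum (r′ X Y : ℕ) {ε : ℝ} (win : Window ε X Y) where

  r : ℕ
  r = suc r′

  U : List ℕ
  U = colours-of r

  instance
    Y≢0 : NonZero Y
    Y≢0 = Window.Y≢0 win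

  -- No moments occur here. Both β and b₀ are r, to account for the factor q^r = r^r by which counts
  -- of patterns of length r are multiplied, and `ratio` holds with room to spare.
  module Sch = Scheme r′ r X Y r r 1 1 {{_}} {{Y≢0}} (*-monoˡ-≤ (r * 1) (+-monoʳ-≤ (2 * X) (n≤1+n 1)))
  open Sch using (κ; A; δ; c₀; hi; lo; coefficient)

  out : ℕ → ℕ → ℕ
  out τ c = c₀ * isColour τ (suc c)

  module Alg = Algorithm r r r δ κ A (s≤s z≤n) out

  module _ {n : ℕ} {σ : Store} {s w : ℕ} (log : IsLog n s) (root : IsRoot r s w) (em : Alg.Emitted n (κ * w ^ r) w σ) where

    open Alg.Emitted em

    private
      k : ℕ
      k = outputCount σ
      γ : ℚ
      γ = coefficient w

    total : Subset n → ℕ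
    total I = sumTo k (λ i → bijections f i 0 U I)

    form-value : ∀ i τ j m →
      seq (outputFormFamily σ r n i τ j) m ≡ γ ℚ.* ι (isColour (toℕ τ) (f (toℕ i) (toℕ j)))
    form-value i τ j m with Coloured.colour is-coloured (toℕ i) (toℕ j) (subst (toℕ i <_) count-cell (toℕ<n i)) (toℕ<n j)
    ... | c , _ , eq = begin
      seq (outputCoeff σ p) m
        ≡⟨ outputCoeff-value σ p (c₀ * isColour (toℕ τ) (suc c)) (δ * w ∸ 1) m
             (trans (cong (σ 1) place) (numerator i<k (toℕ<n τ) (toℕ<n j) eq))
             (nothing p)
             (trans (cong (σ 3) place) (denominator i<k (toℕ<n τ) (toℕ<n j))) ⟩
      frac (c₀ * isColour (toℕ τ) (suc c)) (δ * w ∸ 1)   ≡⟨ frac-* c₀ (isColour (toℕ τ) (suc c)) (δ * w ∸ 1) ⟨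
      γ ℚ.* ι (isColour (toℕ τ) (suc c))                  ≡⟨ cong (λ z → γ ℚ.* ι (isColour (toℕ τ) z)) eq ⟨
      γ ℚ.* ι (isColour (toℕ τ) (f (toℕ i) (toℕ j)))      ∎
      where
      open ≡-Reasoning
      p : ℕ
      p = toℕ (combine (combine i τ) j)
      i<k : toℕ i < κ * w ^ r
      i<k = subst (toℕ i <_) count-cell (toℕ<n i)
      place : p ≡ n * (r * toℕ i + toℕ τ) + toℕ j
      place = trans (toℕ-combine (combine i τ) j) (cong (λ z → n * z + toℕ j) (toℕ-combine i τ))

    expansion : (x : Point n) → (∑[ i ← allFin k ] ∏[ j ← allFin r ] outputFormFamily σ r n i j ⟨ x ⟩)
                ≃ᴿ (∑[ I ← subsets n r ] fromℚ (γ ^ℚ r ℚ.* ι (total I)) *ᴿ squarefree x I)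
    expansion x = pointwise-≃
      {∑[ i ← allFin k ] ∏[ j ← allFin r ] outputFormFamily σ r n i j ⟨ x ⟩}
      {∑[ I ← subsets n r ] fromℚ (γ ^ℚ r ℚ.* ι (total I)) *ᴿ squarefree x I} λ m → begin
      seq (∑[ i ← allFin k ] ∏[ j ← allFin r ] outputFormFamily σ r n i j ⟨ x ⟩) m
        ≡⟨ trans (seq-∑ (allFin k) (λ i → ∏[ j ← allFin r ] outputFormFamily σ r n i j ⟨ x ⟩) m)
             (∑ℚ-tabulate (λ i → i) (λ i → seq (∏[ j ← allFin r ] outputFormFamily σ r n i j ⟨ x ⟩) m)) ⟩
      ∑ᶠ k (λ i → seq (∏[ j ← allFin r ] outputFormFamily σ r n i j ⟨ x ⟩) m)
        ≡⟨ ∑ᶠ-cong k (λ i → trans (seq-∏ (allFin r) (λ j → outputFormFamily σ r n i j ⟨ x ⟩) m)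
             (∏ℚ-cong (allFin r) (λ τ → trans (seq-form (outputFormFamily σ r n i τ) x m)
               (∑ᶠ-cong n (λ j → cong (ℚ._* seq (x j) m) (form-value i τ j m)))))) ⟩
      ∑ᶠ k (λ i → ∏ℚ (allFin r) (λ τ → ∑ᶠ n (λ j →
        (γ ℚ.* ι (isColour (toℕ τ) (f (toℕ i) (toℕ j)))) ℚ.* seq (x j) m)))
        ≡⟨ product-sum-expansion γ f k n r (λ j → seq (x j) m) ⟩
      ∑ℚ (subsets n r) (λ I → (γ ^ℚ r ℚ.* ι (total I)) ℚ.* squarefreeᶠ (λ j → seq (x j) m) I)
        ≡⟨ ∑ℚ-cong (subsets n r) (λ I → cong ((γ ^ℚ r ℚ.* ι (total I)) ℚ.*_) (seq-squarefree x I m)) ⟨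
      ∑ℚ (subsets n r) (λ I → (γ ^ℚ r ℚ.* ι (total I)) ℚ.* seq (squarefree x I) m)
        ≡⟨ seq-∑ (subsets n r) (λ I → fromℚ (γ ^ℚ r ℚ.* ι (total I)) *ᴿ squarefree x I) m ⟨
      seq (∑[ I ← subsets n r ] fromℚ (γ ^ℚ r ℚ.* ι (total I)) *ᴿ squarefree x I) m ∎
      where open ≡-Reasoning

    private
      module B = Sch.Balanced log root is-coloured balanced
      module Up = Squeeze _≤_ ≤-refl +-mono-≤ (λ c → *-monoʳ-≤ c) is-coloured r (hi w) B.upper
      module Low = Squeeze _≥_ ≤-refl +-mono-≤ (λ c → *-monoʳ-≤ c) is-coloured r (lo w) B.lower

      total≡ : ∀ I → sumTo (κ * w ^ r) (λ i → 1 * bijections f i 0 U I) * r ^ length U ≡ total I * r ^ r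
      total≡ I = cong₂ _*_ (trans (sumTo-cong (κ * w ^ r) (λ i _ → *-identityˡ _))
        (cong (λ k → sumTo k (λ i → bijections f i 0 U I)) (sym count-cell))) (cong (r ^_) (colours-length r))

      bound≡ : ∀ c → c * length U ! ≡ c * r ! * 1 ^ r
      bound≡ c = trans (cong (λ l → c * l !) (colours-length r))
        (sym (trans (cong (c * r ! *_) (^-zeroˡ r)) (*-identityʳ (c * r !))))

      sizes : ∀ (I : Subset n) → ∣ I ∣ ≡ r → length U ≡ size I
      sizes I card = trans (colours-length r) (sym (trans (size-∣∣ I) card))

    total-upper : ∀ I → ∣ I ∣ ≡ r → total I * r ^ r ≤ hi w * r ! * 1 ^ r
    total-upper I card = subst₂ _≤_ (total≡ I) (bound≡ (hi w))
      (Up.bijectionSum-≼ [] U I [] z≤n ≤-refl (colours-< r) (sizes I card) (≤-reflexive (colours-length r)))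

    total-lower : ∀ I → ∣ I ∣ ≡ r → lo w * r ! * 1 ^ r ≤ total I * r ^ r
    total-lower I card = subst₂ _≤_ (bound≡ (lo w)) (total≡ I)
      (Low.bijectionSum-≼ [] U I [] z≤n ≤-refl (colours-< r) (sizes I card) (≤-reflexive (colours-length r)))

    few : ∀ {c} → κ * 2 ^ r ≤ c → fromℕ k ≤ᴿ fromℕ (c * 2) *ᴿ ln n
    few {c} le = subst (λ k → fromℕ k ≤ᴿ fromℕ (c * 2) *ᴿ ln n) (sym count-cell) (Sch.count-≤-ln log root le)

    close : ∀ I → ∣ I ∣ ≡ r →
      (1ᴿ -ᴿ ε) ^ᴿ r ≤ᴿ fromℚ (γ ^ℚ r ℚ.* ι (total I)) × fromℚ (γ ^ℚ r ℚ.* ι (total I)) ≤ᴿ (1ᴿ +ᴿ ε) ^ᴿ r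
    close I card = Sch.Scaled.bounds-hold w (total I) {{>-nonZero (IsRoot.pos root)}} (total-upper I card) (total-lower I card) win

    spec : ∀ {c} → κ * 2 ^ r ≤ c → ProductSums r ε (fromℕ (c * 2)) n σ
    spec le = product-sums (few le , (λ I → fromℚ (γ ^ℚ r ℚ.* ι (total I))) , expansion , close)

  solvable : Solvable (ProductSums r ε)
  solvable = Alg.program , κ * 2 ^ r , λ c le →
    Alg.program-polytime {ProductSums r ε (fromℕ (c * 2))} (λ { n σ _ (s , w , log , root , em) → spec log root em le })

-- One constant for both algorithms

fromℕ-pos : ∀ c → 0ᴿ <ᴿ fromℕ (suc c)
fromℕ-pos c = 1ℚ , ℚP.positive⁻¹ 1ℚ , 0 , λ _ _ → subst₂ ℚ._≤_
  (trans ι1 (sym (ℚP.+-identityˡ 1ℚ))) (ι-def (suc c)) (ι-mono (s≤s z≤n))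

both-solvable : ∀ {Spec Spec′ : ℝ → ℕ → Store → Set} → Solvable Spec → Solvable Spec′ →
  ∃[ κ ] (0ᴿ <ᴿ κ × (∃[ P ] PolyTime P (Spec κ)) × (∃[ P ] PolyTime P (Spec′ κ)))
both-solvable (P , c , poly) (P′ , c′ , poly′) =
  fromℕ (suc (c + c′) * 2) , fromℕ-pos (suc ((c + c′) * 2)) ,
  (P , poly (suc (c + c′)) (m≤n⇒m≤1+n (m≤m+n c c′))) ,
  (P′ , poly′ (suc (c + c′)) (m≤n⇒m≤1+n (m≤n+m c′ c)))

polyTime-map : ∀ {P} {Spec Spec′ : ℕ → Store → Set} → (∀ n σ → Spec n σ → Spec′ n σ) →
               PolyTime P Spec → PolyTime P Spec′
polyTime-map f (c , d , run) = c , d , λ n 2≤n →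
  let σ , t , halts , t≤ , spec = run n 2≤n in σ , t , halts , t≤ , f n σ spec

from-window : ∀ r′ {ε} → ∃[ X ] ∃[ Y ] Window ε X Y → ∃[ κ ] (0ᴿ <ᴿ κ ×
  (∃[ P ] PolyTime P (PowerSums (suc r′) ε κ)) × (∃[ P ] PolyTime P (ProductSums (suc r′) ε κ)))
from-window r′ {ε} (X , Y , win) = both-solvable {PowerSums (suc r′) ε} {ProductSums (suc r′) ε}
  (PowerSum.solvable r′ X Y win) (ProductSum.solvable r′ X Y win)

mainTheorem7 : (r : ℕ) → r ≥ 1 → (ε : ℝ) → 0ᴿ <ᴿ ε →
    ∃[ κ ] (0ᴿ <ᴿ κ
    × (∃[ P ] PolyTime P (λ n σ →
    let k = outputCount σ
        ℓ = outputForms σ n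
    in fromℕ k ≤ᴿ κ *ᴿ ln n
    × (Σ[ h ∈ (Vec ℕ n → ℝ) ]
    ((x : Point n) →
    (∑[ i ← allFin k ] (ℓ i ⟨ x ⟩) ^ᴿ r)
    ≃ᴿ (∑[ a ← exponents n r ] h a *ᴿ monomial x a))
    × ((a : Vec ℕ n) → sum a ≡ r →
    (1ᴿ -ᴿ ε) ^ᴿ r ≤ᴿ h a × h a ≤ᴿ (1ᴿ +ᴿ ε) ^ᴿ r))))
    × (∃[ P ] PolyTime P (λ n σ →
    let k = outputCount σ
        ℓ = outputFormFamily σ r n
    in fromℕ k ≤ᴿ κ *ᴿ ln n
    × (Σ[ e ∈ (Subset n → ℝ) ]
    ((x : Point n) →
    (∑[ i ← allFin k ] ∏[ j ← allFin r ] ℓ i j ⟨ x ⟩)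
    ≃ᴿ (∑[ I ← subsets n r ] e I *ᴿ squarefree x I))
    × ((I : Subset n) → ∣ I ∣ ≡ r →
    (1ᴿ -ᴿ ε) ^ᴿ r ≤ᴿ e I × e I ≤ᴿ (1ᴿ +ᴿ ε) ^ᴿ r)))))
mainTheorem7 (suc r′) _ ε 0<ε =
  let κ , 0<κ , (P , poly) , (P′ , poly′) = from-window r′ (window ε 0<ε) in
  κ , 0<κ , (P , polyTime-map (λ n σ → power-sums⁻¹) poly) ,
            (P′ , polyTime-map (λ n σ → product-sums⁻¹) poly′)
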